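{- For every even integer $n\ge 342$ there exists a cyclically $6$-connected strictly critical snark of order $n$.
   Context: A snark is a connected cubic graph with chromatic index $4$ (i.e. it admits no proper $3$-edge-colouring). A snark is critical if, for every pair of distinct adjacent vertices, the graph obtained by removing these two vertices is $3$-edge-colourable; it is bicritical if the same holds for every pair of distinct vertices; it is strictly critical if it is critical but not bicritical. A cubic graph is cyclically $k$-connected if no set of fewer than $k$ edges separates two cycles of the graph from each other (i.e. no edge cut of size less than $k$ has a cycle on each side). -}

module Defs where

open import Data.Nat using (ℕ; zero; suc; _+_; _≤_)
open import Data.Bool using (Bool; true; false; not; T)
open import Data.Fin using (Fin; zero; suc)
open import Data.List using (List; []; _∷_; _++_; [_]; length)
open import Data.List.Relation.Unary.All using (All)
open import Data.List.Relation.Unary.Unique.Propositional using (Unique)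
open import Data.Product using (Σ; _×_; _,_)
open import Data.Sum using (_⊎_)
open import Data.Unit using (⊤)
open import Relation.Nullary using (¬_)
open import Relation.Binary.PropositionalEquality using (_≡_; _≢_)

EdgeColouring : {V : Set} → (V → V → Set) → ℕ → Set
EdgeColouring {V} Adj k =
  Σ ((u v : V) → Adj u v → Fin k) λ c →
    ((u v : V) (e : Adj u v) (e' : Adj v u) → c u v e ≡ c v u e')
  × ((u v w : V) (e : Adj u v) (f : Adj u w) → v ≢ w → c u v e ≢ c u w f)

EdgeColourable : {V : Set} → (V → V → Set) → ℕ → Set
EdgeColourable Adj k = EdgeColouring Adj k

Cubic : {V : Set} → (V → V → Set) → Set
Cubic {V} Adj = (v : V) → Σ V λ a → Σ V λ b → Σ V λ c →
  (a ≢ b × a ≢ c × b ≢ c)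
  × (Adj v a × Adj v b × Adj v c)
  × ((w : V) → Adj v w → (w ≡ a ⊎ w ≡ b ⊎ w ≡ c))

data Reach {V : Set} (Adj : V → V → Set) : V → V → Set where
  here : {u : V} → Reach Adj u u
  step : {u v w : V} → Adj u v → Reach Adj v w → Reach Adj u w

Connected : {V : Set} → (V → V → Set) → Set
Connected {V} Adj = (u v : V) → Reach Adj u v

Chain : {V : Set} → (V → V → Set) → List V → Set
Chain Adj [] = ⊤
Chain Adj (x ∷ []) = ⊤
Chain Adj (x ∷ y ∷ ys) = Adj x y × Chain Adj (y ∷ ys)

HasCycleIn : {V : Set} → (V → V → Set) → (V → Set) → Set
HasCycleIn {V} Adj P = Σ V λ x → Σ (List V) λ ys →
  (2 ≤ length ys) × Unique (x ∷ ys) × All P (x ∷ ys)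
  × Chain Adj (x ∷ ys ++ [ x ])

Minus2 : {V : Set} → V → V → Set
Minus2 {V} x y = Σ V λ v → (v ≢ x × v ≢ y)

AdjMinus2 : {V : Set} → (V → V → Set) → (x y : V) → Minus2 x y → Minus2 x y → Set
AdjMinus2 Adj x y (u , _) (v , _) = Adj u v

record Graph (n : ℕ) : Set where
  field
    adj    : Fin n → Fin n → Bool
    sym    : (u v : Fin n) → adj u v ≡ adj v u
    irrefl : (v : Fin n) → adj v v ≡ false

Adj : {n : ℕ} → Graph n → Fin n → Fin n → Set
Adj G u v = T (Graph.adj G u v)

sumFin : {n : ℕ} → (Fin n → ℕ) → ℕ
sumFin {zero} f = 0
sumFin {suc n} f = f zero + sumFin (λ i → f (suc i))

b2n : Bool → ℕ
b2n true = 1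
b2n false = 0

_∧_ : Bool → Bool → Bool
true ∧ b = b
false ∧ b = false

cutSize : {n : ℕ} → Graph n → (Fin n → Bool) → ℕ
cutSize G S = sumFin λ u → sumFin λ v →
  b2n (Graph.adj G u v ∧ (S u ∧ not (S v)))

CyclicallyConnected : {n : ℕ} → ℕ → Graph n → Set
CyclicallyConnected k G = (S : Fin _ → Bool) →
  HasCycleIn (Adj G) (λ v → T (S v)) →
  HasCycleIn (Adj G) (λ v → T (not (S v))) →
  k ≤ cutSize G S

Snark : {n : ℕ} → Graph n → Set
Snark G = Connected (Adj G) × Cubic (Adj G)
  × EdgeColourable (Adj G) 4 × ¬ EdgeColourable (Adj G) 3

Critical : {n : ℕ} → Graph n → Set
Critical {n} G = Snark G × ((u v : Fin n) → u ≢ v → Adj G u v →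
  EdgeColourable (AdjMinus2 (Adj G) u v) 3)

Bicritical : {n : ℕ} → Graph n → Set
Bicritical {n} G = Snark G × ((u v : Fin n) → u ≢ v →
  EdgeColourable (AdjMinus2 (Adj G) u v) 3)

StrictlyCritical : {n : ℕ} → Graph n → Set
StrictlyCritical G = Critical G × ¬ Bicritical G

-- The graph is a ring of small blocks: 45 fixed pieces (vertices and six-port slots, each slot filled with a cut J5 or a cut
-- double-star snark) closed up by a chain of m + 2 eight-vertex blocks of flower type; filling ρ slots the second way gives 300 + 10ρ
-- fixed vertices, and ρ ≤ 3 realises every even order from 342 on.
-- Cyclic connectivity: an edge cut of size k < 6 has a side on which no cycle fits by the edge count of a cubic graph, once the sides
-- satisfy |S| + 2 ≤ k. This is proved by dynamic programming over the blocks: the states of a partial graph record the sides of its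
-- dangling edges, the cut edges so far and the truncated sizes of the two sides, and the chain is treated by an invariant set of states.
-- Colourings: a slot transmits a nonzero element of the Klein group, which forces two edges of each third of the ring to agree, and then
-- the chain cannot be closed. The argument does not use the two vertices s and t, so the graph minus s, t is uncolourable as well.
-- Criticality: 3-edge-colourings of the graph minus two adjacent vertices are flows with a single zero edge, given by explicit certificates.
module Submission where

open import Defs
open import Data.Nat using (ℕ; _≤_)
open import Data.Nat.Divisibility using (_∣_)
open import Data.Product using (Σ; _×_)

-- A slot is a snark with two vertices cut out, three ports for each. By conservation in the Klein
-- group both triples of ports have the same sum; sum zero would make each triple three different
-- colours, and putting the vertices back would 3-colour the snark. So the sum is nonzero, and stays
-- so after every leg tapped from the ring of slots. Each third spends this on a zigzag of four legs
-- whose two ends must then agree, so that a vertex between zigzag and chain sees different colours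
-- on a head and on a tail strand. The pairing of heads with tails exchanges two strands: the chain
-- meets the twist of a flower snark.
--
-- The obstacle is that infinitely many graphs have to be settled by finite evaluation. Hence the
-- two fillings share one table of cuts and one set of flows, and a flow paints the chain with only
-- three colour triples, before, at and after one movable place, so that the blocks on either side
-- of it can be repeated at will.
--
-- The three vertices of the ring between two thirds belong to no zigzag; `s` and `t` are two of
-- them, which is what makes the criticality strict.

module Gluing where
 open import Defs using (sumFin)
 open import Data.Fin using (Fin; zero; suc)
 open import Data.List.Relation.Unary.All.Properties using (tabulate⁺)
 open import Data.Nat using (ℕ; zero; suc; _+_; _≤_; _<_; _<ᵇ_; z≤n; s≤s⁻¹)
 open import Data.Nat.Properties
 open import Data.Bool using (Bool; true; false; if_then_else_; T)
 open import Data.List using (List; []; _∷_; _++_; map; drop; take; tabulate)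
 open import Data.List.Properties using (map-++; drop-map; take-map)
 open import Data.List.Relation.Unary.Any as Any using (Any; here; there)
 open import Data.List.Relation.Unary.All using (All; []; _∷_)
 open import Data.Product using (Σ; _×_; _,_; proj₁; proj₂)
 open import Data.Sum using (_⊎_; inj₁; inj₂)
 open import Data.Unit using (⊤; tt)
 open import Data.Empty
 open import Relation.Binary.PropositionalEquality
 open import Data.Nat.Tactic.RingSolver using (solve-∀)

 -- Gluing partial graphs: states, dominance and soundness.

 <ᵇ-true : ∀ m n → (m <ᵇ n) ≡ true → m < n
 <ᵇ-true m n e = <ᵇ⇒< m n (subst T (sym e) tt)

 <ᵇ-false : ∀ m n → (m <ᵇ n) ≡ false → n ≤ m
 <ᵇ-false m n e = ≮⇒≥ λ p → subst T e (<⇒<ᵇ p)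

 infixr 6 _&_
 _&_ : Bool → Bool → Bool
 true & b = b
 false & b = false

 &-fst : ∀ {a b} → (a & b) ≡ true → a ≡ true
 &-fst {true} e = refl

 &-snd : ∀ {a b} → (a & b) ≡ true → b ≡ true
 &-snd {true} e = e

 record Wt : Set where
   constructor ⟨_,_,_⟩
   field cst inn out : ℕ
 open Wt public

 -- The more dangerous weight stands on the left: a cheaper cut with larger sides is harder to
 -- declare harmless. A verdict on the states kept therefore holds for every state that they
 -- dominate.
 _⊒_ : Wt → Wt → Set
 y ⊒ x = cst y ≤ cst x × inn x ≤ inn y × out x ≤ out y

 ⊒-trans : ∀ {x y z} → x ⊒ y → y ⊒ z → x ⊒ z
 ⊒-trans (a , b , c) (a' , b' , c') = ≤-trans a a' , ≤-trans b' b , ≤-trans c' c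

 dom : Wt → Wt → Bool
 dom y x = (cst y <ᵇ suc (cst x)) & (inn x <ᵇ suc (inn y)) & (out x <ᵇ suc (out y))

 dom-sound : ∀ y x → dom y x ≡ true → y ⊒ x
 dom-sound y x e = s≤s⁻¹ (<ᵇ-true _ _ (&-fst e)) , s≤s⁻¹ (<ᵇ-true _ _ (&-fst (&-snd {cst y <ᵇ suc (cst x)} e)))
                 , s≤s⁻¹ (<ᵇ-true _ _ (&-snd {inn x <ᵇ suc (inn y)} (&-snd {cst y <ᵇ suc (cst x)} e)))

 anyDom : List Wt → Wt → Bool
 anyDom [] x = false
 anyDom (y ∷ ys) x = if dom y x then true else anyDom ys x

 prune : Wt → List Wt → List Wt
 prune x [] = []
 prune x (y ∷ ys) = if dom x y then prune x ys else y ∷ prune x ys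

 addWt : Wt → List Wt → List Wt
 addWt x ys = if anyDom ys x then ys else x ∷ prune x ys

 Dominated : List Wt → Wt → Set
 Dominated ys x = Any (_⊒ x) ys

 anyDom-sound : ∀ ys x → anyDom ys x ≡ true → Dominated ys x
 anyDom-sound (y ∷ ys) x e with dom y x in q
 ... | true = here (dom-sound y x q)
 ... | false = there (anyDom-sound ys x e)

 prune-sound : ∀ x ys z → Dominated ys z → Dominated (x ∷ prune x ys) z
 prune-sound x (y ∷ ys) z p with dom x y in q
 prune-sound x (y ∷ ys) z (here p) | true = here (⊒-trans (dom-sound x y q) p)
 prune-sound x (y ∷ ys) z (there p) | true = prune-sound x ys z p
 prune-sound x (y ∷ ys) z (here p) | false = there (here p)
 prune-sound x (y ∷ ys) z (there p) | false with prune-sound x ys z p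
 ... | here r = here r
 ... | there r = there (there r)

 addWt-new : ∀ x ys → Dominated (addWt x ys) x
 addWt-new x ys with anyDom ys x in q
 ... | true = anyDom-sound ys x q
 ... | false = here (≤-refl , ≤-refl , ≤-refl)

 addWt-old : ∀ x ys z → Dominated ys z → Dominated (addWt x ys) z
 addWt-old x ys z p with anyDom ys x
 ... | true = p
 ... | false = prune-sound x ys z p

 -- A side with four or more vertices satisfies `s + 2 ≤ k` only from six cut edges on, where
 -- nothing is left to prove, so larger sizes need no distinction.
 cap : ℕ → ℕ
 cap n = if n <ᵇ 4 then n else 4

 cap-≤ : ∀ n → cap n ≤ n
 cap-≤ n with n <ᵇ 4 in e
 ... | true = ≤-refl
 ... | false = <ᵇ-false n 4 e

 cap-≤4 : ∀ n → cap n ≤ 4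
 cap-≤4 n with n <ᵇ 4 in e
 ... | true = <⇒≤ (<ᵇ-true n 4 e)
 ... | false = ≤-refl

 cap-mono : ∀ {m n} → m ≤ n → cap m ≤ cap n
 cap-mono {m} {n} p with n <ᵇ 4 in e
 ... | true = ≤-trans (cap-≤ m) p
 ... | false = cap-≤4 m

 cap-sub : ∀ m n → cap (m + n) ≤ cap (cap m + cap n)
 cap-sub m n with m <ᵇ 4 in e | n <ᵇ 4 in f
 ... | true | true = ≤-refl
 ... | true | false = ≤-trans (cap-≤4 (m + n)) (cap-mono {4} (m≤n+m 4 m))
 ... | false | true = ≤-trans (cap-≤4 (m + n)) (cap-mono {4} (m≤m+n 4 n))
 ... | false | false = cap-≤4 (m + n)

 -- The price `diff` of joining two strands is the only difference between the two uses: 0 or 1 for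
 -- the sides of a cut, 0 or 6 for colours.
 module Engine {A : Set} (eq : A → A → Bool) (eq-sound : ∀ a b → eq a b ≡ true → a ≡ b)
               (diff : A → A → ℕ) where

   record St : Set where
     constructor _∶_
     field lbl : List A
           wt : Wt
   open St public

   -- States with equal labels meet in one node, so dominance is tested only among weights that can
   -- be compared.
   mutual
     data Trie : Set where
       node : List Wt → Kids → Trie
     data Kids : Set where
       none : Kids
       kid : A → Trie → Kids → Kids

   single : List A → Wt → Trie
   single [] w = node (w ∷ []) none
   single (a ∷ as) w = node [] (kid a (single as w) none)

   mutual
     insert : List A → Wt → Trie → Trie
     insert [] w (node ws ks) = node (addWt w ws) ks
     insert (a ∷ as) w (node ws ks) = node ws (insertK a as w ks)

     insertK : A → List A → Wt → Kids → Kids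
     insertK a as w none = kid a (single as w) none
     insertK a as w (kid b t ks) = if eq a b then kid b (insert as w t) ks else kid b t (insertK a as w ks)

   revOnto : List A → List A → List A
   revOnto [] bs = bs
   revOnto (a ∷ as) bs = revOnto as (a ∷ bs)

   leaves : List A → List Wt → List St → List St
   leaves p [] r = r
   leaves p (w ∷ ws) r = (p ∶ w) ∷ leaves p ws r

   mutual
     list : List A → Trie → List St → List St
     list p (node ws ks) r = leaves (revOnto p []) ws (listK p ks r)

     listK : List A → Kids → List St → List St
     listK p none r = r
     listK p (kid a t ks) r = list (a ∷ p) t (listK p ks r)

   Cover : List St → List A → Wt → Set
   Cover X as w = Any (λ y → lbl y ≡ as × wt y ⊒ w) X

   mutual
     data Has : Trie → List A → Wt → Set where
       hit : ∀ {ws ks w} → Dominated ws w → Has (node ws ks) [] w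
       down : ∀ {ws ks a as w} → HasK ks a as w → Has (node ws ks) (a ∷ as) w
     data HasK : Kids → A → List A → Wt → Set where
       this : ∀ {a t ks as w} → Has t as w → HasK (kid a t ks) a as w
       that : ∀ {b t ks a as w} → HasK ks a as w → HasK (kid b t ks) a as w

   single-has : ∀ as w → Has (single as w) as w
   single-has [] w = hit (here (≤-refl , ≤-refl , ≤-refl))
   single-has (a ∷ as) w = down (this (single-has as w))

   mutual
     insert-new : ∀ as w t → Has (insert as w t) as w
     insert-new [] w (node ws ks) = hit (addWt-new w ws)
     insert-new (a ∷ as) w (node ws ks) = down (insertK-new a as w ks)

     insertK-new : ∀ a as w ks → HasK (insertK a as w ks) a as w
     insertK-new a as w none = this (single-has as w)
     insertK-new a as w (kid b t ks) with eq a b in e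
     ... | true rewrite eq-sound a b e = this (insert-new as w t)
     ... | false = that (insertK-new a as w ks)

   mutual
     insert-old : ∀ as w t {bs v} → Has t bs v → Has (insert as w t) bs v
     insert-old [] w (node ws ks) (hit p) = hit (addWt-old w ws _ p)
     insert-old [] w (node ws ks) (down p) = down p
     insert-old (a ∷ as) w (node ws ks) (hit p) = hit p
     insert-old (a ∷ as) w (node ws ks) (down p) = down (insertK-old a as w ks p)

     insertK-old : ∀ a as w ks {b bs v} → HasK ks b bs v → HasK (insertK a as w ks) b bs v
     insertK-old a as w (kid b t ks) p with eq a b
     insertK-old a as w (kid b t ks) (this p) | true = this (insert-old as w t p)
     insertK-old a as w (kid b t ks) (that p) | true = that p
     insertK-old a as w (kid b t ks) (this p) | false = this p
     insertK-old a as w (kid b t ks) (that p) | false = that (insertK-old a as w ks p)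

   leaves-cover : ∀ p ws r {w} → Dominated ws w → Cover (leaves p ws r) p w
   leaves-cover p (w ∷ ws) r (here q) = here (refl , q)
   leaves-cover p (w ∷ ws) r (there q) = there (leaves-cover p ws r q)

   leaves-rest : ∀ p ws r {as w} → Cover r as w → Cover (leaves p ws r) as w
   leaves-rest p [] r q = q
   leaves-rest p (w ∷ ws) r q = there (leaves-rest p ws r q)

   mutual
     list-rest : ∀ p t r {as w} → Cover r as w → Cover (list p t r) as w
     list-rest p (node ws ks) r q = leaves-rest (revOnto p []) ws _ (listK-rest p ks r q)

     listK-rest : ∀ p ks r {as w} → Cover r as w → Cover (listK p ks r) as w
     listK-rest p none r q = q
     listK-rest p (kid a t ks) r q = list-rest (a ∷ p) t _ (listK-rest p ks r q)

   mutual
     list-cover : ∀ p t r {as w} → Has t as w → Cover (list p t r) (revOnto p as) w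
     list-cover p (node ws ks) r (hit q) = leaves-cover (revOnto p []) ws _ q
     list-cover p (node ws ks) r (down q) = leaves-rest (revOnto p []) ws _ (listK-cover p ks r q)

     listK-cover : ∀ p ks r {a as w} → HasK ks a as w → Cover (listK p ks r) (revOnto p (a ∷ as)) w
     listK-cover p (kid a t ks) r (this q) = list-cover (a ∷ p) t _ q
     listK-cover p (kid a t ks) r (that q) = list-rest (a ∷ p) t _ (listK-cover p ks r q)

   Strand : Set
   Strand = A × ℕ

   labels : List Strand → List A
   labels = map proj₁

   -- The second component of a strand is the cost booked on a half-edge whose partner is not
   -- attached yet; gluing exchanges two such bookings for one `diff`.
   flow : List Strand → ℕ
   flow [] = 0
   flow ((a , d) ∷ ls) = d + flow ls

   -- k is a lower bound for the cut edges counted so far, dangling strands excluded.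
   Good : List St → List Strand → ℕ → ℕ → ℕ → Set
   Good X ls K s c = (6 + flow ls ≤ K) ⊎ Σ ℕ λ k → k + flow ls ≤ K × Cover X (labels ls) ⟨ k , cap s , cap c ⟩

   clash : ℕ → List A → List A → ℕ
   clash zero _ _ = 0
   clash (suc n) (a ∷ as) (b ∷ bs) = diff a b + clash n as bs
   clash (suc n) _ _ = 0

   joinOne : ℕ → St → St → Trie → Trie
   joinOne n (as ∶ ⟨ k , s , c ⟩) (bs ∶ ⟨ k' , s' , c' ⟩) t =
     let d = k + (k' + clash n as bs)
     -- From six cut edges on the state needs no further watching; the first alternative of `Good`
     -- takes it over.
     in if d <ᵇ 6 then insert (drop n bs ++ drop n as) ⟨ d , cap (s + s') , cap (c + c') ⟩ t else t

   joinRow : ℕ → St → List St → Trie → Trie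
   joinRow n x [] t = t
   joinRow n x (y ∷ ys) t = joinRow n x ys (joinOne n x y t)

   joinRows : ℕ → List St → List St → Trie → Trie
   joinRows n [] ys t = t
   joinRows n (x ∷ xs) ys t = joinRows n xs ys (joinRow n x ys t)

   join : ℕ → List St → List St → List St
   join n xs ys = list [] (joinRows n xs ys (node [] none)) []

   joinOne-old : ∀ n x y t {as w} → Has t as w → Has (joinOne n x y t) as w
   joinOne-old n (as ∶ ⟨ k , s , c ⟩) (bs ∶ ⟨ k' , s' , c' ⟩) t h with k + (k' + clash n as bs) <ᵇ 6
   ... | true = insert-old _ _ t h
   ... | false = h

   joinRow-old : ∀ n x ys t {as w} → Has t as w → Has (joinRow n x ys t) as w
   joinRow-old n x [] t h = h
   joinRow-old n x (y ∷ ys) t h = joinRow-old n x ys _ (joinOne-old n x y t h)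

   joinRows-old : ∀ n xs ys t {as w} → Has t as w → Has (joinRows n xs ys t) as w
   joinRows-old n [] ys t h = h
   joinRows-old n (x ∷ xs) ys t h = joinRows-old n xs ys _ (joinRow-old n x ys t h)

   Has-⊒ : ∀ {v w} → v ⊒ w → ∀ t as → Has t as v → Has t as w
   HasK-⊒ : ∀ {v w} → v ⊒ w → ∀ ks a as → HasK ks a as v → HasK ks a as w
   Has-⊒ p (node ws ks) [] (hit q) = hit (Any.map (λ r → ⊒-trans r p) q)
   Has-⊒ p (node ws ks) (a ∷ as) (down q) = down (HasK-⊒ p ks a as q)
   HasK-⊒ p (kid a t ks) .a as (this q) = this (Has-⊒ p t as q)
   HasK-⊒ p (kid b t ks) a as (that q) = that (HasK-⊒ p ks a as q)

   module _ (n : ℕ) {as bs : List A} {k k' s s' c c' : ℕ} (small : k + (k' + clash n as bs) < 6) where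
     private
       goal : Trie → Set
       goal t = Has t (drop n bs ++ drop n as) ⟨ k + (k' + clash n as bs) , cap (s + s') , cap (c + c') ⟩

     -- The stored states cost no more than the true ones, so a true total below six keeps the
     -- stored total below six as well and the joined state is not discarded.
     joinOne-hit : ∀ x y t → lbl x ≡ as → wt x ⊒ ⟨ k , cap s , cap c ⟩ → lbl y ≡ bs → wt y ⊒ ⟨ k' , cap s' , cap c' ⟩ →
                   goal (joinOne n x y t)
     joinOne-hit (as ∶ ⟨ a , b , d ⟩) (bs ∶ ⟨ a' , b' , d' ⟩) t refl (p , q , r) refl (p' , q' , r')
       with a + (a' + clash n as bs) <ᵇ 6 in e
     ... | true = Has-⊒ (le , ≤-trans (cap-sub s s') (cap-mono (+-mono-≤ q q')) , ≤-trans (cap-sub c c') (cap-mono (+-mono-≤ r r'))) _ _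
                    (insert-new _ _ t)
       where le = +-mono-≤ p (+-monoˡ-≤ (clash n as bs) p')
     ... | false = ⊥-elim (<⇒≱ small (≤-trans (<ᵇ-false _ 6 e) (+-mono-≤ p (+-monoˡ-≤ (clash n as bs) p'))))

     joinRow-hit : ∀ x ys t → lbl x ≡ as → wt x ⊒ ⟨ k , cap s , cap c ⟩ → Cover ys bs ⟨ k' , cap s' , cap c' ⟩ →
                   goal (joinRow n x ys t)
     joinRow-hit x (y ∷ ys) t p q (here (r , u)) = joinRow-old n x ys _ (joinOne-hit x y t p q r u)
     joinRow-hit x (y ∷ ys) t p q (there r) = joinRow-hit x ys _ p q r

     joinRows-hit : ∀ xs ys t → Cover xs as ⟨ k , cap s , cap c ⟩ → Cover ys bs ⟨ k' , cap s' , cap c' ⟩ →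
                    goal (joinRows n xs ys t)
     joinRows-hit (x ∷ xs) ys t (here (p , q)) r = joinRows-old n xs ys _ (joinRow-hit x ys t p q r)
     joinRows-hit (x ∷ xs) ys t (there p) r = joinRows-hit xs ys _ p r

   Matched : ℕ → List Strand → List Strand → Set
   Matched zero _ _ = ⊤
   Matched (suc n) ((a , d) ∷ ls) ((b , e) ∷ ms) = diff a b ≤ d + e × Matched n ls ms
   Matched (suc n) _ _ = ⊥

   flow-++ : ∀ ls ms → flow (ls ++ ms) ≡ flow ls + flow ms
   flow-++ [] ms = refl
   flow-++ (l ∷ ls) ms rewrite flow-++ ls ms = sym (+-assoc (proj₂ l) _ _)

   clash-flow : ∀ n ls ms → Matched n ls ms →
     clash n (labels ls) (labels ms) + (flow (drop n ls) + flow (drop n ms)) ≤ flow ls + flow ms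
   clash-flow zero ls ms _ = ≤-refl
   clash-flow (suc n) ((a , d) ∷ ls) ((b , e) ∷ ms) (p , q) = begin
     diff a b + clash n (labels ls) (labels ms) + r ≡⟨ +-assoc (diff a b) _ r ⟩
     diff a b + (clash n (labels ls) (labels ms) + r) ≤⟨ +-mono-≤ p (clash-flow n ls ms q) ⟩
     d + e + (flow ls + flow ms) ≡⟨ ar d e (flow ls) (flow ms) ⟩
     d + flow ls + (e + flow ms) ∎
     where
     open ≤-Reasoning
     r = flow (drop n ls) + flow (drop n ms)
     ar : ∀ d e x y → d + e + (x + y) ≡ d + x + (e + y)
     ar = solve-∀

   flow-drop-≤ : ∀ n ls → flow (drop n ls) ≤ flow ls
   flow-drop-≤ zero ls = ≤-refl
   flow-drop-≤ (suc n) [] = ≤-refl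
   flow-drop-≤ (suc n) (l ∷ ls) = ≤-trans (flow-drop-≤ n ls) (m≤n+m _ (proj₂ l))

   -- The bookings of the glued strands pay for their clashes by `clash-flow`, and the remaining
   -- bookings pass on unchanged. If one part has already spent six, the surplus survives the
   -- gluing, since the other part at least covers its own strands.
   join-good : ∀ n {X Y ls ms K K' s s' c c'} → Matched n ls ms → Good X ls K s c → Good Y ms K' s' c' →
               Good (join n X Y) (drop n ms ++ drop n ls) (K + K') (s + s') (c + c')
   join-good n {X} {Y} {ls} {ms} {K} {K'} {s} {s'} {c} {c'} mt gx gy = go gx gy
     where
     open ≤-Reasoning
     new = drop n ms ++ drop n ls
     new-flow : flow new ≤ flow ls + flow ms
     new-flow = begin
       flow new ≡⟨ flow-++ (drop n ms) (drop n ls) ⟩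
       flow (drop n ms) + flow (drop n ls) ≤⟨ +-mono-≤ (flow-drop-≤ n ms) (flow-drop-≤ n ls) ⟩
       flow ms + flow ls ≡⟨ +-comm (flow ms) _ ⟩
       flow ls + flow ms ∎
     go : Good X ls K s c → Good Y ms K' s' c' → Good (join n X Y) new (K + K') (s + s') (c + c')
     go (inj₁ p) gy' = inj₁ (begin
       6 + flow new ≤⟨ +-monoʳ-≤ 6 new-flow ⟩
       6 + (flow ls + flow ms) ≡⟨ sym (+-assoc 6 (flow ls) _) ⟩
       6 + flow ls + flow ms ≤⟨ +-mono-≤ p (lo gy') ⟩
       K + K' ∎)
       where
       lo : Good Y ms K' s' c' → flow ms ≤ K'
       lo (inj₁ q) = ≤-trans (m≤n+m _ 6) q
       lo (inj₂ (k , q , _)) = ≤-trans (m≤n+m _ k) q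
     go (inj₂ (k , p , _)) (inj₁ q) = inj₁ (begin
       6 + flow new ≤⟨ +-monoʳ-≤ 6 new-flow ⟩
       6 + (flow ls + flow ms) ≡⟨ ar 6 (flow ls) (flow ms) ⟩
       flow ls + (6 + flow ms) ≤⟨ +-mono-≤ (≤-trans (m≤n+m _ k) p) q ⟩
       K + K' ∎)
       where
       ar : ∀ x y z → x + (y + z) ≡ y + (x + z)
       ar = solve-∀
     go (inj₂ (k , p , cx)) (inj₂ (k' , q , cy)) = fin (d <ᵇ 6) refl
       where
       cl = clash n (labels ls) (labels ms)
       d = k + (k' + cl)
       bound : d + flow new ≤ K + K'
       bound = begin
         d + flow new ≡⟨ cong (d +_) (flow-++ (drop n ms) (drop n ls)) ⟩
         d + (flow (drop n ms) + flow (drop n ls)) ≡⟨ ar1 k k' cl (flow (drop n ms)) (flow (drop n ls)) ⟩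
         k + k' + (cl + (flow (drop n ls) + flow (drop n ms))) ≤⟨ +-monoʳ-≤ (k + k') (clash-flow n ls ms mt) ⟩
         k + k' + (flow ls + flow ms) ≡⟨ ar2 k k' (flow ls) (flow ms) ⟩
         k + flow ls + (k' + flow ms) ≤⟨ +-mono-≤ p q ⟩
         K + K' ∎
         where
         ar1 : ∀ k k' c x y → k + (k' + c) + (x + y) ≡ k + k' + (c + (y + x))
         ar1 = solve-∀
         ar2 : ∀ k k' x y → k + k' + (x + y) ≡ k + x + (k' + y)
         ar2 = solve-∀
       fin : ∀ b → (d <ᵇ 6) ≡ b → Good (join n X Y) new (K + K') (s + s') (c + c')
       fin true e = inj₂ (d , bound , subst (λ z → Cover (join n X Y) z ⟨ d , cap (s + s') , cap (c + c') ⟩) (sym eqn)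
                     (list-cover [] _ [] (joinRows-hit n {labels ls} {labels ms} {k} {k'} {s} {s'} {c} {c'} (<ᵇ-true d 6 e) X Y (node [] none) cx cy)))
         where
         eqn : labels new ≡ drop n (labels ms) ++ drop n (labels ls)
         eqn = trans (map-++ proj₁ (drop n ms) _) (cong₂ _++_ (sym (drop-map n ms)) (sym (drop-map n ls)))
       fin false e = inj₁ (≤-trans (+-monoˡ-≤ (flow new) (<ᵇ-false d 6 e)) bound)

   -- Gluing acts on the front of the strand list. Moving single entries to the front generates all
   -- reorderings and commutes with `map`, so labels, costs and ports are reordered by the same list
   -- of moves.
   pull : {B : Set} → ℕ → List B → List B
   pull k xs = take 1 (drop k xs) ++ take k xs ++ drop (suc k) xs

   pulls : {B : Set} → List ℕ → List B → List B
   pulls [] xs = xs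
   pulls (k ∷ ks) xs = pulls ks (pull k xs)

   flow-pull : ∀ k ls → flow (pull k ls) ≡ flow ls
   flow-pull zero [] = refl
   flow-pull zero (l ∷ ls) = refl
   flow-pull (suc k) [] = refl
   flow-pull (suc k) (l ∷ ls) with drop k ls | flow-pull k ls
   ... | [] | e = cong (proj₂ l +_) e
   ... | m ∷ ms | e = trans (ar (proj₂ m) (proj₂ l) _) (cong (proj₂ l +_) e)
     where
     ar : ∀ x y z → x + (y + z) ≡ y + (x + z)
     ar = solve-∀

   map-pull : {B C : Set} (f : B → C) (k : ℕ) (xs : List B) → map f (pull k xs) ≡ pull k (map f xs)
   map-pull f k xs = trans (map-++ f (take 1 (drop k xs)) _)
     (cong₂ _++_ (trans (sym (take-map 1 (drop k xs))) (cong (take 1) (sym (drop-map k xs))))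
                 (trans (map-++ f (take k xs) _) (cong₂ _++_ (sym (take-map k xs)) (sym (drop-map (suc k) xs)))))

   reorder : List ℕ → List St → List St
   reorder ks [] = []
   reorder ks ((as ∶ w) ∷ X) = (pulls ks as ∶ w) ∷ reorder ks X

   reorder-cover : ∀ ks X {as w} → Cover X as w → Cover (reorder ks X) (pulls ks as) w
   reorder-cover ks (x ∷ X) (here (refl , p)) = here (refl , p)
   reorder-cover ks (x ∷ X) (there p) = there (reorder-cover ks X p)

   flow-pulls : ∀ ks ls → flow (pulls ks ls) ≡ flow ls
   flow-pulls [] ls = refl
   flow-pulls (k ∷ ks) ls = trans (flow-pulls ks _) (flow-pull k ls)

   map-pulls : {B C : Set} (f : B → C) (ks : List ℕ) (xs : List B) → map f (pulls ks xs) ≡ pulls ks (map f xs)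
   map-pulls f [] xs = refl
   map-pulls f (k ∷ ks) xs = trans (map-pulls f ks _) (cong (pulls ks) (map-pull f k xs))

   reorder-good : ∀ ks {X ls K s c} → Good X ls K s c → Good (reorder ks X) (pulls ks ls) K s c
   reorder-good ks {ls = ls} {K = K} (inj₁ p) = inj₁ (subst (λ z → 6 + z ≤ K) (sym (flow-pulls ks ls)) p)
   reorder-good ks {X} {ls} {K} {s} {c} (inj₂ (k , p , q)) =
     inj₂ (k , subst (λ z → k + z ≤ K) (sym (flow-pulls ks ls)) p
             , subst (λ z → Cover (reorder ks X) z ⟨ k , cap s , cap c ⟩) (sym (map-pulls proj₁ ks ls)) (reorder-cover ks X q))

   empty : List St
   empty = ([] ∶ ⟨ 0 , 0 , 0 ⟩) ∷ []

   empty-good : Good empty [] 0 0 0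
   empty-good = inj₂ (0 , z≤n , here (refl , z≤n , z≤n , z≤n))

   module Program {Pt Tag : Set} (linked : Pt → Pt → Bool) where

     record Item : Set where
       constructor item
       field tag : Tag
             ports : List Pt
             moves : List ℕ
             glue : ℕ
             table : List St
     open Item public

     linkedN : ℕ → List Pt → List Pt → Bool
     linkedN zero _ _ = true
     linkedN (suc n) (p ∷ ps) (q ∷ qs) = linked p q & linkedN n ps qs
     linkedN (suc n) _ _ = false

     front : List Pt → List Item → List Pt
     front ps [] = ps
     front ps (i ∷ is) = front (drop (glue i) (ports i) ++ drop (glue i) (pulls (moves i) ps)) is

     -- Whether the strands glued by a program really belong together depends on the port names
     -- alone. The check is therefore independent of the tables and of the cut or colouring under
     -- consideration.
     sane : List Pt → List Item → Bool
     sane ps [] = true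
     sane ps (i ∷ is) = linkedN (glue i) (pulls (moves i) ps) (ports i)
                      & sane (drop (glue i) (ports i) ++ drop (glue i) (pulls (moves i) ps)) is

     exec : List St → List Item → List St
     exec X [] = X
     exec X (i ∷ is) = exec (join (glue i) (reorder (moves i) X) (table i)) is

     module Sound (strand : Pt → Strand)
                  (linked-sound : ∀ p q → linked p q ≡ true → diff (proj₁ (strand p)) (proj₁ (strand q)) ≤ proj₂ (strand p) + proj₂ (strand q))
                  where

       linkedN-matched : ∀ n ps qs → linkedN n ps qs ≡ true → Matched n (map strand ps) (map strand qs)
       linkedN-matched zero ps qs e = tt
       linkedN-matched (suc n) (p ∷ ps) (q ∷ qs) e =
         linked-sound p q (&-fst e) , linkedN-matched n ps qs (&-snd {linked p q} e)

       step-good : ∀ n ks {X Y ps qs K K' s s' c c'} → linkedN n (pulls ks ps) qs ≡ true →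
         Good X (map strand ps) K s c → Good Y (map strand qs) K' s' c' →
         Good (join n (reorder ks X) Y) (map strand (drop n qs ++ drop n (pulls ks ps))) (K + K') (s + s') (c + c')
       step-good n ks {X} {Y} {ps} {qs} {K} {K'} {s} {s'} {c} {c'} e gx gy =
         subst (λ z → Good (join n (reorder ks X) Y) z (K + K') (s + s') (c + c')) (sym eqn)
           (join-good n {s = s} {s'} {c} {c'} (linkedN-matched n (pulls ks ps) qs e)
             (subst (λ z → Good (reorder ks X) z K s c) (sym (map-pulls strand ks ps)) (reorder-good ks {s = s} {c} gx)) gy)
         where
         eqn : map strand (drop n qs ++ drop n (pulls ks ps)) ≡ drop n (map strand qs) ++ drop n (map strand (pulls ks ps))
         eqn = trans (map-++ strand (drop n qs) _) (cong₂ _++_ (sym (drop-map n qs)) (sym (drop-map n _)))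

       module _ (K s c : Tag → ℕ) where
         total : (Tag → ℕ) → ℕ → List Item → ℕ
         total f a [] = a
         total f a (i ∷ is) = total f (a + f (tag i)) is

         Fits : Item → Set
         Fits i = Good (table i) (map strand (ports i)) (K (tag i)) (s (tag i)) (c (tag i))

         exec-good : ∀ is {X ps a b d} → sane ps is ≡ true → Good X (map strand ps) a b d → All Fits is →
           Good (exec X is) (map strand (front ps is)) (total K a is) (total s b is) (total c d is)
         exec-good [] e g _ = g
         exec-good (i ∷ is) {ps = ps} {a} {b} {d} e g (h ∷ hs) =
           exec-good is {a = a + K (tag i)} {b + s (tag i)} {d + c (tag i)} (&-snd {linkedN (glue i) (pulls (moves i) ps) (ports i)} e)
             (step-good (glue i) (moves i) {s = b} {s (tag i)} {d} {c (tag i)} (&-fst e) g h) hs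

         run-good : ∀ is fm {es} → sane [] is ≡ true → pulls fm (front [] is) ≡ es → All Fits is →
           Good (reorder fm (exec empty is)) (map strand es) (total K 0 is) (total s 0 is) (total c 0 is)
         run-good is fm e refl fs = subst (λ z → Good (reorder fm (exec empty is)) z (total K 0 is) (total s 0 is) (total c 0 is)) (sym (map-pulls strand fm (front [] is)))
           (reorder-good fm {exec empty is} {map strand (front [] is)} {total K 0 is} {total s 0 is} {total c 0 is} (exec-good is {empty} {[]} {0} {0} {0} e empty-good fs))

         total-tabulate : ∀ (f : Tag → ℕ) a {n} (g : Fin n → Item) → total f a (tabulate g) ≡ a + sumFin (λ i → f (tag (g i)))
         total-tabulate f a {zero} g = sym (+-identityʳ a)
         total-tabulate f a {suc n} g = trans (total-tabulate f _ (λ i → g (suc i))) (+-assoc a _ _)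

         run-tabulate : ∀ {n} (g : Fin n → Item) fm {es} → sane [] (tabulate g) ≡ true → pulls fm (front [] (tabulate g)) ≡ es → (∀ i → Fits (g i)) →
           Good (reorder fm (exec empty (tabulate g))) (map strand es) (sumFin (λ i → K (tag (g i)))) (sumFin (λ i → s (tag (g i)))) (sumFin (λ i → c (tag (g i))))
         run-tabulate g fm {es} e p fs =
           subst (λ z → Good X ls z (tot s) (tot c)) (total-tabulate K 0 g)
             (subst₂ (λ y z → Good X ls (total K 0 is) y z) (total-tabulate s 0 g) (total-tabulate c 0 g) (run-good is fm {es} e p (tabulate⁺ fs)))
           where
           is = tabulate g
           X = reorder fm (exec empty is)
           ls = map strand es
           tot : (Tag → ℕ) → ℕ
           tot f = sumFin (λ i → f (tag (g i)))

   Good-mono : ∀ {X Y ls K s c} → (∀ {as w} → Cover X as w → Cover Y as w) → Good X ls K s c → Good Y ls K s c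
   Good-mono f (inj₁ p) = inj₁ p
   Good-mono f (inj₂ (k , p , q)) = inj₂ (k , p , f q)

   eqList : List A → List A → Bool
   eqList [] [] = true
   eqList (a ∷ as) (b ∷ bs) = eq a b & eqList as bs
   eqList _ _ = false

   eqList-sound : ∀ as bs → eqList as bs ≡ true → as ≡ bs
   eqList-sound [] [] e = refl
   eqList-sound (a ∷ as) (b ∷ bs) e = cong₂ _∷_ (eq-sound a b (&-fst e)) (eqList-sound as bs (&-snd {eq a b} e))

   covers : List St → St → Bool
   covers [] x = false
   covers (y ∷ ys) x = if eqList (lbl y) (lbl x) & dom (wt y) (wt x) then true else covers ys x

   coversAll : List St → List St → Bool
   coversAll ys [] = true
   coversAll ys (x ∷ xs) = covers ys x & coversAll ys xs

   covers-sound : ∀ ys x → covers ys x ≡ true → Cover ys (lbl x) (wt x)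
   covers-sound (y ∷ ys) x e with eqList (lbl y) (lbl x) & dom (wt y) (wt x) in q
   ... | true = here (eqList-sound _ _ (&-fst q) , dom-sound _ _ (&-snd {eqList (lbl y) (lbl x)} q))
   ... | false = there (covers-sound ys x e)

   Cover-⊒ : ∀ {ys as v w} → v ⊒ w → Cover ys as v → Cover ys as w
   Cover-⊒ p = Any.map λ { (e , q) → e , ⊒-trans q p }

   coversAll-sound : ∀ ys xs → coversAll ys xs ≡ true → ∀ {as w} → Cover xs as w → Cover ys as w
   coversAll-sound ys (x ∷ xs) e (here (refl , p)) = Cover-⊒ p (covers-sound ys x (&-fst e))
   coversAll-sound ys (x ∷ xs) e (there p) = coversAll-sound ys xs (&-snd {covers ys x} e) p

   -- Gluing nothing to the empty state normalises a list of states.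
   tidy : List St → List St
   tidy X = join 0 X empty

   tidy-good : ∀ {X ls K s c} → Good X ls K s c → Good (tidy X) ls K s c
   tidy-good {X} {ls} {K} {s} {c} g rewrite sym (+-identityʳ K) | sym (+-identityʳ s) | sym (+-identityʳ c)
     = join-good 0 {s = s} {0} {c} {0} tt (subst₃ g) empty-good
     where
     subst₃ : Good X ls (K + 0) (s + 0) (c + 0) → Good X ls K s c
     subst₃ h rewrite +-identityʳ K | +-identityʳ s | +-identityʳ c = h

   ++-coverˡ : ∀ {X Y as w} → Cover X as w → Cover (X ++ Y) as w
   ++-coverˡ (here p) = here p
   ++-coverˡ (there p) = there (++-coverˡ p)

   ++-coverʳ : ∀ X {Y as w} → Cover Y as w → Cover (X ++ Y) as w
   ++-coverʳ [] p = p
   ++-coverʳ (x ∷ X) p = there (++-coverʳ X p)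

module HalfEdgeGraphs where
 open Gluing using (_&_; &-fst; &-snd)
 open import Defs
 open import Data.Nat using (ℕ; zero; suc; _+_; _≤_; _<_; z≤n; s≤s; s≤s⁻¹)
 open import Data.Nat.Properties hiding (_≟_)
 open import Data.Bool using (Bool; true; false; not; T; _∨_)
 open import Data.Fin using (Fin; zero; suc; _≟_)
 open import Data.List using (List; []; _∷_; length)
 open import Data.List.Membership.Propositional using (_∈_; _∉_)
 open import Data.List.Relation.Unary.Any using (here; there)
 open import Data.List.Relation.Unary.All as All using (All; []; _∷_)
 open import Data.List.Relation.Unary.AllPairs using ([]; _∷_)
 open import Data.List.Relation.Unary.Unique.Propositional using (Unique)
 open import Data.Product using (Σ; _×_; _,_; proj₁; proj₂)
 open import Data.Sum using (_⊎_; inj₁; inj₂)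
 open import Data.Unit using (tt)
 open import Data.Empty using (⊥; ⊥-elim)
 open import Function using (_∘_)
 open import Relation.Nullary using (¬_; Dec; yes; no; ⌊_⌋)
 open import Relation.Binary.PropositionalEquality

 -- Cubic graphs as involutions on half-edges.

 T-true : ∀ {b} → T b → b ≡ true
 T-true {true} _ = refl

 sumFin-cong : ∀ {n} {f g : Fin n → ℕ} → (∀ i → f i ≡ g i) → sumFin f ≡ sumFin g
 sumFin-cong {zero} e = refl
 sumFin-cong {suc n} e = cong₂ _+_ (e zero) (sumFin-cong (e ∘ suc))

 sumFin-mono : ∀ {n} {f g : Fin n → ℕ} → (∀ i → f i ≤ g i) → sumFin f ≤ sumFin g
 sumFin-mono {zero} e = z≤n
 sumFin-mono {suc n} e = +-mono-≤ (e zero) (sumFin-mono (e ∘ suc))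

 sumFin-zero : ∀ {n} (f : Fin n → ℕ) → (∀ i → f i ≡ 0) → sumFin f ≡ 0
 sumFin-zero {zero} f e = refl
 sumFin-zero {suc n} f e rewrite e zero = sumFin-zero (f ∘ suc) (e ∘ suc)

 clear : ∀ {n} → Fin n → (Fin n → ℕ) → Fin n → ℕ
 clear x f i with i ≟ x
 ... | yes _ = 0
 ... | no _ = f i

 clear-at : ∀ {n} (x : Fin n) f → clear x f x ≡ 0
 clear-at x f with x ≟ x
 ... | yes _ = refl
 ... | no p = ⊥-elim (p refl)

 clear-off : ∀ {n} (x : Fin n) f {i} → i ≢ x → clear x f i ≡ f i
 clear-off x f {i} p with i ≟ x
 ... | yes e = ⊥-elim (p e)
 ... | no _ = refl

 sumFin-clear : ∀ {n} (x : Fin n) f → sumFin f ≡ f x + sumFin (clear x f)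
 sumFin-clear zero f = cong (f zero +_) (sym (sumFin-cong {f = λ i → clear zero f (suc i)} (λ i → clear-off zero f λ ())))
 sumFin-clear (suc x) f = begin
   f zero + sumFin (f ∘ suc) ≡⟨ cong (f zero +_) (sumFin-clear x (f ∘ suc)) ⟩
   f zero + (f (suc x) + sumFin (clear x (f ∘ suc))) ≡⟨ sym (+-assoc (f zero) _ _) ⟩
   f zero + f (suc x) + sumFin (clear x (f ∘ suc)) ≡⟨ cong₂ _+_ (+-comm (f zero) _) (sumFin-cong tail) ⟩
   f (suc x) + f zero + sumFin (λ i → clear (suc x) f (suc i)) ≡⟨ +-assoc (f (suc x)) _ _ ⟩
   f (suc x) + sumFin (clear (suc x) f) ∎
   where
   open ≡-Reasoning
   tail : ∀ i → clear x (f ∘ suc) i ≡ clear (suc x) f (suc i)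
   tail i with i ≟ x
   ... | yes _ = refl
   ... | no _ = refl

 sumOver : {A : Set} → (A → ℕ) → List A → ℕ
 sumOver f [] = 0
 sumOver f (x ∷ xs) = f x + sumOver f xs

 sumOver-cong : {A : Set} {f g : A → ℕ} → ∀ xs → (∀ {x} → x ∈ xs → f x ≡ g x) → sumOver f xs ≡ sumOver g xs
 sumOver-cong [] e = refl
 sumOver-cong (x ∷ xs) e = cong₂ _+_ (e (here refl)) (sumOver-cong xs (e ∘ there))

 unique-≢ : ∀ {n} {x : Fin n} {xs} → Unique (x ∷ xs) → ∀ {y} → y ∈ xs → y ≢ x
 unique-≢ (p ∷ _) i refl = All.lookup p i refl

 sumOver-unique : ∀ {n} (f : Fin n → ℕ) xs → Unique xs → Σ (Fin n → ℕ) λ g →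
   sumFin f ≡ sumOver f xs + sumFin g × (∀ i → i ∈ xs → g i ≡ 0) × (∀ i → i ∉ xs → g i ≡ f i)
 sumOver-unique f [] u = f , refl , (λ _ ()) , λ _ _ → refl
 sumOver-unique f (x ∷ xs) u@(_ ∷ us) with sumOver-unique (clear x f) xs us
 ... | g , e , z , o = g , eq , z' , o'
   where
   eq : sumFin f ≡ f x + sumOver f xs + sumFin g
   eq = trans (sumFin-clear x f) (trans (cong (f x +_) (trans e (cong (_+ sumFin g) (sumOver-cong xs λ i → clear-off x f (unique-≢ u i)))))
          (sym (+-assoc (f x) _ _)))
   z' : ∀ i → i ∈ x ∷ xs → g i ≡ 0
   z' i (here refl) = trans (o i λ j → unique-≢ u j refl) (clear-at i f)
   z' i (there j) = z i j
   o' : ∀ i → i ∉ x ∷ xs → g i ≡ f i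
   o' i p = trans (o i (p ∘ there)) (clear-off x f λ { refl → p (here refl) })

 sumOver-≤ : ∀ {n} (f : Fin n → ℕ) {xs} → Unique xs → sumOver f xs ≤ sumFin f
 sumOver-≤ f u with sumOver-unique f _ u
 ... | g , e , _ = ≤-trans (m≤m+n _ _) (≤-reflexive (sym e))

 sumOver-support : ∀ {n} (f : Fin n → ℕ) {xs} → Unique xs → (∀ i → i ∉ xs → f i ≡ 0) → sumFin f ≡ sumOver f xs
 sumOver-support f {xs} u s with sumOver-unique f xs u
 ... | g , e , z , o = trans e (trans (cong (sumOver f xs +_) (sumFin-zero g λ i → g0 i (i ∈? xs))) (+-identityʳ _))
   where
   open import Data.List.Membership.DecPropositional (_≟_) using (_∈?_)
   g0 : ∀ i → Dec (i ∈ xs) → g i ≡ 0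
   g0 i (yes p) = z i p
   g0 i (no p) = trans (o i p) (s i p)

 sumFin-pos : ∀ {n} (f : Fin n → ℕ) → 1 ≤ sumFin f → Σ (Fin n) λ i → 1 ≤ f i
 sumFin-pos {suc n} f p with f zero in e
 ... | suc k = zero , subst (1 ≤_) (sym e) (s≤s z≤n)
 ... | zero with sumFin-pos (f ∘ suc) p
 ... | i , q = suc i , q

 sumFin-+ : ∀ {n} (f g : Fin n → ℕ) → sumFin (λ i → f i + g i) ≡ sumFin f + sumFin g
 sumFin-+ {zero} f g = refl
 sumFin-+ {suc n} f g rewrite sumFin-+ (f ∘ suc) (g ∘ suc) = ar (f zero) (g zero) _ _
   where
   open import Data.Nat.Tactic.RingSolver using (solve-∀)
   ar : ∀ a b x y → a + b + (x + y) ≡ a + x + (b + y)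
   ar = solve-∀

 sumFin-one : ∀ n → sumFin {n} (λ _ → 1) ≡ n
 sumFin-one zero = refl
 sumFin-one (suc n) = cong suc (sumFin-one n)

 -- The Klein four-group: `c1`, `c2`, `c3` are the edge colours of a 3-colouring, while `c0` marks a
 -- zero edge of a flow, or serves as the fourth colour.
 data C : Set where
   c0 c1 c2 c3 : C

 eqC : C → C → Bool
 eqC c0 c0 = true
 eqC c1 c1 = true
 eqC c2 c2 = true
 eqC c3 c3 = true
 eqC _ _ = false

 eqC-refl : ∀ x → eqC x x ≡ true
 eqC-refl c0 = refl
 eqC-refl c1 = refl
 eqC-refl c2 = refl
 eqC-refl c3 = refl

 distinct : C → C → C → Bool
 distinct x y z = not (eqC x y) & not (eqC x z) & not (eqC y z)

 nonzero : C → Bool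
 nonzero x = not (eqC x c0)

 proper : C → C → C → Bool
 proper x y z = distinct x y z & nonzero x & nonzero y & nonzero z

 at : {A : Set} → A → A → A → Fin 3 → A
 at x y z zero = x
 at x y z (suc zero) = y
 at x y z (suc (suc zero)) = z

 at-η : {A : Set} (f : Fin 3 → A) → ∀ a → at (f zero) (f (suc zero)) (f (suc (suc zero))) a ≡ f a
 at-η f zero = refl
 at-η f (suc zero) = refl
 at-η f (suc (suc zero)) = refl

 eqC-neq : ∀ {x y} → not (eqC x y) ≡ true → x ≢ y
 eqC-neq {x} e refl rewrite eqC-refl x with e
 ... | ()

 distinct-at : ∀ x y z → distinct x y z ≡ true → ∀ a b → a ≢ b → at x y z a ≢ at x y z b
 distinct-at x y z e zero zero p = λ _ → p refl
 distinct-at x y z e zero (suc zero) p = eqC-neq (&-fst e)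
 distinct-at x y z e zero (suc (suc zero)) p = eqC-neq (&-fst (&-snd {not (eqC x y)} e))
 distinct-at x y z e (suc zero) zero p = ≢-sym (eqC-neq (&-fst e))
 distinct-at x y z e (suc zero) (suc zero) p = λ _ → p refl
 distinct-at x y z e (suc zero) (suc (suc zero)) p = eqC-neq (&-snd {not (eqC x z)} (&-snd {not (eqC x y)} e))
 distinct-at x y z e (suc (suc zero)) zero p = ≢-sym (eqC-neq (&-fst (&-snd {not (eqC x y)} e)))
 distinct-at x y z e (suc (suc zero)) (suc zero) p = ≢-sym (eqC-neq (&-snd {not (eqC x z)} (&-snd {not (eqC x y)} e)))
 distinct-at x y z e (suc (suc zero)) (suc (suc zero)) p = λ _ → p refl

 nonzero-at : ∀ x y z → proper x y z ≡ true → ∀ a → nonzero (at x y z a) ≡ true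
 nonzero-at x y z e a with &-snd {distinct x y z} e
 nonzero-at x y z e zero | f = &-fst f
 nonzero-at x y z e (suc zero) | f = &-fst (&-snd {nonzero x} f)
 nonzero-at x y z e (suc (suc zero)) | f = &-snd {nonzero y} (&-snd {nonzero x} f)

 col₃ : C → Fin 3
 col₃ c0 = zero
 col₃ c1 = zero
 col₃ c2 = suc zero
 col₃ c3 = suc (suc zero)

 col₃-inj : ∀ x y → nonzero x ≡ true → nonzero y ≡ true → col₃ x ≡ col₃ y → x ≡ y
 col₃-inj c1 c1 _ _ _ = refl
 col₃-inj c2 c2 _ _ _ = refl
 col₃-inj c3 c3 _ _ _ = refl

 col₄ : C → Fin 4
 col₄ c0 = zero
 col₄ c1 = suc zero
 col₄ c2 = suc (suc zero)
 col₄ c3 = suc (suc (suc zero))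

 col₄-inj : ∀ x y → col₄ x ≡ col₄ y → x ≡ y
 col₄-inj c0 c0 _ = refl
 col₄-inj c1 c1 _ = refl
 col₄-inj c2 c2 _ = refl
 col₄-inj c3 c3 _ = refl

 lift₃ : Fin 3 → C
 lift₃ zero = c1
 lift₃ (suc zero) = c2
 lift₃ (suc (suc zero)) = c3

 lift₃-proper : ∀ x y z → x ≢ y → x ≢ z → y ≢ z → proper (lift₃ x) (lift₃ y) (lift₃ z) ≡ true
 lift₃-proper zero zero z p q r = ⊥-elim (p refl)
 lift₃-proper zero (suc zero) zero p q r = ⊥-elim (q refl)
 lift₃-proper zero (suc zero) (suc zero) p q r = ⊥-elim (r refl)
 lift₃-proper zero (suc zero) (suc (suc zero)) p q r = refl
 lift₃-proper zero (suc (suc zero)) zero p q r = ⊥-elim (q refl)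
 lift₃-proper zero (suc (suc zero)) (suc zero) p q r = refl
 lift₃-proper zero (suc (suc zero)) (suc (suc zero)) p q r = ⊥-elim (r refl)
 lift₃-proper (suc zero) zero zero p q r = ⊥-elim (r refl)
 lift₃-proper (suc zero) zero (suc zero) p q r = ⊥-elim (q refl)
 lift₃-proper (suc zero) zero (suc (suc zero)) p q r = refl
 lift₃-proper (suc zero) (suc zero) z p q r = ⊥-elim (p refl)
 lift₃-proper (suc zero) (suc (suc zero)) zero p q r = refl
 lift₃-proper (suc zero) (suc (suc zero)) (suc zero) p q r = ⊥-elim (q refl)
 lift₃-proper (suc zero) (suc (suc zero)) (suc (suc zero)) p q r = ⊥-elim (r refl)
 lift₃-proper (suc (suc zero)) zero zero p q r = ⊥-elim (r refl)
 lift₃-proper (suc (suc zero)) zero (suc zero) p q r = refl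
 lift₃-proper (suc (suc zero)) zero (suc (suc zero)) p q r = ⊥-elim (q refl)
 lift₃-proper (suc (suc zero)) (suc zero) zero p q r = refl
 lift₃-proper (suc (suc zero)) (suc zero) (suc zero) p q r = ⊥-elim (r refl)
 lift₃-proper (suc (suc zero)) (suc zero) (suc (suc zero)) p q r = ⊥-elim (q refl)
 lift₃-proper (suc (suc zero)) (suc (suc zero)) z p q r = ⊥-elim (p refl)

 third : C → C → C
 third c1 c2 = c3
 third c1 c3 = c2
 third c2 c1 = c3
 third c2 c3 = c1
 third c3 c1 = c2
 third c3 c2 = c1
 third _ _ = c0

 -- An edge to a removed vertex (marked c0) gets the colour missing at its other end.
 complete : C → C → C → C
 complete c0 y z = third y z
 complete x _ _ = x

 completed : C → C → C → Bool
 completed x y z = proper (complete x y z) (complete y z x) (complete z x y)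

 complete-lift : ∀ x y z → complete (lift₃ x) y z ≡ lift₃ x
 complete-lift zero y z = refl
 complete-lift (suc zero) y z = refl
 complete-lift (suc (suc zero)) y z = refl

 completed-lift : ∀ x y z → x ≢ y → x ≢ z → y ≢ z → completed (lift₃ x) (lift₃ y) (lift₃ z) ≡ true
 completed-lift x y z p q r
   rewrite complete-lift x (lift₃ y) (lift₃ z) | complete-lift y (lift₃ z) (lift₃ x) | complete-lift z (lift₃ x) (lift₃ y) = lift₃-proper x y z p q r

 completed-two : ∀ x y → x ≢ y → let X = lift₃ x; Y = lift₃ y in
   (completed c0 X Y & completed X c0 Y & completed X Y c0) ≡ true
 completed-two zero zero p = ⊥-elim (p refl)
 completed-two zero (suc zero) p = refl
 completed-two zero (suc (suc zero)) p = refl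
 completed-two (suc zero) zero p = refl
 completed-two (suc zero) (suc zero) p = ⊥-elim (p refl)
 completed-two (suc zero) (suc (suc zero)) p = refl
 completed-two (suc (suc zero)) zero p = refl
 completed-two (suc (suc zero)) (suc zero) p = refl
 completed-two (suc (suc zero)) (suc (suc zero)) p = ⊥-elim (p refl)

 T-irr : ∀ {b} (p q : T b) → p ≡ q
 T-irr {true} p q = refl

 -- In a cubic graph s vertices with k outgoing edges span (3s - k)/2 edges, so `s + 2 ≤ k` says
 -- that they span fewer than s edges. Equality holds for trees.
 Bound : ℕ → ℕ → ℕ → Set
 Bound k s c = 6 ≤ k ⊎ (s ≡ 0 ⊎ s + 2 ≤ k) ⊎ (c ≡ 0 ⊎ c + 2 ≤ k)

 i0 i1 i2 : Fin 3
 i0 = zero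
 i1 = suc zero
 i2 = suc (suc zero)

 module HalfEdges (n : ℕ) (opp : Fin n × Fin 3 → Fin n × Fin 3) (opp-inv : ∀ h → opp (opp h) ≡ h) (large : 12 ≤ n) where

   nbr : Fin n → Fin 3 → Fin n
   nbr u a = proj₁ (opp (u , a))

   size : (Fin n → Bool) → ℕ
   size S = sumFin (b2n ∘ S)

   leave : (Fin n → Bool) → Fin n → Fin 3 → ℕ
   leave S u a = b2n (S u ∧ not (S (nbr u a)))

   boundary : (Fin n → Bool) → ℕ
   boundary S = sumFin λ u → leave S u i0 + (leave S u i1 + leave S u i2)

   size-not : ∀ S → size S + size (not ∘ S) ≡ n
   size-not S = trans (sym (sumFin-+ (b2n ∘ S) _)) (trans (sumFin-cong one) (sumFin-one n))
     where
     one : ∀ i → b2n (S i) + b2n (not (S i)) ≡ 1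
     one i with S i
     ... | true = refl
     ... | false = refl

   -- A side with few edges may still hold a cycle next to a tree, so short cycles are excluded
   -- first: on one, two or three vertices `Bound` asks for three, four or five exits, while a loop
   -- leaves at most two, a double edge two and a triangle three. All cycles then have at least four
   -- vertices, and a side with `4 ≤ s` turns `s + 2 ≤ k` into `6 ≤ k`.
   module Tight (bound : ∀ S → Bound (boundary S) (size S) (size (not ∘ S))) where
     open import Data.List.Membership.DecPropositional (_≟_ {n}) using (_∈?_)

     mem : List (Fin n) → Fin n → Bool
     mem xs i = ⌊ i ∈? xs ⌋

     mem-in : ∀ {xs i} → i ∈ xs → mem xs i ≡ true
     mem-in {xs} {i} p with i ∈? xs
     ... | yes _ = refl
     ... | no q = ⊥-elim (q p)

     mem-out : ∀ {xs i} → i ∉ xs → mem xs i ≡ false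
     mem-out {xs} {i} p with i ∈? xs
     ... | yes q = ⊥-elim (p q)
     ... | no _ = refl

     exits : List (Fin n) → Fin n → ℕ
     exits xs u = sumOver (λ a → b2n (not (mem xs (nbr u a)))) (i0 ∷ i1 ∷ i2 ∷ [])

     size-mem : ∀ {xs} → Unique xs → size (mem xs) ≡ length xs
     size-mem {xs} u = trans (sumOver-support (b2n ∘ mem xs) u λ i p → cong b2n (mem-out p))
       (trans (sumOver-cong xs λ p → cong b2n (mem-in p)) (ones xs))
       where
       ones : (ys : List (Fin n)) → sumOver (λ _ → 1) ys ≡ length ys
       ones [] = refl
       ones (y ∷ ys) = cong suc (ones ys)

     boundary-mem : ∀ {xs} → Unique xs → boundary (mem xs) ≡ sumOver (exits xs) xs
     boundary-mem {xs} u = trans (sumOver-support _ u off) (sumOver-cong xs on)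
       where
       off : ∀ i → i ∉ xs → leave (mem xs) i i0 + (leave (mem xs) i i1 + leave (mem xs) i i2) ≡ 0
       off i p rewrite mem-out p = refl
       on : ∀ {i} → i ∈ xs → leave (mem xs) i i0 + (leave (mem xs) i i1 + leave (mem xs) i i2) ≡ exits xs i
       on {i} p rewrite mem-in p | +-identityʳ (b2n (not (mem xs (nbr i i2)))) = refl

     -- With twelve vertices in all, the complement has at least nine, so whichever side `Bound`
     -- speaks of, the estimate follows for the small one.
     small-boundary : ∀ {xs} → Unique xs → 1 ≤ length xs → length xs ≤ 3 → length xs + 2 ≤ sumOver (exits xs) xs
     small-boundary {xs} u p q = subst₂ (λ s k → s + 2 ≤ k) (size-mem u) (boundary-mem u) (go (bound (mem xs)))
       where
       open ≤-Reasoning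
       S = mem xs
       s≤3 : size S ≤ 3
       s≤3 = subst (_≤ 3) (sym (size-mem u)) q
       9≤c : 9 ≤ size (not ∘ S)
       9≤c = +-cancelˡ-≤ 3 9 _ (begin
         12 ≤⟨ large ⟩
         n ≡⟨ sym (size-not S) ⟩
         size S + size (not ∘ S) ≤⟨ +-monoˡ-≤ _ s≤3 ⟩
         3 + size (not ∘ S) ∎)
       go : Bound (boundary S) (size S) (size (not ∘ S)) → size S + 2 ≤ boundary S
       go (inj₁ k) = ≤-trans (+-monoˡ-≤ 2 s≤3) (≤-trans (n≤1+n 5) k)
       go (inj₂ (inj₁ (inj₁ z))) = ⊥-elim (1+n≰n (subst (1 ≤_) (trans (sym (size-mem u)) z) p))
       go (inj₂ (inj₁ (inj₂ k))) = k
       go (inj₂ (inj₂ (inj₁ z))) = ⊥-elim (<⇒≱ (s≤s (z≤n {8})) (subst (9 ≤_) z 9≤c))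
       go (inj₂ (inj₂ (inj₂ k))) = ≤-trans (+-monoˡ-≤ 2 (≤-trans s≤3 (≤-trans (m≤m+n 3 6) 9≤c))) k

     b2n²≤2 : ∀ x y → b2n x + (b2n y + 0) ≤ 2
     b2n²≤2 true true = ≤-refl
     b2n²≤2 true false = s≤s z≤n
     b2n²≤2 false true = s≤s z≤n
     b2n²≤2 false false = z≤n

     exits-one : ∀ xs u a → nbr u a ∈ xs → exits xs u ≤ 2
     exits-one xs u a p with mem-in p
     exits-one xs u zero p | e rewrite e = b2n²≤2 (not (mem xs (nbr u i1))) (not (mem xs (nbr u i2)))
     exits-one xs u (suc zero) p | e rewrite e = b2n²≤2 (not (mem xs (nbr u i0))) (not (mem xs (nbr u i2)))
     exits-one xs u (suc (suc zero)) p | e rewrite e = b2n²≤2 (not (mem xs (nbr u i0))) (not (mem xs (nbr u i1)))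

     b2n≤1 : ∀ b → b2n b + 0 ≤ 1
     b2n≤1 true = ≤-refl
     b2n≤1 false = z≤n

     exits-two : ∀ xs u a b → a ≢ b → nbr u a ∈ xs → nbr u b ∈ xs → exits xs u ≤ 1
     exits-two xs u a b p q r with mem-in q | mem-in r
     exits-two xs u zero zero p q r | e | f = ⊥-elim (p refl)
     exits-two xs u (suc zero) (suc zero) p q r | e | f = ⊥-elim (p refl)
     exits-two xs u (suc (suc zero)) (suc (suc zero)) p q r | e | f = ⊥-elim (p refl)
     exits-two xs u zero (suc zero) p q r | e | f rewrite e | f = b2n≤1 (not (mem xs (nbr u i2)))
     exits-two xs u (suc zero) zero p q r | e | f rewrite e | f = b2n≤1 (not (mem xs (nbr u i2)))
     exits-two xs u zero (suc (suc zero)) p q r | e | f rewrite e | f = b2n≤1 (not (mem xs (nbr u i1)))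
     exits-two xs u (suc (suc zero)) zero p q r | e | f rewrite e | f = b2n≤1 (not (mem xs (nbr u i1)))
     exits-two xs u (suc zero) (suc (suc zero)) p q r | e | f rewrite e | f = b2n≤1 (not (mem xs (nbr u i0)))
     exits-two xs u (suc (suc zero)) (suc zero) p q r | e | f rewrite e | f = b2n≤1 (not (mem xs (nbr u i0)))

     no-loop : ∀ u a → nbr u a ≢ u
     no-loop u a e = 1+n≰n (≤-trans (small-boundary {u ∷ []} ([] ∷ []) ≤-refl (s≤s z≤n))
       (+-monoˡ-≤ 0 (exits-one (u ∷ []) u a (here e))))

     nbr-inj : ∀ u {a b} → a ≢ b → nbr u a ≢ nbr u b
     nbr-inj u {a} {b} p e = <⇒≱ (s≤s (s≤s (s≤s (z≤n {1}))))
       (≤-trans (small-boundary {xs} uni (s≤s z≤n) (s≤s (s≤s z≤n)))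
         (+-mono-≤ (exits-two xs u a b p (there (here refl)) (there (here (sym e))))
           (+-monoˡ-≤ 0 (exits-two xs v (proj₂ (opp (u , a))) (proj₂ (opp (u , b))) back (here (back-nbr a)) (here at-b)))))
       where
       v = nbr u a
       xs = u ∷ v ∷ []
       uni : Unique xs
       uni = ((λ q → no-loop u a (sym q)) ∷ []) ∷ [] ∷ []
       back-nbr : ∀ c → nbr (nbr u c) (proj₂ (opp (u , c))) ≡ u
       back-nbr c = cong proj₁ (opp-inv (u , c))
       at-b : nbr v (proj₂ (opp (u , b))) ≡ u
       at-b = trans (cong (λ z → nbr z (proj₂ (opp (u , b)))) e) (back-nbr b)
       back : proj₂ (opp (u , a)) ≢ proj₂ (opp (u , b))
       back q = p (cong proj₂ (trans (sym (opp-inv (u , a))) (trans (cong opp (cong₂ _,_ e q)) (opp-inv (u , b)))))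

     triangle-free : ∀ u v w → u ≢ v → u ≢ w → v ≢ w →
       Σ (Fin 3) (λ a → nbr u a ≡ v) → Σ (Fin 3) (λ a → nbr u a ≡ w) →
       Σ (Fin 3) (λ a → nbr v a ≡ w) → Σ (Fin 3) (λ a → nbr v a ≡ u) →
       Σ (Fin 3) (λ a → nbr w a ≡ u) → Σ (Fin 3) (λ a → nbr w a ≡ v) → ⊥
     triangle-free u v w p q r (a , a') (b , b') (c , c') (d , d') (e , e') (f , f') =
       <⇒≱ (s≤s (s≤s (s≤s (s≤s (z≤n {1})))))
         (≤-trans (small-boundary {xs} (((p ∷ q ∷ []) ∷ (r ∷ []) ∷ [] ∷ [])) (s≤s z≤n) ≤-refl)
           (+-mono-≤ (exits-two xs u a b (λ { refl → r (trans (sym a') b') }) (there (here a')) (there (there (here b'))))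
             (+-mono-≤ (exits-two xs v c d (λ { refl → q (trans (sym d') c') }) (there (there (here c'))) (here d'))
               (+-monoˡ-≤ 0 (exits-two xs w e f (λ { refl → p (trans (sym e') f') }) (here e') (there (here f')))))))
       where xs = u ∷ v ∷ w ∷ []

     joins : Fin n → Fin n → Bool
     joins u v = ⌊ nbr u i0 ≟ v ⌋ ∨ (⌊ nbr u i1 ≟ v ⌋ ∨ ⌊ nbr u i2 ≟ v ⌋)

     slot : ∀ u v → T (joins u v) → Σ (Fin 3) λ a → nbr u a ≡ v
     slot u v t with nbr u i0 ≟ v
     ... | yes e = i0 , e
     ... | no _ with nbr u i1 ≟ v
     ... | yes e = i1 , e
     ... | no _ with nbr u i2 ≟ v
     ... | yes e = i2 , e
     ... | no _ = ⊥-elim t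

     joins-nbr : ∀ u v a → nbr u a ≡ v → T (joins u v)
     joins-nbr u v a e with nbr u i0 ≟ v
     ... | yes _ = tt
     joins-nbr u v zero e | no p = ⊥-elim (p e)
     joins-nbr u v (suc a) e | no p with nbr u i1 ≟ v
     ... | yes _ = tt
     joins-nbr u v (suc zero) e | no p | no q = ⊥-elim (q e)
     joins-nbr u v (suc (suc zero)) e | no p | no q with nbr u i2 ≟ v
     ... | yes _ = tt
     ... | no r = ⊥-elim (r e)

     back : ∀ u v → Σ (Fin 3) (λ a → nbr u a ≡ v) → Σ (Fin 3) λ b → nbr v b ≡ u
     back u v (a , refl) = proj₂ (opp (u , a)) , cong proj₁ (opp-inv (u , a))

     joins-back : ∀ u v → T (joins u v) → T (joins v u)
     joins-back u v t = let (b , e) = back u v (slot u v t) in joins-nbr v u b e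

     T-ext : ∀ a b → (T a → T b) → (T b → T a) → a ≡ b
     T-ext true true f g = refl
     T-ext true false f g = ⊥-elim (f tt)
     T-ext false true f g = ⊥-elim (g tt)
     T-ext false false f g = refl

     graph : Graph n
     graph = record
       { adj = joins
       ; sym = λ u v → T-ext _ _ (joins-back u v) (joins-back v u)
       ; irrefl = λ v → T-ext _ false (λ t → let (a , e) = slot v v t in no-loop v a e) λ ()
       }

     slot-unique : ∀ u {v a b} → nbr u a ≡ v → nbr u b ≡ v → a ≡ b
     slot-unique u {v} {a} {b} e f with a ≟ b
     ... | yes p = p
     ... | no p = ⊥-elim (nbr-inj u p (trans e (sym f)))

     opp-slot : ∀ u v {a b} → nbr u a ≡ v → nbr v b ≡ u → opp (u , a) ≡ (v , b)
     opp-slot u v {a} {b} refl f = cong (v ,_) (slot-unique v (cong proj₁ (opp-inv (u , a))) f)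

     cubic : Cubic (Adj graph)
     cubic v = nbr v i0 , nbr v i1 , nbr v i2
       , (nbr-inj v (λ ()) , nbr-inj v (λ ()) , nbr-inj v (λ ()))
       , (joins-nbr v _ i0 refl , joins-nbr v _ i1 refl , joins-nbr v _ i2 refl)
       , λ w t → which w (slot v w t)
       where
       which : ∀ w → Σ (Fin 3) (λ a → nbr v a ≡ w) → (w ≡ nbr v i0 ⊎ w ≡ nbr v i1 ⊎ w ≡ nbr v i2)
       which w (zero , e) = inj₁ (sym e)
       which w (suc zero , e) = inj₂ (inj₁ (sym e))
       which w (suc (suc zero) , e) = inj₂ (inj₂ (sym e))

     -- The three neighbours are distinct, so the three half-edge terms at a vertex are different
     -- terms of the row sum in `cutSize`.
     boundary≤cut : ∀ S → boundary S ≤ cutSize graph S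
     boundary≤cut S = sumFin-mono λ u → ≤-trans (≤-reflexive (terms u)) (sumOver-≤ (f u) {nbr u i0 ∷ nbr u i1 ∷ nbr u i2 ∷ []}
         ((nbr-inj u (λ ()) ∷ nbr-inj u (λ ()) ∷ []) ∷ (nbr-inj u (λ ()) ∷ []) ∷ [] ∷ []))
       where
       f : Fin n → Fin n → ℕ
       f u v = b2n (joins u v ∧ (S u ∧ not (S v)))
       term : ∀ u a → leave S u a ≡ f u (nbr u a)
       term u a rewrite T-true (joins-nbr u (nbr u a) a refl) = refl
       terms : ∀ u → leave S u i0 + (leave S u i1 + leave S u i2) ≡ sumOver (f u) (nbr u i0 ∷ nbr u i1 ∷ nbr u i2 ∷ [])
       terms u = cong₂ _+_ (term u i0) (cong₂ _+_ (term u i1) (trans (term u i2) (sym (+-identityʳ _))))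

     unique-size : ∀ S {xs} → Unique xs → All (λ v → T (S v)) xs → length xs ≤ size S
     unique-size S {xs} u p = ≤-trans (≤-reflexive (sym (ones xs p))) (sumOver-≤ (b2n ∘ S) u)
       where
       ones : ∀ ys → All (λ v → T (S v)) ys → sumOver (b2n ∘ S) ys ≡ length ys
       ones [] _ = refl
       ones (y ∷ ys) (q ∷ qs) rewrite T-true q = cong suc (ones ys qs)

     cycle-size : ∀ S → HasCycleIn (Adj graph) (λ v → T (S v)) → 4 ≤ size S
     cycle-size S (x , [] , () , _)
     cycle-size S (x , y ∷ [] , s≤s () , _)
     cycle-size S (x , y ∷ z ∷ [] , _ , ((p ∷ q ∷ []) ∷ (r ∷ []) ∷ _) , _ , (xy , yz , zx , _)) =
       ⊥-elim (triangle-free x y z p q r (slot x y xy) (back z x (slot z x zx)) (slot y z yz) (back x y (slot x y xy))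
         (slot z x zx) (back y z (slot y z yz)))
     cycle-size S (x , y ∷ z ∷ t ∷ ys , _ , u , a , _) = ≤-trans (s≤s (s≤s (s≤s (s≤s z≤n)))) (unique-size S u a)

     cyclically-6-connected : CyclicallyConnected 6 graph
     cyclically-6-connected S in-S out-S = ≤-trans (go (bound S)) (boundary≤cut S)
       where
       big : ∀ {s k} → 4 ≤ s → s ≡ 0 ⊎ s + 2 ≤ k → 6 ≤ k
       big p (inj₁ refl) = ⊥-elim (<⇒≱ (s≤s (z≤n {3})) p)
       big p (inj₂ q) = ≤-trans (+-monoˡ-≤ 2 p) q
       go : Bound (boundary S) (size S) (size (not ∘ S)) → 6 ≤ boundary S
       go (inj₁ p) = p
       go (inj₂ (inj₁ p)) = big (cycle-size S in-S) p
       go (inj₂ (inj₂ p)) = big (cycle-size (not ∘ S) out-S) p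

     Reach-trans : ∀ {u v w} → Reach (Adj graph) u v → Reach (Adj graph) v w → Reach (Adj graph) u w
     Reach-trans here q = q
     Reach-trans (step e p) q = step e (Reach-trans p q)

     -- Induction on the number of vertices outside `S`: as long as there is one, `Bound` forces an
     -- edge to leave `S`, and its far end can be added to the reached set.
     grow : ∀ u k S → size (not ∘ S) ≤ k → S u ≡ true → (∀ v → S v ≡ true → Reach (Adj graph) u v) →
            ∀ v → Reach (Adj graph) u v
     grow u k S le su reach v with size (not ∘ S) in e
     grow u k S le su reach v | zero = reach v (all (S v) refl)
       where
       all : ∀ b → S v ≡ b → S v ≡ true
       all true q = q
       all false q = ⊥-elim (1+n≰n (≤-trans (subst (λ b → 1 ≤ b2n (not b) + 0) (sym q) ≤-refl)
         (≤-trans (sumOver-≤ (b2n ∘ not ∘ S) {v ∷ []} ([] ∷ [])) (≤-reflexive e))))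
     grow u zero S () su reach v | suc c
     grow u (suc k) S le su reach v | suc c = extend (sumFin-pos _ leaves)
       where
       1≤s : 1 ≤ size S
       1≤s = ≤-trans (subst (λ b → 1 ≤ b2n b + 0) (sym su) ≤-refl) (sumOver-≤ (b2n ∘ S) {u ∷ []} ([] ∷ []))
       leaves : 1 ≤ boundary S
       leaves = go (bound S)
         where
         go : Bound (boundary S) (size S) (size (not ∘ S)) → 1 ≤ boundary S
         go (inj₁ p) = ≤-trans (s≤s z≤n) p
         go (inj₂ (inj₁ (inj₁ p))) = ⊥-elim (1+n≰n (subst (1 ≤_) p 1≤s))
         go (inj₂ (inj₁ (inj₂ p))) = ≤-trans (≤-trans (s≤s z≤n) (m≤n+m 2 (size S))) p
         go (inj₂ (inj₂ (inj₁ p))) with trans (sym e) p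
         ... | ()
         go (inj₂ (inj₂ (inj₂ p))) = ≤-trans (≤-trans (s≤s z≤n) (m≤n+m 2 (size (not ∘ S)))) p
       extend : Σ (Fin n) (λ x → 1 ≤ leave S x i0 + (leave S x i1 + leave S x i2)) → Reach (Adj graph) u v
       extend (x , p) = by (exit (S x) (S (nbr x i0)) (S (nbr x i1)) (S (nbr x i2)) refl refl refl refl p)
         where
         exit : ∀ b p q r → S x ≡ b → S (nbr x i0) ≡ p → S (nbr x i1) ≡ q → S (nbr x i2) ≡ r →
           1 ≤ b2n (b ∧ not p) + (b2n (b ∧ not q) + b2n (b ∧ not r)) →
           S x ≡ true × Σ (Fin 3) λ a → S (nbr x a) ≡ false
         exit true false q r f g h k _ = f , i0 , g
         exit true true false r f g h k _ = f , i1 , h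
         exit true true true false f g h k _ = f , i2 , k
         by : S x ≡ true × Σ (Fin 3) (λ a → S (nbr x a) ≡ false) → Reach (Adj graph) u v
         by (sx , a , sy) = grow u k S' (s≤s⁻¹ (≤-trans smaller (subst (_≤ suc k) (sym e) le))) (in-S' u su) reach' v
           where
           y = nbr x a
           S' : Fin n → Bool
           S' i = ⌊ i ≟ y ⌋ ∨ S i
           in-S' : ∀ i → S i ≡ true → S' i ≡ true
           in-S' i q with i ≟ y
           ... | yes _ = refl
           ... | no _ = q
           reach' : ∀ i → S' i ≡ true → Reach (Adj graph) u i
           reach' i q with i ≟ y
           ... | yes refl = Reach-trans (reach x sx) (step (joins-nbr x y a refl) here)
           ... | no _ = reach i q
           smaller : size (not ∘ S') < size (not ∘ S)
           smaller = ≤-reflexive (sym (trans (sumFin-clear y (b2n ∘ not ∘ S)) (cong₂ _+_ (cong (b2n ∘ not) sy) (sumFin-cong same))))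
             where
             same : ∀ i → clear y (b2n ∘ not ∘ S) i ≡ b2n (not (S' i))
             same i with i ≟ y
             ... | yes _ = refl
             ... | no _ = refl

     connected : Connected (Adj graph)
     connected u = grow u n (λ i → ⌊ i ≟ u ⌋) (≤-trans (m≤n+m _ _) (≤-reflexive (size-not _))) at-u only-u
       where
       at-u : ⌊ u ≟ u ⌋ ≡ true
       at-u with u ≟ u
       ... | yes _ = refl
       ... | no p = ⊥-elim (p refl)
       only-u : ∀ v → ⌊ v ≟ u ⌋ ≡ true → Reach (Adj graph) u v
       only-u v e with v ≟ u
       ... | yes refl = here

     Half : Set
     Half = Fin n × Fin 3

     Consistent : (Half → C) → Set
     Consistent F = ∀ h → F (opp h) ≡ F h

     around : (C → C → C → Bool) → (Half → C) → Fin n → Bool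
     around p F x = p (F (x , i0)) (F (x , i1)) (F (x , i2))

     four-colourable : (F : Half → C) → Consistent F → (∀ x → around distinct F x ≡ true) → EdgeColourable (Adj graph) 4
     four-colourable F con ok = c , c-sym , c-proper
       where
       c : ∀ u v → Adj graph u v → Fin 4
       c u v e = col₄ (F (u , proj₁ (slot u v e)))
       c-sym : ∀ u v e e' → c u v e ≡ c v u e'
       c-sym u v e e' = cong col₄ (trans (sym (con _)) (cong F (opp-slot u v (proj₂ (slot u v e)) (proj₂ (slot v u e')))))
       c-proper : ∀ u v w e f → v ≢ w → c u v e ≢ c u w f
       c-proper u v w e f p q with slot u v e | slot u w f
       ... | a , refl | b , refl = distinct-at _ _ _ (ok u) a b (λ { refl → p refl })
              (trans (at-η (λ a → F (u , a)) a) (trans (col₄-inj _ _ q) (sym (at-η (λ a → F (u , a)) b))))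

     minus-colourable : ∀ s t (F : Half → C) → Consistent F → (∀ x → x ≢ s → x ≢ t → around proper F x ≡ true) →
       EdgeColourable (AdjMinus2 (Adj graph) s t) 3
     minus-colourable s t F con ok = c , c-sym , c-proper
       where
       c : ∀ u v → AdjMinus2 (Adj graph) s t u v → Fin 3
       c (u , _) (v , _) e = col₃ (F (u , proj₁ (slot u v e)))
       c-sym : ∀ u v e e' → c u v e ≡ c v u e'
       c-sym (u , _) (v , _) e e' = cong col₃ (trans (sym (con _)) (cong F (opp-slot u v (proj₂ (slot u v e)) (proj₂ (slot v u e')))))
       -- Removed vertices are excluded by maps into the proof-irrelevant ⊥, so equal vertices give equal elements of Minus2.
       c-proper : ∀ u v w e f → v ≢ w → c u v e ≢ c u w f
       c-proper (u , us , ut) (v , _) (w , _) e f p q with slot u v e | slot u w f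
       ... | a , refl | b , refl = distinct-at _ _ _ (&-fst okᵤ) a b (λ { refl → p refl })
              (trans (at-η (λ a → F (u , a)) a) (trans (col₃-inj _ _ (nz a) (nz b) q) (sym (at-η (λ a → F (u , a)) b))))
         where
         okᵤ = ok u us ut
         nz : ∀ a → nonzero (F (u , a)) ≡ true
         nz a = trans (cong nonzero (sym (at-η (λ a → F (u , a)) a))) (nonzero-at _ _ _ okᵤ a)

     module Colour₃ (s t : Fin n) (s≢t : s ≢ t)
                    (apart : ∀ x a b → nbr x a ≡ s → nbr x b ≡ t → ⊥)
                    (stuck : ∀ F → Consistent F → (∀ x → x ≢ s → x ≢ t → around proper F x ≡ true) → ⊥) where

       not-3-colourable : ¬ EdgeColourable (Adj graph) 3
       not-3-colourable (c , c-sym , c-proper) = stuck F con λ x _ _ → lift₃-proper _ _ _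
           (c-proper _ _ _ _ _ (nbr-inj x λ ())) (c-proper _ _ _ _ _ (nbr-inj x λ ())) (c-proper _ _ _ _ _ (nbr-inj x λ ()))
         where
         F : Half → C
         F (x , a) = lift₃ (c x (nbr x a) (joins-nbr x _ a refl))
         con : Consistent F
         con (x , a) = cong lift₃ (trans (c-sym y _ _ (subst (λ z → Adj graph z y) (sym y-x) (joins-nbr x y a refl))) (coh y-x))
           where
           y = nbr x a
           b = proj₂ (opp (x , a))
           y-x : nbr y b ≡ x
           y-x = cong proj₁ (opp-inv (x , a))
           coh : ∀ {z} (e : z ≡ x) {p : Adj graph z y} → c z y p ≡ c x y (joins-nbr x y a refl)
           coh refl = cong (c x y) (T-irr _ _)

       Kept : Fin n → Set
       Kept x = x ≢ s × x ≢ t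

       kept? : ∀ x → Dec (Kept x)
       kept? x with x ≟ s | x ≟ t
       ... | no p | no q = yes (p , q)
       ... | yes p | _ = no λ r → proj₁ r p
       ... | no _ | yes q = no λ r → proj₂ r q

       lost : ∀ x → ¬ Kept x → x ≡ s ⊎ x ≡ t
       lost x p with x ≟ s | x ≟ t
       ... | yes q | _ = inj₁ q
       ... | no _ | yes q = inj₂ q
       ... | no q | no r = ⊥-elim (p (q , r))

       two-lost : ∀ x a b → a ≢ b → ¬ Kept (nbr x a) → ¬ Kept (nbr x b) → ⊥
       two-lost x a b p e f with lost _ e | lost _ f
       ... | inj₁ q | inj₁ r = nbr-inj x p (trans q (sym r))
       ... | inj₁ q | inj₂ r = apart x a b q r
       ... | inj₂ q | inj₁ r = apart x b a r q
       ... | inj₂ q | inj₂ r = nbr-inj x p (trans q (sym r))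

       -- By `apart` a remaining vertex has at most one removed neighbour. The edge towards it takes
       -- the colour missing at the vertex, which turns a 3-colouring of the rest into a half-edge
       -- colouring that is proper off `s` and `t`, and `stuck` refutes it.
       not-bicritical-at : ¬ EdgeColourable (AdjMinus2 (Adj graph) s t) 3
       not-bicritical-at (c , c-sym , c-proper) = stuck F con λ x p q → ok x (p , q)
         where
         open import Data.Bool.Properties using (T?)
         edge : Fin n → Fin n → C
         edge x y with kept? x | kept? y | T? (joins x y)
         ... | yes p | yes q | yes j = lift₃ (c (x , p) (y , q) j)
         ... | _ | _ | _ = c0
         edge-kept : ∀ x y (p : Kept x) (q : Kept y) j → edge x y ≡ lift₃ (c (x , p) (y , q) j)
         edge-kept x y p q j with kept? x | kept? y | T? (joins x y)
         ... | yes _ | yes _ | yes j' = cong (λ j → lift₃ (c (x , p) (y , q) j)) (T-irr j' j)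
         ... | no r | _ | _ = ⊥-elim (r p)
         ... | yes _ | no r | _ = ⊥-elim (r q)
         ... | yes _ | yes _ | no r = ⊥-elim (r j)
         edge-lost : ∀ x y → ¬ Kept x ⊎ ¬ Kept y → edge x y ≡ c0
         edge-lost x y r with kept? x | kept? y | T? (joins x y)
         edge-lost x y (inj₁ r) | yes p | yes q | yes j = ⊥-elim (r p)
         edge-lost x y (inj₂ r) | yes p | yes q | yes j = ⊥-elim (r q)
         ... | yes _ | yes _ | no _ = refl
         ... | yes _ | no _ | _ = refl
         ... | no _ | _ | _ = refl
         absorb : ∀ {e v} f g → e ≡ lift₃ v → complete e f g ≡ e
         absorb {v = v} f g refl = complete-lift v f g
         full : Half → C
         full (x , zero) = complete (edge x (nbr x i0)) (edge x (nbr x i1)) (edge x (nbr x i2))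
         full (x , suc zero) = complete (edge x (nbr x i1)) (edge x (nbr x i2)) (edge x (nbr x i0))
         full (x , suc (suc zero)) = complete (edge x (nbr x i2)) (edge x (nbr x i0)) (edge x (nbr x i1))
         full-kept : ∀ x a (p : Kept x) (q : Kept (nbr x a)) → full (x , a) ≡ edge x (nbr x a)
         full-kept x zero p q = absorb _ _ (edge-kept x _ p q (joins-nbr x _ i0 refl))
         full-kept x (suc zero) p q = absorb _ _ (edge-kept x _ p q (joins-nbr x _ i1 refl))
         full-kept x (suc (suc zero)) p q = absorb _ _ (edge-kept x _ p q (joins-nbr x _ i2 refl))
         vanish : ∀ {e f g} → e ≡ c0 → f ≡ c0 → g ≡ c0 → complete e f g ≡ c0
         vanish refl refl refl = refl
         full-lost : ∀ x a → ¬ Kept x → full (x , a) ≡ c0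
         full-lost x zero p = vanish (edge-lost x _ (inj₁ p)) (edge-lost x _ (inj₁ p)) (edge-lost x _ (inj₁ p))
         full-lost x (suc zero) p = vanish (edge-lost x _ (inj₁ p)) (edge-lost x _ (inj₁ p)) (edge-lost x _ (inj₁ p))
         full-lost x (suc (suc zero)) p = vanish (edge-lost x _ (inj₁ p)) (edge-lost x _ (inj₁ p)) (edge-lost x _ (inj₁ p))
         -- At a removed vertex the colour is read at the other end of the edge, where it was
         -- completed; between two removed vertices both readings are `c0`.
         pickF : ∀ {x} → Dec (Kept x) → Half → C
         pickF (yes _) h = full h
         pickF (no _) h = full (opp h)
         F : Half → C
         F h = pickF (kept? (proj₁ h)) h
         con : Consistent F
         con h@(x , a) = go (kept? x) (kept? y)
           where
           y = nbr x a
           b = proj₂ (opp h)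
           y-x : nbr y b ≡ x
           y-x = cong proj₁ (opp-inv h)
           go : (p : Dec (Kept x)) (q : Dec (Kept y)) → pickF q (opp h) ≡ pickF p h
           go (yes p) (yes q) = trans (full-kept y b q (subst Kept (sym y-x) p)) (trans (cong (edge y) y-x)
               (trans (edge-kept y x q p (joins-nbr y x b y-x)) (trans (cong lift₃ (c-sym _ _ _ _))
                 (trans (sym (edge-kept x y p q (joins-nbr x y a refl))) (sym (full-kept x a p q))))))
           go (yes p) (no q) = cong full (opp-inv h)
           go (no p) (yes q) = refl
           go (no p) (no q) = trans (cong full (opp-inv h)) (trans (full-lost x a p) (sym (full-lost y b q)))
         ok : ∀ x → Kept x → around proper F x ≡ true
         ok x p with kept? x
         ... | no q = ⊥-elim (q p)
         ... | yes _ = go (kept? (nbr x i0)) (kept? (nbr x i1)) (kept? (nbr x i2))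
           where
           live : ∀ a → Kept (nbr x a) → Fin 3
           live a q = c (x , p) (nbr x a , q) (joins-nbr x _ a refl)
           live-eq : ∀ a (q : Kept (nbr x a)) → edge x (nbr x a) ≡ lift₃ (live a q)
           live-eq a q = edge-kept x _ p q (joins-nbr x _ a refl)
           live-≢ : ∀ a b q r → a ≢ b → live a q ≢ live b r
           live-≢ a b q r a≢b = c-proper _ _ _ _ _ λ e → nbr-inj x a≢b (cong proj₁ e)
           dead-eq : ∀ a → ¬ Kept (nbr x a) → edge x (nbr x a) ≡ c0
           dead-eq a q = edge-lost x _ (inj₂ q)
           Goal : Set
           Goal = completed (edge x (nbr x i0)) (edge x (nbr x i1)) (edge x (nbr x i2)) ≡ true
           on : ∀ {e f g e' f' g'} → e ≡ e' → f ≡ f' → g ≡ g' → completed e' f' g' ≡ true → completed e f g ≡ true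
           on refl refl refl r = r
           go : Dec (Kept (nbr x i0)) → Dec (Kept (nbr x i1)) → Dec (Kept (nbr x i2)) → Goal
           go (yes q₀) (yes q₁) (yes q₂) = on (live-eq i0 q₀) (live-eq i1 q₁) (live-eq i2 q₂)
             (completed-lift (live i0 q₀) (live i1 q₁) (live i2 q₂) (live-≢ i0 i1 q₀ q₁ λ ()) (live-≢ i0 i2 q₀ q₂ λ ()) (live-≢ i1 i2 q₁ q₂ λ ()))
           go (no q₀) (yes q₁) (yes q₂) = on (dead-eq i0 q₀) (live-eq i1 q₁) (live-eq i2 q₂)
             (&-fst (completed-two (live i1 q₁) (live i2 q₂) (live-≢ i1 i2 q₁ q₂ λ ())))
           go (yes q₀) (no q₁) (yes q₂) = on (live-eq i0 q₀) (dead-eq i1 q₁) (live-eq i2 q₂)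
             (&-fst (&-snd {completed c0 X Y} (completed-two (live i0 q₀) (live i2 q₂) (live-≢ i0 i2 q₀ q₂ λ ()))))
             where X = lift₃ (live i0 q₀); Y = lift₃ (live i2 q₂)
           go (yes q₀) (yes q₁) (no q₂) = on (live-eq i0 q₀) (live-eq i1 q₁) (dead-eq i2 q₂)
             (&-snd {completed X c0 Y} (&-snd {completed c0 X Y} (completed-two (live i0 q₀) (live i1 q₁) (live-≢ i0 i1 q₀ q₁ λ ()))))
             where X = lift₃ (live i0 q₀); Y = lift₃ (live i1 q₁)
           go (no q₀) (no q₁) _ = ⊥-elim (two-lost x i0 i1 (λ ()) q₀ q₁)
           go (no q₀) (yes _) (no q₂) = ⊥-elim (two-lost x i0 i2 (λ ()) q₀ q₂)
           go (yes _) (no q₁) (no q₂) = ⊥-elim (two-lost x i1 i2 (λ ()) q₁ q₂)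

       strictly-critical : (∀ u a → Σ (Half → C) λ F → Consistent F × (∀ x → x ≢ u → x ≢ nbr u a → around proper F x ≡ true)) →
         Σ (Half → C) (λ F → Consistent F × (∀ x → around distinct F x ≡ true)) →
         CyclicallyConnected 6 graph × StrictlyCritical graph
       strictly-critical flows (F , con , ok) = cyclically-6-connected , (snark , critical) , λ b → not-bicritical-at (proj₂ b s t s≢t)
         where
         snark : Snark graph
         snark = connected , cubic , four-colourable F con ok , not-3-colourable
         critical : ∀ u v → u ≢ v → Adj graph u v → EdgeColourable (AdjMinus2 (Adj graph) u v) 3
         critical u v _ e with slot u v e
         ... | a , refl = let (F , con , ok) = flows u a in minus-colourable u (nbr u a) F con ok

module Network where
 open import Defs
 open Gluing
 open HalfEdgeGraphs
 open import Data.Nat using (ℕ; zero; suc; _+_; _<ᵇ_; _≡ᵇ_)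
 open import Data.Nat.Properties using (≡ᵇ⇒≡; +-assoc)
 open import Data.Nat.DivMod using (_mod_)
 open import Data.Bool using (Bool; true; false; not; T; if_then_else_)
 open import Data.Fin using (Fin; zero; suc; toℕ; fromℕ; inject₁; splitAt; _↑ˡ_; _↑ʳ_)
 open import Data.Fin.Properties using (toℕ-injective; splitAt-↑ˡ; splitAt-↑ʳ; splitAt⁻¹-↑ˡ; splitAt⁻¹-↑ʳ)
 open import Data.Fin.Relation.Unary.Top using (view; ‵fromℕ; ‵inject₁; view-fromℕ; view-inject₁)
 open import Data.List using (List; []; _∷_)
 import Data.List.Relation.Unary.Any as Any
 open import Data.List.Relation.Unary.All using ([]; _∷_)
 open import Data.Product using (Σ; _×_; _,_; proj₁; proj₂)
 open import Data.Sum using (_⊎_; inj₁; inj₂)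
 open import Data.Unit using (tt)
 open import Function using (_∘_)
 open import Relation.Binary.PropositionalEquality

 -- The network: blocks with ports, their partners, and the chain.

 allFin? : ∀ n → (Fin n → Bool) → Bool
 allFin? zero f = true
 allFin? (suc n) f = f zero & allFin? n (f ∘ suc)

 allFin-sound : ∀ n f → allFin? n f ≡ true → ∀ i → f i ≡ true
 allFin-sound (suc n) f e zero = &-fst e
 allFin-sound (suc n) f e (suc i) = allFin-sound n (f ∘ suc) (&-snd {f zero} e) i

 eqFin : ∀ {n} → Fin n → Fin n → Bool
 eqFin i j = toℕ i ≡ᵇ toℕ j

 eqFin-sound : ∀ {n} (i j : Fin n) → eqFin i j ≡ true → i ≡ j
 eqFin-sound i j e = toℕ-injective (≡ᵇ⇒≡ _ _ (subst T (sym e) tt))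

 nth : {A : Set} → A → List A → ℕ → A
 nth d [] _ = d
 nth d (x ∷ xs) zero = x
 nth d (x ∷ xs) (suc k) = nth d xs k

 -- A block with up to six numbered ports; real tells which ports exist.
 record Net (real : Fin 6 → Bool) : Set where
   field
     size : ℕ
     label : Fin size → Fin 3 → ℕ
     link : Fin size → Fin 3 → (Fin size × Fin 3) ⊎ Fin 6
     port : Fin 6 → Fin size × Fin 3
     link-inner : ∀ v a v' a' → link v a ≡ inj₁ (v' , a') → link v' a' ≡ inj₁ (v , a)
     link-label : ∀ v a v' a' → link v a ≡ inj₁ (v' , a') → label v a ≡ label v' a'
     link-port : ∀ v a p → link v a ≡ inj₂ p → port p ≡ (v , a) × real p ≡ true × label v a ≡ toℕ p
     port-link : ∀ p → real p ≡ true → link (proj₁ (port p)) (proj₂ (port p)) ≡ inj₂ p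

 -- A label below six is a port; every other label is an edge and is found at the two corners which
 -- it joins. `okNet` confirms this by evaluation.
 module Build (s : ℕ) (rows : List (List ℕ)) (real : Fin 6 → Bool) where
   Slot : Set
   Slot = Fin (suc s) × Fin 3

   lab : Fin (suc s) → Fin 3 → ℕ
   lab v a = nth 99 (nth [] rows (toℕ v)) (toℕ a)

   eqSlot : Slot → Slot → Bool
   eqSlot (v , a) (w , b) = eqFin v w & eqFin a b

   eqSlot-sound : ∀ h k → eqSlot h k ≡ true → h ≡ k
   eqSlot-sound (v , a) (w , b) e = cong₂ _,_ (eqFin-sound v w (&-fst e)) (eqFin-sound a b (&-snd {eqFin v w} e))

   firstFin : {A : Set} → A → ∀ n → (Fin n → A → A) → A
   firstFin d zero f = d
   firstFin d (suc n) f = f zero (firstFin d n (f ∘ suc))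

   search : (Slot → Bool) → Slot
   search f = firstFin (zero , zero) (suc s) λ v r → firstFin r 3 λ a r' → if f (v , a) then (v , a) else r'

   prt : Fin 6 → Slot
   prt p = search λ { (v , a) → lab v a ≡ᵇ toℕ p }

   lnk : Fin (suc s) → Fin 3 → Slot ⊎ Fin 6
   lnk v a = if lab v a <ᵇ 6 then inj₂ (lab v a mod 6)
             else inj₁ (search λ { (w , b) → (lab v a ≡ᵇ lab w b) & not (eqSlot (v , a) (w , b)) })

   isInner : Slot ⊎ Fin 6 → Slot → Bool
   isInner (inj₁ h) k = eqSlot h k
   isInner (inj₂ _) k = false

   isPort : Slot ⊎ Fin 6 → Fin 6 → Bool
   isPort (inj₁ _) p = false
   isPort (inj₂ q) p = eqFin q p

   isInner-sound : ∀ x h → isInner x h ≡ true → x ≡ inj₁ h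
   isInner-sound (inj₁ k) h e = cong inj₁ (eqSlot-sound k h e)

   isPort-sound : ∀ x p → isPort x p ≡ true → x ≡ inj₂ p
   isPort-sound (inj₂ q) p e = cong inj₂ (eqFin-sound q p e)

   okSlot : Slot → Slot ⊎ Fin 6 → Bool
   okSlot (v , a) (inj₁ (w , b)) = isInner (lnk w b) (v , a) & (lab v a ≡ᵇ lab w b)
   okSlot (v , a) (inj₂ p) = eqSlot (prt p) (v , a) & real p & (lab v a ≡ᵇ toℕ p)

   okAt : Fin (suc s) → Fin 3 → Bool
   okAt v a = okSlot (v , a) (lnk v a)

   okPort : Fin 6 → Bool
   okPort p = if real p then isPort (lnk (proj₁ (prt p)) (proj₂ (prt p))) p else true

   okNet : Bool
   okNet = allFin? (suc s) (λ v → allFin? 3 (okAt v)) & allFin? 6 okPort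

   build : okNet ≡ true → Net real
   build ok = record
     { size = suc s ; label = lab ; link = lnk ; port = prt
     ; link-inner = λ v a w b e → isInner-sound _ _ (&-fst (inner v a w b e))
     ; link-label = λ v a w b e → ≡ᵇ⇒≡ _ _ (subst T (sym (&-snd {isInner (lnk w b) (v , a)} (inner v a w b e))) tt)
     ; link-port = λ v a p e → eqSlot-sound _ _ (&-fst (outer v a p e)) , &-fst (&-snd {eqSlot (prt p) (v , a)} (outer v a p e))
         , ≡ᵇ⇒≡ _ _ (subst T (sym (&-snd {real p} (&-snd {eqSlot (prt p) (v , a)} (outer v a p e)))) tt)
     ; port-link = λ p r → isPort-sound _ p (when r
         (allFin-sound 6 okPort (&-snd {allFin? (suc s) λ v → allFin? 3 (okAt v)} ok) p))
     }
     where
     when : ∀ {b x} → b ≡ true → (if b then x else true) ≡ true → x ≡ true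
     when refl e = e
     slots : ∀ v a → okSlot (v , a) (lnk v a) ≡ true
     slots v a = allFin-sound 3 (okAt v) (allFin-sound (suc s) (λ v → allFin? 3 (okAt v)) (&-fst ok) v) a
     inner : ∀ v a w b → lnk v a ≡ inj₁ (w , b) → okSlot (v , a) (inj₁ (w , b)) ≡ true
     inner v a w b e = subst (λ x → okSlot (v , a) x ≡ true) e (slots v a)
     outer : ∀ v a p → lnk v a ≡ inj₂ p → okSlot (v , a) (inj₂ p) ≡ true
     outer v a p e = subst (λ x → okSlot (v , a) x ≡ true) e (slots v a)

 data Kind : Set where
   vert slot : Kind

 all6 first3 : Fin 6 → Bool
 all6 _ = true
 first3 p = toℕ p <ᵇ 3

 realK : Kind → Fin 6 → Bool
 realK vert = first3
 realK slot = all6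

 record Row : Set where
   constructor row
   field twist moves : List ℕ
         glue : ℕ

 data Mate : Set where
   to : ℕ → ℕ → Mate
   head tail : ℕ → Mate

 -- The flower snark J5 without two vertices, to which the ports 0, 1, 2 and the ports 3, 4, 5 were
 -- attached. The first was on the 5-cycle, the second the centre of a claw.
 labelsP : List (List ℕ)
 labelsP =
   (8 ∷ 9 ∷ 26 ∷ []) ∷ (0 ∷ 6 ∷ 8 ∷ []) ∷ (20 ∷ 25 ∷ 26 ∷ []) ∷ (6 ∷ 7 ∷ 28 ∷ []) ∷ (25 ∷ 27 ∷ 29 ∷ []) ∷ (22 ∷ 27 ∷ 28 ∷ []) ∷
   (7 ∷ 10 ∷ 11 ∷ []) ∷ (16 ∷ 19 ∷ 20 ∷ []) ∷ (3 ∷ 11 ∷ 16 ∷ []) ∷ (9 ∷ 12 ∷ 13 ∷ []) ∷ (10 ∷ 12 ∷ 14 ∷ []) ∷ (4 ∷ 13 ∷ 17 ∷ []) ∷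
   (17 ∷ 21 ∷ 22 ∷ []) ∷ (19 ∷ 21 ∷ 23 ∷ []) ∷ (2 ∷ 24 ∷ 29 ∷ []) ∷ (18 ∷ 23 ∷ 24 ∷ []) ∷ (1 ∷ 14 ∷ 15 ∷ []) ∷ (5 ∷ 15 ∷ 18 ∷ []) ∷ []

 sweepP : List Row
 sweepP =
   row (2 ∷ 2 ∷ 2 ∷ []) ([]) 0 ∷ row (1 ∷ 1 ∷ 2 ∷ []) (0 ∷ []) 1 ∷ row (1 ∷ 1 ∷ 2 ∷ []) (3 ∷ []) 1 ∷ row (2 ∷ 2 ∷ 2 ∷ []) (3 ∷ []) 1 ∷
   row (2 ∷ 2 ∷ 2 ∷ []) (3 ∷ []) 1 ∷ row (2 ∷ 2 ∷ []) (3 ∷ 1 ∷ []) 2 ∷ row (2 ∷ 2 ∷ 2 ∷ []) (2 ∷ []) 1 ∷ row (1 ∷ 1 ∷ 2 ∷ []) (4 ∷ []) 1 ∷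
   row (1 ∷ 2 ∷ []) (3 ∷ 1 ∷ []) 2 ∷ row (2 ∷ 2 ∷ 2 ∷ []) (6 ∷ []) 1 ∷ row (2 ∷ 1 ∷ 2 ∷ []) (4 ∷ 1 ∷ []) 2 ∷ row (2 ∷ 1 ∷ 2 ∷ []) (1 ∷ []) 1 ∷
   row (1 ∷ 2 ∷ 2 ∷ []) (5 ∷ 2 ∷ []) 2 ∷ row (2 ∷ 1 ∷ 2 ∷ []) (4 ∷ 1 ∷ []) 2 ∷ row (1 ∷ 1 ∷ 2 ∷ []) (4 ∷ []) 1 ∷ row (1 ∷ 2 ∷ []) (2 ∷ 2 ∷ []) 2 ∷
   row (2 ∷ 1 ∷ 2 ∷ []) (3 ∷ []) 1 ∷ row (2 ∷ 2 ∷ []) (2 ∷ 2 ∷ []) 2 ∷ []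

 finalP : List ℕ
 finalP = 0 ∷ 3 ∷ 4 ∷ 4 ∷ 4 ∷ 5 ∷ []

 labelsQ : List (List ℕ)
 labelsQ =
   (32 ∷ 33 ∷ 34 ∷ []) ∷ (11 ∷ 33 ∷ 35 ∷ []) ∷ (3 ∷ 35 ∷ 36 ∷ []) ∷ (32 ∷ 42 ∷ 43 ∷ []) ∷ (29 ∷ 40 ∷ 43 ∷ []) ∷ (34 ∷ 37 ∷ 44 ∷ []) ∷
   (8 ∷ 10 ∷ 11 ∷ []) ∷ (21 ∷ 41 ∷ 42 ∷ []) ∷ (31 ∷ 36 ∷ 41 ∷ []) ∷ (7 ∷ 28 ∷ 29 ∷ []) ∷ (28 ∷ 30 ∷ 31 ∷ []) ∷ (30 ∷ 37 ∷ 38 ∷ []) ∷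
   (16 ∷ 38 ∷ 39 ∷ []) ∷ (4 ∷ 39 ∷ 40 ∷ []) ∷ (1 ∷ 8 ∷ 9 ∷ []) ∷ (9 ∷ 17 ∷ 18 ∷ []) ∷ (15 ∷ 16 ∷ 17 ∷ []) ∷ (18 ∷ 19 ∷ 20 ∷ []) ∷
   (19 ∷ 21 ∷ 22 ∷ []) ∷ (14 ∷ 22 ∷ 23 ∷ []) ∷ (12 ∷ 14 ∷ 15 ∷ []) ∷ (10 ∷ 12 ∷ 13 ∷ []) ∷ (0 ∷ 6 ∷ 7 ∷ []) ∷ (6 ∷ 13 ∷ 27 ∷ []) ∷
   (20 ∷ 26 ∷ 27 ∷ []) ∷ (5 ∷ 25 ∷ 44 ∷ []) ∷ (24 ∷ 25 ∷ 26 ∷ []) ∷ (2 ∷ 23 ∷ 24 ∷ []) ∷ []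

 sweepQ : List Row
 sweepQ =
   row (2 ∷ 2 ∷ 2 ∷ []) ([]) 0 ∷ row (2 ∷ 1 ∷ 2 ∷ []) (1 ∷ []) 1 ∷ row (2 ∷ 1 ∷ 2 ∷ []) (1 ∷ []) 1 ∷ row (2 ∷ 2 ∷ 2 ∷ []) (3 ∷ []) 1 ∷
   row (1 ∷ 1 ∷ 2 ∷ []) (1 ∷ []) 1 ∷ row (2 ∷ 2 ∷ 2 ∷ []) (6 ∷ []) 1 ∷ row (1 ∷ 1 ∷ 2 ∷ []) (7 ∷ []) 1 ∷ row (1 ∷ 1 ∷ 2 ∷ []) (6 ∷ []) 1 ∷
   row (1 ∷ 2 ∷ []) (9 ∷ 2 ∷ []) 2 ∷ row (1 ∷ 1 ∷ 2 ∷ []) (6 ∷ []) 1 ∷ row (1 ∷ 2 ∷ 2 ∷ []) (2 ∷ 2 ∷ []) 2 ∷ row (2 ∷ 2 ∷ 2 ∷ []) (5 ∷ 1 ∷ []) 2 ∷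
   row (2 ∷ 1 ∷ 2 ∷ []) (0 ∷ []) 1 ∷ row (2 ∷ 2 ∷ []) (7 ∷ 2 ∷ []) 2 ∷ row (2 ∷ 1 ∷ 2 ∷ []) (4 ∷ []) 1 ∷ row (2 ∷ 2 ∷ 2 ∷ []) (1 ∷ []) 1 ∷
   row (1 ∷ 2 ∷ []) (4 ∷ 1 ∷ []) 2 ∷ row (2 ∷ 2 ∷ 2 ∷ []) (1 ∷ []) 1 ∷ row (2 ∷ 2 ∷ 2 ∷ []) (6 ∷ 1 ∷ []) 2 ∷ row (2 ∷ 1 ∷ 2 ∷ []) (0 ∷ []) 1 ∷
   row (2 ∷ 2 ∷ []) (3 ∷ 1 ∷ []) 2 ∷ row (2 ∷ 1 ∷ 2 ∷ []) (6 ∷ 1 ∷ []) 2 ∷ row (1 ∷ 1 ∷ 2 ∷ []) (5 ∷ []) 1 ∷ row (2 ∷ 2 ∷ 2 ∷ []) (2 ∷ 2 ∷ []) 2 ∷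
   row (1 ∷ 1 ∷ 2 ∷ []) (3 ∷ 1 ∷ []) 2 ∷ row (1 ∷ 1 ∷ 2 ∷ []) (5 ∷ []) 1 ∷ row (2 ∷ 2 ∷ []) (2 ∷ 2 ∷ []) 2 ∷ row (1 ∷ 2 ∷ []) (3 ∷ 1 ∷ []) 2 ∷ []

 finalQ : List ℕ
 finalQ = 1 ∷ 4 ∷ 5 ∷ 3 ∷ 5 ∷ 5 ∷ []

 -- Two consecutive claws of a flower snark: edges 9 to 11 and 12 to 14 form the claws, edges 6 to 8
 -- join leaf to leaf, and strand k runs from port k to port 3 + k.
 labelsY : List (List ℕ)
 labelsY =
   (5 ∷ 8 ∷ 14 ∷ []) ∷ (12 ∷ 13 ∷ 14 ∷ []) ∷ (2 ∷ 8 ∷ 11 ∷ []) ∷ (3 ∷ 6 ∷ 12 ∷ []) ∷ (0 ∷ 6 ∷ 9 ∷ []) ∷ (9 ∷ 10 ∷ 11 ∷ []) ∷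
   (4 ∷ 7 ∷ 13 ∷ []) ∷ (1 ∷ 7 ∷ 10 ∷ []) ∷ []

 sweepY : List Row
 sweepY =
   row (2 ∷ 2 ∷ 2 ∷ []) ([]) 0 ∷ row (1 ∷ 1 ∷ 2 ∷ []) (2 ∷ []) 1 ∷ row (2 ∷ 1 ∷ 2 ∷ []) (3 ∷ []) 1 ∷ row (1 ∷ 1 ∷ 2 ∷ []) (2 ∷ []) 1 ∷
   row (2 ∷ 1 ∷ 2 ∷ []) (1 ∷ []) 1 ∷ row (1 ∷ 2 ∷ 2 ∷ []) (4 ∷ 2 ∷ []) 2 ∷ row (1 ∷ 1 ∷ 2 ∷ []) (4 ∷ []) 1 ∷ row (2 ∷ 2 ∷ []) (2 ∷ 2 ∷ []) 2 ∷ []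

 finalY : List ℕ
 finalY = 5 ∷ 2 ∷ 4 ∷ 5 ∷ 4 ∷ 5 ∷ []
 -- The fifteen slots lie in a ring, five in each of the thirds 0 to 13, 14 to 27 and 28 to 41, with
 -- the connectors 0, 14, 28 between the thirds. The vertices 42, 43, 44 each meet a connector, an
 -- end of a zigzag and a head strand of the chain.
 kinds : List Kind
 kinds = vert ∷ slot ∷ vert ∷ slot ∷ vert ∷ vert ∷ slot ∷ vert ∷ vert ∷ slot ∷ vert ∷ vert ∷ slot ∷ vert ∷ vert ∷ slot ∷ vert ∷ slot ∷ vert ∷ vert ∷ slot ∷ vert ∷ vert ∷ slot ∷ vert ∷ vert ∷ slot ∷ vert ∷ vert ∷ slot ∷ vert ∷ slot ∷ vert ∷ vert ∷ slot ∷ vert ∷ vert ∷ slot ∷ vert ∷ vert ∷ slot ∷ vert ∷ vert ∷ vert ∷ vert ∷ []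

 names : List (List ℕ)
 names =
   (0 ∷ 1 ∷ 2 ∷ []) ∷ (2 ∷ 3 ∷ 4 ∷ 5 ∷ 6 ∷ 7 ∷ []) ∷ (5 ∷ 8 ∷ 9 ∷ []) ∷ (8 ∷ 6 ∷ 7 ∷ 10 ∷ 11 ∷ 12 ∷ []) ∷
   (9 ∷ 13 ∷ 14 ∷ []) ∷ (11 ∷ 15 ∷ 16 ∷ []) ∷ (10 ∷ 15 ∷ 12 ∷ 17 ∷ 18 ∷ 19 ∷ []) ∷ (16 ∷ 92 ∷ 20 ∷ []) ∷
   (19 ∷ 21 ∷ 22 ∷ []) ∷ (17 ∷ 18 ∷ 21 ∷ 23 ∷ 24 ∷ 25 ∷ []) ∷ (22 ∷ 14 ∷ 26 ∷ []) ∷ (23 ∷ 27 ∷ 28 ∷ []) ∷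
   (27 ∷ 24 ∷ 25 ∷ 29 ∷ 30 ∷ 31 ∷ []) ∷ (28 ∷ 20 ∷ 13 ∷ []) ∷ (29 ∷ 32 ∷ 33 ∷ []) ∷ (33 ∷ 30 ∷ 31 ∷ 34 ∷ 35 ∷ 36 ∷ []) ∷
   (34 ∷ 37 ∷ 38 ∷ []) ∷ (37 ∷ 35 ∷ 36 ∷ 39 ∷ 40 ∷ 41 ∷ []) ∷ (38 ∷ 42 ∷ 43 ∷ []) ∷ (40 ∷ 44 ∷ 45 ∷ []) ∷
   (39 ∷ 44 ∷ 41 ∷ 46 ∷ 47 ∷ 48 ∷ []) ∷ (45 ∷ 90 ∷ 49 ∷ []) ∷ (48 ∷ 50 ∷ 51 ∷ []) ∷ (46 ∷ 47 ∷ 50 ∷ 52 ∷ 53 ∷ 54 ∷ []) ∷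
   (51 ∷ 43 ∷ 55 ∷ []) ∷ (52 ∷ 56 ∷ 57 ∷ []) ∷ (56 ∷ 53 ∷ 54 ∷ 58 ∷ 59 ∷ 60 ∷ []) ∷ (57 ∷ 49 ∷ 42 ∷ []) ∷
   (58 ∷ 61 ∷ 62 ∷ []) ∷ (62 ∷ 59 ∷ 60 ∷ 63 ∷ 64 ∷ 65 ∷ []) ∷ (63 ∷ 66 ∷ 67 ∷ []) ∷ (66 ∷ 64 ∷ 65 ∷ 68 ∷ 69 ∷ 70 ∷ []) ∷
   (67 ∷ 71 ∷ 72 ∷ []) ∷ (69 ∷ 73 ∷ 74 ∷ []) ∷ (68 ∷ 73 ∷ 70 ∷ 75 ∷ 76 ∷ 77 ∷ []) ∷ (74 ∷ 91 ∷ 78 ∷ []) ∷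
   (77 ∷ 79 ∷ 80 ∷ []) ∷ (75 ∷ 76 ∷ 79 ∷ 81 ∷ 82 ∷ 83 ∷ []) ∷ (80 ∷ 72 ∷ 84 ∷ []) ∷ (81 ∷ 85 ∷ 86 ∷ []) ∷
   (85 ∷ 82 ∷ 83 ∷ 1 ∷ 3 ∷ 4 ∷ []) ∷ (86 ∷ 78 ∷ 71 ∷ []) ∷ (0 ∷ 55 ∷ 88 ∷ []) ∷ (32 ∷ 84 ∷ 87 ∷ []) ∷
   (61 ∷ 26 ∷ 89 ∷ []) ∷ []

 mates : List (List Mate)
 mates =
   (to 42 0 ∷ to 40 3 ∷ to 1 0 ∷ []) ∷
   (to 0 2 ∷ to 40 4 ∷ to 40 5 ∷ to 2 0 ∷ to 3 1 ∷ to 3 2 ∷ []) ∷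
   (to 1 3 ∷ to 3 0 ∷ to 4 0 ∷ []) ∷
   (to 2 1 ∷ to 1 4 ∷ to 1 5 ∷ to 6 0 ∷ to 5 0 ∷ to 6 2 ∷ []) ∷
   (to 2 2 ∷ to 13 2 ∷ to 10 1 ∷ []) ∷
   (to 3 4 ∷ to 6 1 ∷ to 7 0 ∷ []) ∷
   (to 3 3 ∷ to 5 1 ∷ to 3 5 ∷ to 9 0 ∷ to 9 1 ∷ to 8 0 ∷ []) ∷
   (to 5 2 ∷ tail 2 ∷ to 13 1 ∷ []) ∷
   (to 6 5 ∷ to 9 2 ∷ to 10 0 ∷ []) ∷
   (to 6 3 ∷ to 6 4 ∷ to 8 1 ∷ to 11 0 ∷ to 12 1 ∷ to 12 2 ∷ []) ∷
   (to 8 2 ∷ to 4 2 ∷ to 44 1 ∷ []) ∷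
   (to 9 3 ∷ to 12 0 ∷ to 13 0 ∷ []) ∷
   (to 11 1 ∷ to 9 4 ∷ to 9 5 ∷ to 14 0 ∷ to 15 1 ∷ to 15 2 ∷ []) ∷
   (to 11 2 ∷ to 7 2 ∷ to 4 1 ∷ []) ∷
   (to 12 3 ∷ to 43 0 ∷ to 15 0 ∷ []) ∷
   (to 14 2 ∷ to 12 4 ∷ to 12 5 ∷ to 16 0 ∷ to 17 1 ∷ to 17 2 ∷ []) ∷
   (to 15 3 ∷ to 17 0 ∷ to 18 0 ∷ []) ∷
   (to 16 1 ∷ to 15 4 ∷ to 15 5 ∷ to 20 0 ∷ to 19 0 ∷ to 20 2 ∷ []) ∷
   (to 16 2 ∷ to 27 2 ∷ to 24 1 ∷ []) ∷
   (to 17 4 ∷ to 20 1 ∷ to 21 0 ∷ []) ∷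
   (to 17 3 ∷ to 19 1 ∷ to 17 5 ∷ to 23 0 ∷ to 23 1 ∷ to 22 0 ∷ []) ∷
   (to 19 2 ∷ tail 0 ∷ to 27 1 ∷ []) ∷
   (to 20 5 ∷ to 23 2 ∷ to 24 0 ∷ []) ∷
   (to 20 3 ∷ to 20 4 ∷ to 22 1 ∷ to 25 0 ∷ to 26 1 ∷ to 26 2 ∷ []) ∷
   (to 22 2 ∷ to 18 2 ∷ to 42 1 ∷ []) ∷
   (to 23 3 ∷ to 26 0 ∷ to 27 0 ∷ []) ∷
   (to 25 1 ∷ to 23 4 ∷ to 23 5 ∷ to 28 0 ∷ to 29 1 ∷ to 29 2 ∷ []) ∷
   (to 25 2 ∷ to 21 2 ∷ to 18 1 ∷ []) ∷
   (to 26 3 ∷ to 44 0 ∷ to 29 0 ∷ []) ∷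
   (to 28 2 ∷ to 26 4 ∷ to 26 5 ∷ to 30 0 ∷ to 31 1 ∷ to 31 2 ∷ []) ∷
   (to 29 3 ∷ to 31 0 ∷ to 32 0 ∷ []) ∷
   (to 30 1 ∷ to 29 4 ∷ to 29 5 ∷ to 34 0 ∷ to 33 0 ∷ to 34 2 ∷ []) ∷
   (to 30 2 ∷ to 41 2 ∷ to 38 1 ∷ []) ∷
   (to 31 4 ∷ to 34 1 ∷ to 35 0 ∷ []) ∷
   (to 31 3 ∷ to 33 1 ∷ to 31 5 ∷ to 37 0 ∷ to 37 1 ∷ to 36 0 ∷ []) ∷
   (to 33 2 ∷ tail 1 ∷ to 41 1 ∷ []) ∷
   (to 34 5 ∷ to 37 2 ∷ to 38 0 ∷ []) ∷
   (to 34 3 ∷ to 34 4 ∷ to 36 1 ∷ to 39 0 ∷ to 40 1 ∷ to 40 2 ∷ []) ∷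
   (to 36 2 ∷ to 32 2 ∷ to 43 1 ∷ []) ∷
   (to 37 3 ∷ to 40 0 ∷ to 41 0 ∷ []) ∷
   (to 39 1 ∷ to 37 4 ∷ to 37 5 ∷ to 0 1 ∷ to 1 1 ∷ to 1 2 ∷ []) ∷
   (to 39 2 ∷ to 35 2 ∷ to 32 1 ∷ []) ∷
   (to 0 0 ∷ to 24 2 ∷ head 1 ∷ []) ∷
   (to 14 1 ∷ to 38 2 ∷ head 0 ∷ []) ∷
   (to 28 1 ∷ to 10 2 ∷ head 2 ∷ []) ∷ []

 sweepK : List Row
 sweepK =
   row ([]) ([]) 0 ∷ row ([]) (2 ∷ []) 1 ∷ row ([]) (2 ∷ []) 1 ∷ row ([]) (5 ∷ 5 ∷ 2 ∷ []) 3 ∷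
   row ([]) (3 ∷ []) 1 ∷ row ([]) (3 ∷ []) 1 ∷ row ([]) (5 ∷ 1 ∷ 5 ∷ []) 3 ∷ row ([]) (3 ∷ []) 1 ∷
   row ([]) (4 ∷ []) 1 ∷ row ([]) (0 ∷ 5 ∷ 5 ∷ []) 3 ∷ row ([]) (7 ∷ 4 ∷ []) 2 ∷ row ([]) (1 ∷ []) 1 ∷
   row ([]) (4 ∷ 4 ∷ 2 ∷ []) 3 ∷ row ([]) (7 ∷ 7 ∷ 5 ∷ []) 3 ∷ row ([]) (0 ∷ []) 1 ∷ row ([]) (3 ∷ 3 ∷ 3 ∷ []) 3 ∷
   row ([]) (0 ∷ []) 1 ∷ row ([]) (3 ∷ 3 ∷ 2 ∷ []) 3 ∷ row ([]) (3 ∷ []) 1 ∷ row ([]) (3 ∷ []) 1 ∷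
   row ([]) (5 ∷ 1 ∷ 5 ∷ []) 3 ∷ row ([]) (3 ∷ []) 1 ∷ row ([]) (4 ∷ []) 1 ∷ row ([]) (0 ∷ 5 ∷ 5 ∷ []) 3 ∷
   row ([]) (7 ∷ 4 ∷ []) 2 ∷ row ([]) (1 ∷ []) 1 ∷ row ([]) (4 ∷ 4 ∷ 2 ∷ []) 3 ∷ row ([]) (7 ∷ 7 ∷ 5 ∷ []) 3 ∷
   row ([]) (0 ∷ []) 1 ∷ row ([]) (3 ∷ 3 ∷ 3 ∷ []) 3 ∷ row ([]) (0 ∷ []) 1 ∷ row ([]) (3 ∷ 3 ∷ 2 ∷ []) 3 ∷
   row ([]) (3 ∷ []) 1 ∷ row ([]) (3 ∷ []) 1 ∷ row ([]) (5 ∷ 1 ∷ 5 ∷ []) 3 ∷ row ([]) (3 ∷ []) 1 ∷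
   row ([]) (4 ∷ []) 1 ∷ row ([]) (0 ∷ 5 ∷ 5 ∷ []) 3 ∷ row ([]) (7 ∷ 4 ∷ []) 2 ∷ row ([]) (1 ∷ []) 1 ∷
   row ([]) (15 ∷ 15 ∷ 17 ∷ 7 ∷ 7 ∷ 5 ∷ []) 6 ∷ row ([]) (4 ∷ 4 ∷ 2 ∷ []) 3 ∷ row ([]) (3 ∷ 8 ∷ []) 2 ∷ row ([]) (1 ∷ 5 ∷ []) 2 ∷
   row ([]) (5 ∷ 4 ∷ []) 2 ∷ []

 finalK : List ℕ
 finalK = 5 ∷ 4 ∷ 5 ∷ 3 ∷ 5 ∷ 5 ∷ []

 netV : Net first3
 netV = Build.build 0 ((0 ∷ 1 ∷ 2 ∷ []) ∷ []) first3 refl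

 netP netQ netY : Net all6
 netP = Build.build 17 labelsP all6 refl
 netQ = Build.build 27 labelsQ all6 refl
 netY = Build.build 7 labelsY all6 refl

 netK : (k : Kind) → Bool → Net (realK k)
 netK vert _ = netV
 netK slot true = netQ
 netK slot false = netP

 module Sum where
   ↑-sum : ∀ a {b} (f : Fin (a + b) → ℕ) → sumFin f ≡ sumFin (λ i → f (i ↑ˡ b)) + sumFin (λ i → f (a ↑ʳ i))
   ↑-sum zero f = refl
   ↑-sum (suc a) f = trans (cong (f zero +_) (↑-sum a (f ∘ suc))) (sym (+-assoc (f zero) _ _))

   Dep : ∀ {k} → (Fin k → ℕ) → Set
   Dep {k} f = Σ (Fin k) (Fin ∘ f)

   enc : ∀ {k} (f : Fin k → ℕ) → Dep f → Fin (sumFin f)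
   enc f (zero , v) = v ↑ˡ _
   enc f (suc i , v) = f zero ↑ʳ enc (f ∘ suc) (i , v)

   push : ∀ {k} {f : Fin (suc k) → ℕ} → Dep (f ∘ suc) → Dep f
   push (i , v) = suc i , v

   dec : ∀ {k} (f : Fin k → ℕ) → Fin (sumFin f) → Dep f
   dec {suc k} f x with splitAt (f zero) x
   ... | inj₁ v = zero , v
   ... | inj₂ y = push {f = f} (dec (f ∘ suc) y)

   dec-enc : ∀ {k} (f : Fin k → ℕ) d → dec f (enc f d) ≡ d
   dec-enc f (zero , v) rewrite splitAt-↑ˡ (f zero) v (sumFin (f ∘ suc)) = refl
   dec-enc f (suc i , v) rewrite splitAt-↑ʳ (f zero) (sumFin (f ∘ suc)) (enc (f ∘ suc) (i , v)) = cong (push {f = f}) (dec-enc (f ∘ suc) (i , v))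

   enc-dec : ∀ {k} (f : Fin k → ℕ) x → enc f (dec f x) ≡ x
   enc-dec {suc k} f x with splitAt (f zero) x in e
   ... | inj₁ v = splitAt⁻¹-↑ˡ e
   ... | inj₂ y = trans (cong (f zero ↑ʳ_) (enc-dec (f ∘ suc) y)) (splitAt⁻¹-↑ʳ e)

   dep-sum : ∀ {k} (f : Fin k → ℕ) (g : Fin (sumFin f) → ℕ) → sumFin g ≡ sumFin λ i → sumFin λ v → g (enc f (i , v))
   dep-sum {zero} f g = refl
   dep-sum {suc k} f g = trans (↑-sum (f zero) g) (cong (sumFin (λ v → g (v ↑ˡ sumFin (f ∘ suc))) +_) (dep-sum (f ∘ suc) λ x → g (f zero ↑ʳ x)))

 -- Partners are written without the length of the chain, so that one evaluation shows their
 -- symmetry for all m.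
 data Code : Set where
   fixed : Fin 45 → Fin 6 → Code
   first last : Fin 3 → Code

 mateCode : Fin 45 → Fin 6 → Code
 mateCode i p with nth (to 0 0) (nth [] mates (toℕ i)) (toℕ p)
 ... | to j q = fixed (j mod 45) (q mod 6)
 ... | head k = first (k mod 3)
 ... | tail k = last (k mod 3)

 kindOf : Fin 45 → Kind
 kindOf i = nth vert kinds (toℕ i)

 -- The ports of the fixed part at the two ends of the chain of double Y blocks.
 headPort tailPort : Fin 3 → Fin 45 × Fin 6
 headPort k = nth (0 mod 45 , 0 mod 6) ((43 mod 45 , 2 mod 6) ∷ (42 mod 45 , 2 mod 6) ∷ (44 mod 45 , 2 mod 6) ∷ []) (toℕ k)
 tailPort k = nth (0 mod 45 , 0 mod 6) ((21 mod 45 , 1 mod 6) ∷ (35 mod 45 , 1 mod 6) ∷ (7 mod 45 , 1 mod 6) ∷ []) (toℕ k)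

 realF : Fin 45 → Fin 6 → Bool
 realF i = realK (kindOf i)

 eqCode : Code → Code → Bool
 eqCode (fixed i p) (fixed j q) = eqFin i j & eqFin p q
 eqCode (first k) (first l) = eqFin k l
 eqCode (last k) (last l) = eqFin k l
 eqCode _ _ = false

 eqCode-sound : ∀ x y → eqCode x y ≡ true → x ≡ y
 eqCode-sound (fixed i p) (fixed j q) e = cong₂ fixed (eqFin-sound i j (&-fst e)) (eqFin-sound p q (&-snd {eqFin i j} e))
 eqCode-sound (first k) (first l) e = cong first (eqFin-sound k l e)
 eqCode-sound (last k) (last l) e = cong last (eqFin-sound k l e)

 okMate : Fin 45 → Fin 6 → Code → Bool
 okMate i p (fixed j q) = eqCode (mateCode j q) (fixed i p) & realF j q
 okMate i p (first k) = eqFin (proj₁ (headPort k)) i & eqFin (proj₂ (headPort k)) p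
 okMate i p (last k) = eqFin (proj₁ (tailPort k)) i & eqFin (proj₂ (tailPort k)) p

 okFixed : Fin 45 → Fin 6 → Bool
 okFixed i p = if realF i p then okMate i p (mateCode i p) else true

 okEnd : Fin 3 → Bool
 okEnd k = (eqCode (mateCode (proj₁ (headPort k)) (proj₂ (headPort k))) (first k) & realF (proj₁ (headPort k)) (proj₂ (headPort k)))
         & (eqCode (mateCode (proj₁ (tailPort k)) (proj₂ (tailPort k))) (last k) & realF (proj₁ (tailPort k)) (proj₂ (tailPort k)))

 okMates : (allFin? 45 (λ i → allFin? 6 (okFixed i)) & allFin? 3 okEnd) ≡ true
 okMates = refl

 lo hi : Fin 3 → Fin 6
 lo k = k ↑ˡ 3
 hi k = 3 ↑ʳ k

 module Chain (m : ℕ) (b : Fin 45 → Bool) where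

   Blk : Set
   Blk = Fin 45 ⊎ Fin (suc m)

   Port : Set
   Port = Blk × Fin 6

   real : Blk → Fin 6 → Bool
   real (inj₁ i) = realF i
   real (inj₂ _) = all6

   net : (x : Blk) → Net (real x)
   net (inj₁ i) = netK (kindOf i) (b i)
   net (inj₂ _) = netY

   decode : Code → Port
   decode (fixed i p) = inj₁ i , p
   decode (first k) = inj₂ zero , lo k
   decode (last k) = inj₂ (fromℕ m) , hi k

   before after : Fin (suc m) → Fin 3 → Port
   before zero k = inj₁ (proj₁ (headPort k)) , proj₂ (headPort k)
   before (suc j) k = inj₂ (inject₁ j) , hi k
   after j k with view j
   ... | ‵fromℕ = inj₁ (proj₁ (tailPort k)) , proj₂ (tailPort k)
   ... | ‵inject₁ i = inj₂ (suc i) , lo k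

   mate : Port → Port
   mate (inj₁ i , p) = decode (mateCode i p)
   mate (inj₂ j , p) with splitAt 3 p
   ... | inj₁ k = before j k
   ... | inj₂ k = after j k

   mate-lo : ∀ j k → mate (inj₂ j , lo k) ≡ before j k
   mate-lo j k rewrite splitAt-↑ˡ 3 k 3 = refl

   mate-hi : ∀ j k → mate (inj₂ j , hi k) ≡ after j k
   mate-hi j k rewrite splitAt-↑ʳ 3 3 k = refl

   after-last : ∀ k → after (fromℕ m) k ≡ (inj₁ (proj₁ (tailPort k)) , proj₂ (tailPort k))
   after-last k rewrite view-fromℕ m = refl

   after-inject : ∀ j k → after (inject₁ j) k ≡ (inj₂ (suc j) , lo k)
   after-inject j k rewrite view-inject₁ j = refl

   Back : Port → Port → Set
   Back x y = mate y ≡ x × real (proj₁ y) (proj₂ y) ≡ true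

   end-ok : ∀ k → okEnd k ≡ true
   end-ok = allFin-sound 3 okEnd (&-snd {allFin? 45 (λ i → allFin? 6 (okFixed i))} okMates)

   when : ∀ {b x} → b ≡ true → (if b then x else true) ≡ true → x ≡ true
   when refl e = e

   mate-back : ∀ x p → real x p ≡ true → Back (x , p) (mate (x , p))
   mate-back (inj₁ i) p r = go (mateCode i p) (when r (allFin-sound 6 (okFixed i) (allFin-sound 45 (λ i → allFin? 6 (okFixed i)) (&-fst okMates) i) p))
     where
     go : ∀ c → okMate i p c ≡ true → Back (inj₁ i , p) (decode c)
     go (fixed j q) e = cong decode (eqCode-sound _ _ (&-fst e)) , &-snd {eqCode (mateCode j q) (fixed i p)} e
     go (first k) e = trans (mate-lo zero k) (cong₂ (λ i p → inj₁ i , p) (eqFin-sound _ _ (&-fst e))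
       (eqFin-sound _ _ (&-snd {eqFin (proj₁ (headPort k)) i} e))) , refl
     go (last k) e = trans (mate-hi (fromℕ m) k) (trans (after-last k) (cong₂ (λ i p → inj₁ i , p) (eqFin-sound _ _ (&-fst e))
       (eqFin-sound _ _ (&-snd {eqFin (proj₁ (tailPort k)) i} e)))) , refl
   mate-back (inj₂ j) p _ with splitAt 3 p in e
   mate-back (inj₂ zero) p _ | inj₁ k = trans (cong decode (eqCode-sound _ (first k) (&-fst h))) (cong (inj₂ zero ,_) (splitAt⁻¹-↑ˡ e)) , &-snd {eqCode (mateCode (proj₁ (headPort k)) (proj₂ (headPort k))) (first k)} h
     where h = &-fst (end-ok k)
   mate-back (inj₂ (suc j)) p _ | inj₁ k = trans (mate-hi (inject₁ j) k) (trans (after-inject j k) (cong (inj₂ (suc j) ,_) (splitAt⁻¹-↑ˡ e))) , refl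
   mate-back (inj₂ j) p _ | inj₂ k with view j
   ... | ‵fromℕ = trans (cong decode (eqCode-sound _ (last k) (&-fst h))) (cong (inj₂ (fromℕ m) ,_) (splitAt⁻¹-↑ʳ e)) , &-snd {eqCode (mateCode (proj₁ (tailPort k)) (proj₂ (tailPort k))) (last k)} h
     where h = &-snd {eqCode (mateCode (proj₁ (headPort k)) (proj₂ (headPort k))) (first k) & realF (proj₁ (headPort k)) (proj₂ (headPort k))} (end-ok k)
   ... | ‵inject₁ i = trans (mate-lo (suc i) k) (cong (inj₂ (inject₁ i) ,_) (splitAt⁻¹-↑ʳ e)) , refl

   module N (x : Blk) = Net (net x)

   V : Set
   V = Σ Blk λ x → Fin (N.size x)

   H : Set
   H = V × Fin 3

   vertexOf : Port → H
   vertexOf (x , p) = (x , proj₁ (N.port x p)) , proj₂ (N.port x p)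

   cross : (x : Blk) → (Fin (N.size x) × Fin 3) ⊎ Fin 6 → H
   cross x (inj₁ (v , a)) = (x , v) , a
   cross x (inj₂ p) = vertexOf (mate (x , p))

   opp : H → H
   opp ((x , v) , a) = cross x (N.link x v a)

   opp-port : ∀ x p → real x p ≡ true → opp (vertexOf (x , p)) ≡ vertexOf (mate (x , p))
   opp-port x p r = cong (cross x) (N.port-link x p r)

   opp-inv : ∀ h → opp (opp h) ≡ h
   opp-inv ((x , v) , a) with N.link x v a in e
   ... | inj₁ (w , b) = cong (cross x) (N.link-inner x v a w b e)
   ... | inj₂ p = trans (opp-port (proj₁ y) (proj₂ y) (proj₂ back)) (trans (cong vertexOf (proj₁ back))
         (cong (λ h → (x , proj₁ h) , proj₂ h) (proj₁ (N.link-port x v a p e))))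
     where
     y = mate (x , p)
     back = mate-back x p (proj₁ (proj₂ (N.link-port x v a p e)))

   open Sum

   sizeF : Fin 45 → ℕ
   sizeF i = N.size (inj₁ i)

   sizeY : Fin (suc m) → ℕ
   sizeY _ = 8

   order : ℕ
   order = sumFin sizeF + sumFin sizeY

   fromV : V → Fin order
   fromV (inj₁ i , v) = enc sizeF (i , v) ↑ˡ sumFin sizeY
   fromV (inj₂ j , v) = sumFin sizeF ↑ʳ enc sizeY (j , v)

   injF : Dep sizeF → V
   injF (i , v) = inj₁ i , v

   injY : Dep sizeY → V
   injY (j , v) = inj₂ j , v

   toV : Fin order → V
   toV x with splitAt (sumFin sizeF) x
   ... | inj₁ y = injF (dec sizeF y)
   ... | inj₂ y = injY (dec sizeY y)

   toV-fromV : ∀ v → toV (fromV v) ≡ v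
   toV-fromV (inj₁ i , v) rewrite splitAt-↑ˡ (sumFin sizeF) (enc sizeF (i , v)) (sumFin sizeY) = cong injF (dec-enc sizeF (i , v))
   toV-fromV (inj₂ j , v) rewrite splitAt-↑ʳ (sumFin sizeF) (sumFin sizeY) (enc sizeY (j , v)) = cong injY (dec-enc sizeY (j , v))

   fromV-toV : ∀ x → fromV (toV x) ≡ x
   fromV-toV x with splitAt (sumFin sizeF) x in e
   ... | inj₁ y = trans (cong (_↑ˡ sumFin sizeY) (enc-dec sizeF y)) (splitAt⁻¹-↑ˡ e)
   ... | inj₂ y = trans (cong (sumFin sizeF ↑ʳ_) (enc-dec sizeY y)) (splitAt⁻¹-↑ʳ e)

   sum-V : ∀ (g : Fin order → ℕ) → sumFin g ≡ sumFin (λ i → sumFin λ v → g (fromV (inj₁ i , v))) + sumFin (λ j → sumFin λ v → g (fromV (inj₂ j , v)))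
   sum-V g = trans (↑-sum (sumFin sizeF) g) (cong₂ _+_ (dep-sum sizeF λ y → g (y ↑ˡ sumFin sizeY)) (dep-sum sizeY λ y → g (sumFin sizeF ↑ʳ y)))

module CutTable where
 open import Defs
 open Gluing
 open HalfEdgeGraphs
 open Network
 open import Data.Nat using (ℕ; zero; suc; _+_; _≤_; z≤n; _<ᵇ_; _≡ᵇ_)
 open import Data.Nat.Properties using (≤-refl; ≤-reflexive; +-identityʳ)
 open import Data.Bool using (Bool; true; false; not; T; if_then_else_)
 open import Data.Fin using (Fin; zero; suc; toℕ)
 open import Data.List using (List; []; _∷_; _++_; map; tabulate)
 open import Data.List.Relation.Unary.Any as Any using (here; there)
 open import Data.List.Relation.Unary.All using ([]; _∷_)
 open import Data.Product using (_×_; _,_; proj₁; proj₂)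
 open import Data.Sum using (_⊎_; inj₁; inj₂)
 open import Relation.Binary.PropositionalEquality

 -- Tables of cut states for the blocks and for the fixed part.

 eqB : Bool → Bool → Bool
 eqB true b = b
 eqB false b = not b

 eqB-sound : ∀ a b → eqB a b ≡ true → a ≡ b
 eqB-sound true true e = refl
 eqB-sound false false e = refl

 diffB : Bool → Bool → ℕ
 diffB a b = if eqB a b then 0 else 1

 noRow : Row
 noRow = row [] [] 0

 sixPorts : List (Fin 6)
 sixPorts = tabulate λ p → p

 -- The sweep over the vertices of a block runs twice, with sides of a cut and with colours as
 -- labels; only the table of a single vertex changes.
 module Local {A : Set} (eq : A → A → Bool) (eq-sound : ∀ a b → eq a b ≡ true → a ≡ b) (diff : A → A → ℕ)
              (vt : List (Engine.St eq eq-sound diff)) {real : Fin 6 → Bool} (N : Net real) (rows : List Row) where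
   open Engine eq eq-sound diff
   open Net N
   Slot : Set
   Slot = Fin size × Fin 3

   eqSlot : Slot → Slot → Bool
   eqSlot (v , a) (w , b) = eqFin v w & eqFin a b

   eqSlot-sound : ∀ h k → eqSlot h k ≡ true → h ≡ k
   eqSlot-sound (v , a) (w , b) e = cong₂ _,_ (eqFin-sound v w (&-fst e)) (eqFin-sound a b (&-snd {eqFin v w} e))

   joined : Slot ⊎ Fin 6 → Slot → Bool
   joined (inj₁ h) k = eqSlot h k
   joined (inj₂ _) k = false

   joined-sound : ∀ x k → joined x k ≡ true → x ≡ inj₁ k
   joined-sound (inj₁ h) k e = cong inj₁ (eqSlot-sound h k e)

   linked : Slot → Slot → Bool
   linked (v , a) k = joined (link v a) k

   open Program {Slot} {Fin size} linked

   corners : Fin size → List Slot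
   corners v = (v , i0) ∷ (v , i1) ∷ (v , i2) ∷ []

   itemV : Fin size → Item
   itemV v = let r = nth noRow rows (toℕ v) in item v (pulls (Row.twist r) (corners v)) (Row.moves r) (Row.glue r) vt

   items : List Item
   items = tabulate itemV

   SweepOk : List ℕ → Set
   SweepOk fm = sane [] items ≡ true × pulls fm (front [] items) ≡ map port sixPorts

   table-of : List ℕ → List St
   table-of fm = reorder fm (exec empty items)

   module _ (strand : Slot → Strand) (cost yes no : Fin size → ℕ)
            (pay : ∀ h k → link (proj₁ h) (proj₂ h) ≡ inj₁ k → diff (proj₁ (strand h)) (proj₁ (strand k)) ≤ proj₂ (strand h) + proj₂ (strand k))
            (corner-good : ∀ v ks → Good vt (pulls ks (map strand (corners v))) (cost v) (yes v) (no v)) where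

     open Sound strand (λ h k e → pay h k (joined-sound _ k e))

     local-good : ∀ fm → SweepOk fm →
       Good (table-of fm) (map strand (map port sixPorts)) (sumFin cost) (sumFin yes) (sumFin no)
     local-good fm (e , p) = run-tabulate cost yes no itemV fm {map port sixPorts} e p fits
       where
       fits : ∀ v → Fits cost yes no (itemV v)
       fits v = subst (λ ls → Good vt ls (cost v) (yes v) (no v)) (sym (map-pulls strand (Row.twist r) _)) (corner-good v (Row.twist r))
         where r = nth noRow rows (toℕ v)

 open Engine eqB eqB-sound diffB

 diffB-≤ : ∀ a b → diffB a b ≤ b2n (a ∧ not b) + b2n (b ∧ not a)
 diffB-≤ true true = z≤n
 diffB-≤ true false = ≤-refl
 diffB-≤ false true = ≤-refl
 diffB-≤ false false = z≤n

 -- The three strands of a vertex lie on its own side and nothing is cut yet; edges are priced when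
 -- they are glued.
 vertexTable : List St
 vertexTable = ((false ∷ false ∷ false ∷ []) ∶ ⟨ 0 , 0 , 1 ⟩) ∷ ((true ∷ true ∷ true ∷ []) ∶ ⟨ 0 , 1 , 0 ⟩) ∷ []

 pull-const : {A : Set} (k : ℕ) (x : A) → pull k (x ∷ x ∷ x ∷ []) ≡ x ∷ x ∷ x ∷ []
 pull-const zero x = refl
 pull-const (suc zero) x = refl
 pull-const (suc (suc zero)) x = refl
 pull-const (suc (suc (suc zero))) x = refl
 pull-const (suc (suc (suc (suc k)))) x = refl

 pulls-const : {A : Set} (ks : List ℕ) (x : A) → pulls ks (x ∷ x ∷ x ∷ []) ≡ x ∷ x ∷ x ∷ []
 pulls-const [] x = refl
 pulls-const (k ∷ ks) x = trans (cong (pulls ks) (pull-const k x)) (pulls-const ks x)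

 vertex-good : ∀ ks b l₀ l₁ l₂ →
   Good vertexTable (pulls ks ((b , l₀) ∷ (b , l₁) ∷ (b , l₂) ∷ [])) (l₀ + (l₁ + l₂)) (b2n b) (b2n (not b))
 vertex-good ks b l₀ l₁ l₂ = inj₂ (0 , ≤-reflexive (trans (flow-pulls ks _) (cong (λ z → l₀ + (l₁ + z)) (+-identityʳ l₂)))
     , subst (λ z → Cover vertexTable z ⟨ 0 , cap (b2n b) , cap (b2n (not b)) ⟩) (sym eqn) (cov b))
   where
   eqn : labels (pulls ks ((b , l₀) ∷ (b , l₁) ∷ (b , l₂) ∷ [])) ≡ b ∷ b ∷ b ∷ []
   eqn = trans (map-pulls proj₁ ks _) (pulls-const ks b)
   cov : ∀ b → Cover vertexTable (b ∷ b ∷ b ∷ []) ⟨ 0 , cap (b2n b) , cap (b2n (not b)) ⟩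
   cov false = here (refl , ≤-refl , ≤-refl , ≤-refl)
   cov true = there (here (refl , ≤-refl , ≤-refl , ≤-refl))

 okP : Local.SweepOk eqB eqB-sound diffB vertexTable netP sweepP finalP
 okP = refl , refl
 okQ : Local.SweepOk eqB eqB-sound diffB vertexTable netQ sweepQ finalQ
 okQ = refl , refl
 okY : Local.SweepOk eqB eqB-sound diffB vertexTable netY sweepY finalY
 okY = refl , refl

 module Fixed where
   FPort : Set
   FPort = Fin 45 × Fin 6

   linkedF : FPort → FPort → Bool
   linkedF (i , p) (j , q) = realF i p & eqCode (mateCode i p) (fixed j q)

   open Program {FPort} {Fin 45} linkedF public

   portsOf : Kind → List (Fin 6)
   portsOf vert = zero ∷ suc zero ∷ suc (suc zero) ∷ []
   portsOf slot = sixPorts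

   tableFor : List St → Kind → List St
   tableFor T vert = vertexTable
   tableFor T slot = T

   itemF : List St → Fin 45 → Item
   itemF T i = let r = nth noRow sweepK (toℕ i) in
     item i (map (i ,_) (portsOf (kindOf i))) (Row.moves r) (Row.glue r) (tableFor T (kindOf i))

   itemsF : List St → List Item
   itemsF T = tabulate (itemF T)

   ends : List FPort
   ends = map headPort (zero ∷ suc zero ∷ suc (suc zero) ∷ []) ++ map tailPort (zero ∷ suc zero ∷ suc (suc zero) ∷ [])

   saneF : ∀ T → sane [] (itemsF T) ≡ true
   saneF T = refl

   endsF : ∀ T → pulls finalK (front [] (itemsF T)) ≡ ends
   endsF T = refl

   -- The states after one block and after two blocks together. `verdict` checks that a further
   -- block leads to nothing new, which settles chains of every length.
   afterFixed afterOne chainInv : List St → List St → List St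
   afterFixed T Y = reorder finalK (exec empty (itemsF T))
   afterOne T Y = join 3 (afterFixed T Y) Y
   chainInv T Y = let X = afterOne T Y in tidy (X ++ join 3 X Y)

   -- The capped size four may stand for any larger one and proves nothing, hence the test `s <ᵇ 4`.
   light : ℕ → ℕ → Bool
   light k s = if s ≡ᵇ 0 then true else (s <ᵇ 4) & (s + 2 <ᵇ suc k)

   harmless : Wt → Bool
   harmless w = if light (cst w) (inn w) then true else light (cst w) (out w)

   allHarmless : List St → Bool
   allHarmless [] = true
   allHarmless (x ∷ xs) = harmless (wt x) & allHarmless xs

   verdict : List St → List St → Bool
   verdict I Y = coversAll I (join 3 I Y) & allHarmless (join 6 I Y)

module CutBound where
 open import Defs
 open Gluing
 open HalfEdgeGraphs
 open Network
 open CutTable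
 open import Data.Nat using (ℕ; zero; suc; _+_; _≤_; _<_; z≤n; s≤s; s≤s⁻¹; _<ᵇ_; _≡ᵇ_)
 open import Data.Nat.Properties using (≡ᵇ⇒≡; ≤-trans; +-identityʳ; +-assoc; +-monoˡ-≤; n≤0⇒n≡0; <⇒≱)
 open import Data.Bool using (Bool; true; false; not; T; if_then_else_)
 open import Data.Fin using (Fin; zero; suc; fromℕ; inject₁)
 open import Data.List using (List; []; _∷_; _++_; map)
 open import Data.List.Properties using (map-∘)
 open import Data.List.Relation.Unary.Any as Any using (here; there)
 open import Data.List.Relation.Unary.All using ([]; _∷_)
 open import Data.Product using (_×_; _,_; proj₁; proj₂)
 open import Data.Sum using (_⊎_; inj₁; inj₂)
 open import Data.Unit using (tt)
 open import Data.Empty using (⊥-elim)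
 open import Function using (_∘_)
 open import Relation.Binary.PropositionalEquality

 -- The bound for every vertex set of the whole network.

 module ChainWalk (m : ℕ) (b : Fin 45 → Bool) where
   open Chain (suc m) b public

   tailP headP : Fin 3 → Port
   tailP k = inj₁ (proj₁ (tailPort k)) , proj₂ (tailPort k)
   headP k = inj₁ (proj₁ (headPort k)) , proj₂ (headPort k)

   Faces : (Fin 3 → Port) → Fin (suc (suc m)) → Set
   Faces f j = ∀ k → real (proj₁ (f k)) (proj₂ (f k)) ≡ true × mate (f k) ≡ (inj₂ j , lo k)

   head-faces : Faces headP zero
   head-faces k = let h = &-fst (end-ok k) in &-snd {eqCode (mateCode (proj₁ (headPort k)) (proj₂ (headPort k))) (first k)} h
     , cong decode (eqCode-sound _ (first k) (&-fst h))

   module Walk {A : Set} (eq : A → A → Bool) (eq-sound : ∀ a b → eq a b ≡ true → a ≡ b) (diff : A → A → ℕ)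
               (strandP : Port → A × ℕ)
               (pay-port : ∀ x y → real (proj₁ x) (proj₂ x) ≡ true → mate x ≡ y → diff (proj₁ (strandP x)) (proj₁ (strandP y)) ≤ proj₂ (strandP x) + proj₂ (strandP y))
               (costY yesY noY : Fin (suc (suc m)) → ℕ) where
     open Engine eq eq-sound diff

     Ygood : List St → Set
     Ygood Y = ∀ j → Good Y (map (λ p → strandP (inj₂ j , p)) sixPorts) (costY j) (yesY j) (noY j)

     three : (Fin 3 → Port) → List Strand
     three f = strandP (f zero) ∷ strandP (f (suc zero)) ∷ strandP (f (suc (suc zero))) ∷ []

     faces-pay : ∀ {f j} → Faces f j → ∀ k →
       diff (proj₁ (strandP (f k))) (proj₁ (strandP (inj₂ j , lo k))) ≤ proj₂ (strandP (f k)) + proj₂ (strandP (inj₂ j , lo k))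
     faces-pay {f} {j} F k = pay-port (f k) (inj₂ j , lo k) (proj₁ (F k)) (proj₂ (F k))

     module Along (Y : List St) (yg : Ygood Y) where
       pass : ∀ {X K s c} f j → Faces f j → Good X (three f ++ three tailP) K s c →
         Good (join 3 X Y) (three (λ k → inj₂ j , hi k) ++ three tailP) (K + costY j) (s + yesY j) (c + noY j)
       pass {X} {K} {s} {c} f j F g = join-good 3 {X} {Y} {three f ++ three tailP} {map (λ p → strandP (inj₂ j , p)) sixPorts} {K} {costY j} {s} {yesY j} {c} {noY j}
         (faces-pay {f} {j} F zero , faces-pay {f} {j} F (suc zero) , faces-pay {f} {j} F (suc (suc zero)) , tt) g (yg j)

       stop : ∀ {X K s c} f j → Faces f j → (∀ k → mate (inj₂ j , hi k) ≡ tailP k) → Good X (three f ++ three tailP) K s c →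
         Good (join 6 X Y) [] (K + costY j) (s + yesY j) (c + noY j)
       stop {X} {K} {s} {c} f j F t g = join-good 6 {X} {Y} {three f ++ three tailP} {map (λ p → strandP (inj₂ j , p)) sixPorts} {K} {costY j} {s} {yesY j} {c} {noY j}
         (faces-pay {f} {j} F zero , faces-pay {f} {j} F (suc zero) , faces-pay {f} {j} F (suc (suc zero)) , back zero , back (suc zero) , back (suc (suc zero)) , tt) g (yg j)
         where
         back : ∀ k → diff (proj₁ (strandP (tailP k))) (proj₁ (strandP (inj₂ j , hi k))) ≤ proj₂ (strandP (tailP k)) + proj₂ (strandP (inj₂ j , hi k))
         back k = let (e , r) = mate-back (inj₂ j) (hi k) refl in
           pay-port (tailP k) (inj₂ j , hi k) (subst (λ z → real (proj₁ z) (proj₂ z) ≡ true) (t k) r) (trans (cong mate (sym (t k))) e)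

       module Closed (I : List St) (closed : ∀ {as w} → Cover (join 3 I Y) as w → Cover I as w) where
         -- The map `e` lists the blocks still to be attached; the induction drops its first value
         -- and keeps the numbering of the whole chain.
         walk : ∀ n (e : Fin (suc n) → Fin (suc (suc m))) →
           (∀ i k → mate (inj₂ (e (inject₁ i)) , hi k) ≡ (inj₂ (e (suc i)) , lo k)) →
           (∀ k → mate (inj₂ (e (fromℕ n)) , hi k) ≡ tailP k) →
           ∀ f {K s c} → Faces f (e zero) → Good I (three f ++ three tailP) K s c →
           Good (join 6 I Y) [] (K + sumFin (costY ∘ e)) (s + sumFin (yesY ∘ e)) (c + sumFin (noY ∘ e))
         walk zero e co st f {K} {s} {c} F g
           rewrite +-identityʳ (costY (e zero)) | +-identityʳ (yesY (e zero)) | +-identityʳ (noY (e zero)) = stop {s = s} {c} f (e zero) F st g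
         walk (suc n) e co st f {K} {s} {c} F g
           rewrite sym (+-assoc K (costY (e zero)) (sumFin (costY ∘ e ∘ suc))) | sym (+-assoc s (yesY (e zero)) (sumFin (yesY ∘ e ∘ suc)))
                 | sym (+-assoc c (noY (e zero)) (sumFin (noY ∘ e ∘ suc))) =
           walk n (e ∘ suc) (co ∘ suc) st (λ k → inj₂ (e zero) , hi k) {K + costY (e zero)} {s + yesY (e zero)} {c + noY (e zero)} (λ k → refl , co zero k)
             (Good-mono {join 3 I Y} {I} {three (λ k → inj₂ (e zero) , hi k) ++ three tailP} {K + costY (e zero)} {s + yesY (e zero)} {c + noY (e zero)} (λ {as} {w} → closed {as} {w}) (pass {I} {K} {s} {c} f (e zero) F g))

     -- The first block is attached separately: the invariant need not hold before it.
     module Ring (X₀ Y : List St) (yg : Ygood Y) {K₀ s₀ c₀ : ℕ} (start : Good X₀ (three headP ++ three tailP) K₀ s₀ c₀) where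
       open Along Y yg
       X₁ I : List St
       X₁ = join 3 X₀ Y
       I = tidy (X₁ ++ join 3 X₁ Y)

       ports₁ : List Strand
       ports₁ = three (λ k → inj₂ zero , hi k) ++ three tailP

       first-good : Good X₁ ports₁ (K₀ + costY zero) (s₀ + yesY zero) (c₀ + noY zero)
       first-good = pass {X₀} {K₀} {s₀} {c₀} headP zero head-faces start

       first-step : Good I ports₁ (K₀ + costY zero) (s₀ + yesY zero) (c₀ + noY zero)
       first-step = tidy-good {X₁ ++ join 3 X₁ Y} {ports₁} {K₀ + costY zero} {s₀ + yesY zero} {c₀ + noY zero}
         (Good-mono {X₁} {X₁ ++ join 3 X₁ Y} {ports₁} {K₀ + costY zero} {s₀ + yesY zero} {c₀ + noY zero}
           (λ {as} {w} → ++-coverˡ {X₁} {join 3 X₁ Y} {as} {w}) first-good)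

       ring : (∀ {as w} → Cover (join 3 I Y) as w → Cover I as w) →
         Good (join 6 I Y) [] (K₀ + sumFin costY) (s₀ + sumFin yesY) (c₀ + sumFin noY)
       ring closed rewrite sym (+-assoc K₀ (costY zero) (sumFin (costY ∘ suc))) | sym (+-assoc s₀ (yesY zero) (sumFin (yesY ∘ suc)))
                     | sym (+-assoc c₀ (noY zero) (sumFin (noY ∘ suc))) =
         Closed.walk I closed m suc (λ i k → trans (mate-hi (suc (inject₁ i)) k) (after-inject (suc i) k)) (λ k → trans (mate-hi (fromℕ (suc m)) k) (after-last k))
           (λ k → inj₂ zero , hi k) {K₀ + costY zero} {s₀ + yesY zero} {c₀ + noY zero}
           (λ k → refl , trans (mate-hi zero k) (after-inject zero k)) first-step

 open Engine eqB eqB-sound diffB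

 -- The stored weight is the worst case, with no more cut edges and no smaller sides, and lightness
 -- passes from it to the true values.
 harmless-bound : ∀ w {k s c} → Fixed.harmless w ≡ true → cst w ≤ k → cap s ≤ inn w → cap c ≤ out w → Bound k s c
 harmless-bound w {k} {s} {c} h p q r = go (either _ _ h)
   where
   open Fixed
   either : ∀ x y → (if x then true else y) ≡ true → x ≡ true ⊎ y ≡ true
   either true y e = inj₁ refl
   either false y e = inj₂ e
   uncap : ∀ s t → t < 4 → cap s ≤ t → s ≤ t
   uncap s t t<4 le with s <ᵇ 4
   ... | true = le
   ... | false = ⊥-elim (<⇒≱ t<4 le)
   light-sound : ∀ s t → light (cst w) t ≡ true → cap s ≤ t → s ≡ 0 ⊎ s + 2 ≤ k
   light-sound s t e le with t ≡ᵇ 0 in z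
   ... | true = inj₁ (n≤0⇒n≡0 (uncap s 0 (s≤s z≤n) (subst (cap s ≤_) (≡ᵇ⇒≡ t 0 (subst T (sym z) tt)) le)))
   ... | false = inj₂ (≤-trans (+-monoˡ-≤ 2 (uncap s t (<ᵇ-true t 4 (&-fst e)) le))
                    (≤-trans (s≤s⁻¹ (<ᵇ-true _ _ (&-snd {t <ᵇ 4} e))) p))
   go : light (cst w) (inn w) ≡ true ⊎ light (cst w) (out w) ≡ true → Bound k s c
   go (inj₁ e) = inj₂ (inj₁ (light-sound s _ e q))
   go (inj₂ e) = inj₂ (inj₂ (light-sound c _ e r))

 allHarmless-bound : ∀ X {K s c} → Fixed.allHarmless X ≡ true → Good X [] K s c → Bound K s c
 allHarmless-bound X {K} h (inj₁ p) = inj₁ p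
 allHarmless-bound X {K} {s} {c} h (inj₂ (k , p , q)) = go X h q
   where
   go : ∀ X → Fixed.allHarmless X ≡ true → Cover X [] ⟨ k , cap s , cap c ⟩ → Bound K s c
   go (x ∷ X) h (here (_ , a , b , d)) = harmless-bound (wt x) (&-fst h) (≤-trans a (subst (_≤ K) (+-identityʳ k) p)) b d
   go (x ∷ X) h (there y) = go X (&-snd {Fixed.harmless (wt x)} h) y

 module CutTables (tableP tableQ tableY : List St) 
   (isP : Local.table-of eqB eqB-sound diffB vertexTable netP sweepP finalP ≡ tableP) 
   (isQ : Local.table-of eqB eqB-sound diffB vertexTable netQ sweepQ finalQ ≡ tableQ) 
   (isY : Local.table-of eqB eqB-sound diffB vertexTable netY sweepY finalY ≡ tableY) where

  -- Every slot receives the union of the tables of both fillings, so a single evaluation of the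
  -- ring covers all choices of `b`.
  tableS : List St
  tableS = tidy (tableP ++ tableQ)

  kind-good : ∀ k β (S : Fin (Net.size (netK k β)) → Bool) (d : Fin (Net.size (netK k β)) → Fin 3 → ℕ) →
    (∀ h k' → Net.link (netK k β) (proj₁ h) (proj₂ h) ≡ inj₁ k' → diffB (S (proj₁ h)) (S (proj₁ k')) ≤ d (proj₁ h) (proj₂ h) + d (proj₁ k') (proj₂ k')) →
    Good (Fixed.tableFor tableS k)
      (map (λ p → let h = Net.port (netK k β) p in S (proj₁ h) , d (proj₁ h) (proj₂ h)) (Fixed.portsOf k))
      (sumFin λ v → d v i0 + (d v i1 + d v i2)) (sumFin (b2n ∘ S)) (sumFin (b2n ∘ not ∘ S))
  kind-good vert β S d pay =
    subst₂ (Good vertexTable ls (sumFin λ v → d v i0 + (d v i1 + d v i2))) (sym (+-identityʳ (b2n (S zero)))) (sym (+-identityʳ (b2n (not (S zero)))))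
      (subst (λ k → Good vertexTable ls k (b2n (S zero)) (b2n (not (S zero)))) (sym (+-identityʳ (d zero i0 + (d zero i1 + d zero i2)))) (vertex-good [] (S zero) (d zero i0) (d zero i1) (d zero i2)))
    where
    ls = (S zero , d zero i0) ∷ (S zero , d zero i1) ∷ (S zero , d zero i2) ∷ []
  kind-good slot true S d pay = slot-good (λ {as} {w} → ++-coverʳ tableP {tableQ} {as} {w})
    (subst (λ X → Good X ls K s c) isQ
      (Local.local-good eqB eqB-sound diffB vertexTable netQ sweepQ st (λ v → d v i0 + (d v i1 + d v i2)) (b2n ∘ S) (b2n ∘ not ∘ S) pay
        (λ v ks → vertex-good ks (S v) (d v i0) (d v i1) (d v i2)) finalQ okQ))
    where
    st : Fin (Net.size netQ) × Fin 3 → Strand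
    st h = S (proj₁ h) , d (proj₁ h) (proj₂ h)
    ls = map st (map (Net.port netQ) sixPorts)
    K = sumFin λ v → d v i0 + (d v i1 + d v i2)
    s = sumFin (b2n ∘ S)
    c = sumFin (b2n ∘ not ∘ S)
    slot-good : (∀ {as w} → Cover tableQ as w → Cover (tableP ++ tableQ) as w) → Good tableQ ls K s c → Good tableS ls K s c
    slot-good f g = tidy-good {tableP ++ tableQ} {ls} {K} {s} {c} (Good-mono {tableQ} {tableP ++ tableQ} {ls} {K} {s} {c} (λ {as} {w} → f {as} {w}) g)
  kind-good slot false S d pay = slot-good (λ {as} {w} → ++-coverˡ {tableP} {tableQ} {as} {w})
    (subst (λ X → Good X ls K s c) isP
      (Local.local-good eqB eqB-sound diffB vertexTable netP sweepP st (λ v → d v i0 + (d v i1 + d v i2)) (b2n ∘ S) (b2n ∘ not ∘ S) pay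
        (λ v ks → vertex-good ks (S v) (d v i0) (d v i1) (d v i2)) finalP okP))
    where
    st : Fin (Net.size netP) × Fin 3 → Strand
    st h = S (proj₁ h) , d (proj₁ h) (proj₂ h)
    ls = map st (map (Net.port netP) sixPorts)
    K = sumFin λ v → d v i0 + (d v i1 + d v i2)
    s = sumFin (b2n ∘ S)
    c = sumFin (b2n ∘ not ∘ S)
    slot-good : (∀ {as w} → Cover tableP as w → Cover (tableP ++ tableQ) as w) → Good tableP ls K s c → Good tableS ls K s c
    slot-good f g = tidy-good {tableP ++ tableQ} {ls} {K} {s} {c} (Good-mono {tableP} {tableP ++ tableQ} {ls} {K} {s} {c} (λ {as} {w} → f {as} {w}) g)

  module CutSize (m : ℕ) (b : Fin 45 → Bool) where
    open ChainWalk m b public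

    module _ (S : V → Bool) where
      -- Only the half-edge on the inner side of a cut edge is charged. Its two half-edges together
      -- thus pay exactly the price of the edge, and the sum of all charges is the boundary.
      lv : V → Fin 3 → ℕ
      lv v a = b2n (S v ∧ not (S (proj₁ (opp (v , a)))))

      strandH : H → Strand
      strandH h = S (proj₁ h) , lv (proj₁ h) (proj₂ h)

      pay : ∀ h k → opp h ≡ k → diffB (S (proj₁ h)) (S (proj₁ k)) ≤ lv (proj₁ h) (proj₂ h) + lv (proj₁ k) (proj₂ k)
      pay h k refl = subst (λ z → diffB (S (proj₁ h)) (S (proj₁ k)) ≤ lv (proj₁ h) (proj₂ h) + b2n (S (proj₁ k) ∧ not (S (proj₁ z))))
        (sym (opp-inv h)) (diffB-≤ (S (proj₁ h)) (S (proj₁ k)))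

      costB yesB noB : Blk → ℕ
      costB x = sumFin λ v → lv (x , v) i0 + (lv (x , v) i1 + lv (x , v) i2)
      yesB x = sumFin λ v → b2n (S (x , v))
      noB x = sumFin λ v → b2n (not (S (x , v)))

      inside : ∀ x v a w c → N.link x v a ≡ inj₁ (w , c) → diffB (S (x , v)) (S (x , w)) ≤ lv (x , v) a + lv (x , w) c
      inside x v a w c e = pay ((x , v) , a) ((x , w) , c) (cong (cross x) e)

      strandP : Port → Strand
      strandP x = strandH (vertexOf x)

      pay-port : ∀ x y → real (proj₁ x) (proj₂ x) ≡ true → mate x ≡ y → diffB (proj₁ (strandP x)) (proj₁ (strandP y)) ≤ proj₂ (strandP x) + proj₂ (strandP y)
      pay-port x y r e = pay (vertexOf x) (vertexOf y) (trans (opp-port (proj₁ x) (proj₂ x) r) (cong vertexOf e))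

      open Fixed

      strandF : FPort → Strand
      strandF (i , p) = strandP (inj₁ i , p)

      linkedF-sound : ∀ x y → linkedF x y ≡ true → diffB (proj₁ (strandF x)) (proj₁ (strandF y)) ≤ proj₂ (strandF x) + proj₂ (strandF y)
      linkedF-sound (i , p) (j , q) e = pay-port (inj₁ i , p) (inj₁ j , q) (&-fst e) (cong decode (eqCode-sound _ (fixed j q) (&-snd {realF i p} e)))

      open Sound strandF linkedF-sound

      costF yesF noF : Fin 45 → ℕ
      costF i = costB (inj₁ i)
      yesF i = yesB (inj₁ i)
      noF i = noB (inj₁ i)

      fits : ∀ i → Fits costF yesF noF (itemF tableS i)
      fits i = subst (λ ls → Good (tableFor tableS (kindOf i)) ls (costF i) (yesF i) (noF i)) (map-∘ (portsOf (kindOf i)))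
        (kind-good (kindOf i) (b i) (λ v → S (inj₁ i , v)) (λ v → lv (inj₁ i , v)) λ h k e → inside (inj₁ i) (proj₁ h) (proj₂ h) (proj₁ k) (proj₂ k) e)

      fixed-good : ∀ T → (∀ i → Fits costF yesF noF (itemF T i)) → ∀ Y →
        Good (afterFixed T Y) (map strandF ends) (sumFin costF) (sumFin yesF) (sumFin noF)
      fixed-good T fit Y = run-tabulate costF yesF noF (itemF T) finalK {ends} (saneF T) (endsF T) fit

      costY yesY noY : Fin (suc (suc m)) → ℕ
      costY j = costB (inj₂ j)
      yesY j = yesB (inj₂ j)
      noY j = noB (inj₂ j)

      open Walk eqB eqB-sound diffB strandP pay-port costY yesY noY

      table-Y : Ygood tableY
      table-Y j = subst (λ X → Good X (map strand (map (Net.port netY) sixPorts)) (costY j) (yesY j) (noY j)) isY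
        (Local.local-good eqB eqB-sound diffB vertexTable netY sweepY strand (λ v → lv (inj₂ j , v) i0 + (lv (inj₂ j , v) i1 + lv (inj₂ j , v) i2))
          (λ v → b2n (S (inj₂ j , v))) (λ v → b2n (not (S (inj₂ j , v))))
          (λ h k e → inside (inj₂ j) (proj₁ h) (proj₂ h) (proj₁ k) (proj₂ k) e)
          (λ v ks → vertex-good ks (S (inj₂ j , v)) (lv (inj₂ j , v) i0) (lv (inj₂ j , v) i1) (lv (inj₂ j , v) i2)) finalY okY)
        where
        strand : Fin (Net.size netY) × Fin 3 → Strand
        strand h = strandH ((inj₂ j , proj₁ h) , proj₂ h)

      begin-good : ∀ T Y → (∀ i → Fits costF yesF noF (itemF T i)) → Good (afterFixed T Y) (three headP ++ three tailP) (sumFin costF) (sumFin yesF) (sumFin noF)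
      begin-good T Y fit = fixed-good T fit Y

      bound : ∀ inv → chainInv tableS tableY ≡ inv → verdict inv tableY ≡ true →
        Bound (sumFin costF + sumFin costY) (sumFin yesF + sumFin yesY) (sumFin noF + sumFin noY)
      bound inv refl v = allHarmless-bound (join 6 inv tableY) {sumFin costF + sumFin costY} {sumFin yesF + sumFin yesY} {sumFin noF + sumFin noY}
        (&-snd {coversAll inv (join 3 inv tableY)} {allHarmless (join 6 inv tableY)} v)
        (Ring.ring (afterFixed tableS tableY) tableY table-Y {sumFin costF} {sumFin yesF} {sumFin noF} (begin-good tableS tableY fits)
          (λ {as} {w} → coversAll-sound inv (join 3 inv tableY) (&-fst {coversAll inv (join 3 inv tableY)} {allHarmless (join 6 inv tableY)} v) {as} {w}))

module ColourTable where
 open import Defs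
 open Gluing
 open HalfEdgeGraphs
 open Network
 open CutTable
 open CutBound using (module ChainWalk)
 open import Data.Nat using (ℕ; zero; suc; _+_; _≤_; z≤n)
 open import Data.Nat.Properties using (≤-reflexive)
 open import Data.Bool using (Bool; true; false; if_then_else_)
 open import Data.Fin using (Fin; zero; suc)
 open import Data.List using (List; []; _∷_; map)
 open import Data.List.Relation.Unary.Any using (here; there)
 open import Data.List.Relation.Unary.All using (All; []; _∷_)
 open import Data.Product using (_×_; _,_; proj₁; proj₂)
 open import Data.Sum using (inj₁; inj₂)
 open import Relation.Binary.PropositionalEquality

 -- Colours as labels: what slots and zigzags force.

 eqC-sound : ∀ x y → eqC x y ≡ true → x ≡ y
 eqC-sound c0 c0 e = refl
 eqC-sound c1 c1 e = refl
 eqC-sound c2 c2 e = refl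
 eqC-sound c3 c3 e = refl

 -- A mismatch costs six, the amount at which gluing discards a state, so the engine for cuts
 -- enumerates colourings without change.
 diffC : C → C → ℕ
 diffC x y = if eqC x y then 0 else 6

 diffC-≡ : ∀ {x y} → x ≡ y → diffC x y ≤ 0
 diffC-≡ {x} refl rewrite eqC-refl x = z≤n

 infixr 5 _⇒_
 _⇒_ : Bool → Bool → Bool
 a ⇒ b = if a then b else true

 ⇒-mp : ∀ {a b} → (a ⇒ b) ≡ true → a ≡ true → b ≡ true
 ⇒-mp e refl = e

 allC : (C → Bool) → Bool
 allC f = f c0 & f c1 & f c2 & f c3

 allC-sound : ∀ f → allC f ≡ true → ∀ x → f x ≡ true
 allC-sound f e c0 = &-fst e
 allC-sound f e c1 = &-fst (&-snd {f c0} e)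
 allC-sound f e c2 = &-fst (&-snd {f c1} (&-snd {f c0} e))
 allC-sound f e c3 = &-snd {f c2} (&-snd {f c1} (&-snd {f c0} e))

 allC³-sound : ∀ (f : C → C → C → Bool) → (allC λ x → allC λ y → allC λ z → f x y z) ≡ true → ∀ x y z → f x y z ≡ true
 allC³-sound f e x y z = allC-sound (f x y) (allC-sound (λ y → allC (f x y)) (allC-sound (λ x → allC (λ y → allC (f x y))) e x) y) z

 infixl 6 _⊕_
 _⊕_ : C → C → C
 c0 ⊕ y = y
 x ⊕ c0 = x
 c1 ⊕ c1 = c0
 c1 ⊕ c2 = c3
 c1 ⊕ c3 = c2
 c2 ⊕ c1 = c3
 c2 ⊕ c2 = c0
 c2 ⊕ c3 = c1
 c3 ⊕ c1 = c2
 c3 ⊕ c2 = c1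
 c3 ⊕ c3 = c0

 ⊕-assoc : ∀ x y z → (x ⊕ y) ⊕ z ≡ x ⊕ (y ⊕ z)
 ⊕-assoc x y z = eqC-sound _ _ (allC³-sound (λ x y z → eqC ((x ⊕ y) ⊕ z) (x ⊕ (y ⊕ z))) refl x y z)

 ⊕-swap : ∀ x y z → (x ⊕ y) ⊕ z ≡ (x ⊕ z) ⊕ y
 ⊕-swap x y z = eqC-sound _ _ (allC³-sound (λ x y z → eqC ((x ⊕ y) ⊕ z) ((x ⊕ z) ⊕ y)) refl x y z)

 proper-⊕ : ∀ x y z → proper x y z ≡ true → y ≡ x ⊕ z
 proper-⊕ x y z p = eqC-sound _ _ (⇒-mp (allC³-sound (λ x y z → proper x y z ⇒ eqC y (x ⊕ z)) refl x y z) p)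

 open Engine eqC eqC-sound diffC

 colourTable : List St
 colourTable = map (_∶ ⟨ 0 , 0 , 0 ⟩)
   ((c1 ∷ c2 ∷ c3 ∷ []) ∷ (c1 ∷ c3 ∷ c2 ∷ []) ∷ (c2 ∷ c1 ∷ c3 ∷ []) ∷ (c2 ∷ c3 ∷ c1 ∷ []) ∷ (c3 ∷ c1 ∷ c2 ∷ []) ∷ (c3 ∷ c2 ∷ c1 ∷ []) ∷ [])

 free : List C → St
 free as = as ∶ ⟨ 0 , 0 , 0 ⟩

 pulls-cover : ∀ ks x y z → proper x y z ≡ true → Cover colourTable (pulls ks (x ∷ y ∷ z ∷ [])) ⟨ 0 , 0 , 0 ⟩
 pulls-cover [] x y z p = covers-sound colourTable (free (x ∷ y ∷ z ∷ []))
   (⇒-mp (allC³-sound (λ x y z → proper x y z ⇒ covers colourTable (free (x ∷ y ∷ z ∷ []))) refl x y z) p)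
 pulls-cover (zero ∷ ks) x y z p = pulls-cover ks x y z p
 pulls-cover (suc zero ∷ ks) x y z p = pulls-cover ks y x z (⇒-mp (allC³-sound (λ x y z → proper x y z ⇒ proper y x z) refl x y z) p)
 pulls-cover (suc (suc zero) ∷ ks) x y z p = pulls-cover ks z x y (⇒-mp (allC³-sound (λ x y z → proper x y z ⇒ proper z x y) refl x y z) p)
 pulls-cover (suc (suc (suc k)) ∷ ks) x y z p = subst (λ l → Cover colourTable (pulls ks l) ⟨ 0 , 0 , 0 ⟩) (sym (pull-late k)) (pulls-cover ks x y z p)
   where
   pull-late : ∀ k → pull (3 + k) (x ∷ y ∷ z ∷ []) ≡ x ∷ y ∷ z ∷ []
   pull-late zero = refl
   pull-late (suc k) = refl

 still : C → Strand
 still x = x , 0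

 corner-colour : ∀ ks x y z → proper x y z ≡ true → Good colourTable (pulls ks (still x ∷ still y ∷ still z ∷ [])) 0 0 0
 corner-colour ks x y z p = inj₂ (0 , ≤-reflexive (flow-pulls ks ls)
   , subst (λ l → Cover colourTable l ⟨ 0 , 0 , 0 ⟩) (sym (map-pulls proj₁ ks ls)) (pulls-cover ks x y z p))
   where ls = still x ∷ still y ∷ still z ∷ []

 colour-good : ∀ {real} (N : Net real) rows fm → Local.SweepOk eqC eqC-sound diffC colourTable N rows fm →
   (f : Fin (Net.size N) → Fin 3 → C) →
   (∀ h k → Net.link N (proj₁ h) (proj₂ h) ≡ inj₁ k → f (proj₁ h) (proj₂ h) ≡ f (proj₁ k) (proj₂ k)) →
   (∀ v → proper (f v i0) (f v i1) (f v i2) ≡ true) →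
   Good (Local.table-of eqC eqC-sound diffC colourTable N rows fm) (map (λ h → still (f (proj₁ h) (proj₂ h))) (map (Net.port N) sixPorts)) 0 0 0
 colour-good N rows fm ok f con good = subst (λ k → Good X ls k k k) (sumFin-zero {Net.size N} (λ _ → 0) (λ _ → refl))
   (Local.local-good eqC eqC-sound diffC colourTable N rows (λ h → still (f (proj₁ h) (proj₂ h))) (λ _ → 0) (λ _ → 0) (λ _ → 0)
     (λ h k e → diffC-≡ (con h k e)) (λ v ks → corner-colour ks (f v i0) (f v i1) (f v i2) (good v)) fm ok)
   where
   X = Local.table-of eqC eqC-sound diffC colourTable N rows fm
   ls = map (λ h → still (f (proj₁ h) (proj₂ h))) (map (Net.port N) sixPorts)

 -- Colourings have total cost zero, which rules out the alternative of six spent edges.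
 Good-cover : ∀ X ls → Good X ls 0 0 0 → Cover X (labels ls) ⟨ 0 , 0 , 0 ⟩
 Good-cover X ls (inj₂ (zero , p , q)) = q

 -- Ports 0 to 2 and 3 to 5 belong to the two vertices cut out of the snark; their common sum is the
 -- element that the slot transmits.
 carries : List C → Bool
 carries (x ∷ y ∷ z ∷ x' ∷ y' ∷ z' ∷ []) = eqC ((x ⊕ y) ⊕ z) ((x' ⊕ y') ⊕ z') & nonzero ((x ⊕ y) ⊕ z)
 carries _ = false

 allCarry : List St → Bool
 allCarry [] = true
 allCarry (x ∷ xs) = carries (lbl x) & allCarry xs

 allCarry-sound : ∀ X {as w} → allCarry X ≡ true → Cover X as w → carries as ≡ true
 allCarry-sound (x ∷ X) e (here (refl , _)) = &-fst e
 allCarry-sound (x ∷ X) e (there p) = allCarry-sound X (&-snd {carries (lbl x)} e) p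

 carryP : Local.SweepOk eqC eqC-sound diffC colourTable netP sweepP finalP
 carryP = refl , refl
 carryQ : Local.SweepOk eqC eqC-sound diffC colourTable netQ sweepQ finalQ
 carryQ = refl , refl
 carryY : Local.SweepOk eqC eqC-sound diffC colourTable netY sweepY finalY
 carryY = refl , refl

 allList : {A : Set} → (A → Bool) → List A → Bool
 allList f [] = true
 allList f (x ∷ xs) = f x & allList f xs

 allList-sound : {A : Set} {P : A → Set} (f : A → Bool) → (∀ x → f x ≡ true → P x) → ∀ xs → allList f xs ≡ true → All P xs
 allList-sound f s [] e = []
 allList-sound f s (x ∷ xs) e = s x (&-fst e) ∷ allList-sound f s xs (&-snd {f x} e)

 -- The half-block with vertices numbered 0 … 13, slots 1, 3, 6, 9, 12: the legs of 2, 5, 8, 11 and the vertices 7, 13, 4, 10 form a zigzag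
 -- that forces its two ends, port 1 of 7 and port 2 of 10, to have the same colour.
 zigzagVertices zigzagSlots : List ℕ
 zigzagVertices = 2 ∷ 4 ∷ 5 ∷ 7 ∷ 8 ∷ 10 ∷ 11 ∷ 13 ∷ []
 zigzagSlots = 1 ∷ 3 ∷ 6 ∷ 9 ∷ 12 ∷ []

 zigzagLinks : List ((ℕ × ℕ) × (ℕ × ℕ))
 zigzagLinks =
   ((2 , 0) , (1 , 3)) ∷ ((3 , 0) , (2 , 1)) ∷ ((3 , 1) , (1 , 4)) ∷ ((3 , 2) , (1 , 5)) ∷
   ((6 , 0) , (3 , 3)) ∷ ((5 , 0) , (3 , 4)) ∷ ((6 , 1) , (5 , 1)) ∷ ((6 , 2) , (3 , 5)) ∷
   ((9 , 0) , (6 , 3)) ∷ ((9 , 1) , (6 , 4)) ∷ ((8 , 0) , (6 , 5)) ∷ ((9 , 2) , (8 , 1)) ∷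
   ((11 , 0) , (9 , 3)) ∷ ((12 , 0) , (11 , 1)) ∷ ((12 , 1) , (9 , 4)) ∷ ((12 , 2) , (9 , 5)) ∷
   ((4 , 0) , (2 , 2)) ∷ ((7 , 0) , (5 , 2)) ∷ ((10 , 0) , (8 , 2)) ∷ ((13 , 0) , (11 , 2)) ∷
   ((13 , 1) , (7 , 2)) ∷ ((4 , 1) , (13 , 2)) ∷ ((10 , 1) , (4 , 2)) ∷ []

 module Zigzag (c : ℕ → ℕ → C) where
   Linked : (ℕ × ℕ) × (ℕ × ℕ) → Set
   Linked ((i , p) , (j , q)) = c i p ≡ c j q

   Proper : ℕ → Set
   Proper k = proper (c k 0) (c k 1) (c k 2) ≡ true

   into from : ℕ → C
   into k = (c k 0 ⊕ c k 1) ⊕ c k 2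
   from k = (c k 3 ⊕ c k 4) ⊕ c k 5

   Carry : ℕ → Set
   Carry k = into k ≡ from k × nonzero (into k) ≡ true

   private
     -- A vertex between two slots taps one of the three strands and so adds the colour of its leg
     -- to the sum. The three versions are for the strand tapped.
     step₀ : ∀ x y z {a b l a' s} → proper a a' l ≡ true → a ≡ x → s ≡ (x ⊕ y) ⊕ z → b ≡ a' → (b ⊕ y) ⊕ z ≡ s ⊕ l
     step₀ x y z {a} {l = l} {a'} p refl refl refl rewrite proper-⊕ a a' l p | ⊕-swap a l y = ⊕-swap (a ⊕ y) l z
     step₁ : ∀ x y z {a b l a' s} → proper a a' l ≡ true → a ≡ y → s ≡ (x ⊕ y) ⊕ z → b ≡ a' → (x ⊕ b) ⊕ z ≡ s ⊕ l
     step₁ x y z {a} {l = l} {a'} p refl refl refl rewrite proper-⊕ a a' l p | sym (⊕-assoc x a l) = ⊕-swap (x ⊕ a) l z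
     step₂ : ∀ x y z {a b l a' s} → proper a a' l ≡ true → a ≡ z → s ≡ (x ⊕ y) ⊕ z → b ≡ a' → (x ⊕ y) ⊕ b ≡ s ⊕ l
     step₂ x y z {a} {l = l} {a'} p refl refl refl rewrite proper-⊕ a a' l p = sym (⊕-assoc (x ⊕ y) a l)

     -- Each hypothesis is tested as soon as its colours are chosen; this nesting cuts the
     -- enumeration of ten colours down to the cases that satisfy all earlier hypotheses.
     g₆ g₅ : C → C → C → C → C → C → Bool
     g₆ l₂ l₃ e₁₂ e₃₄ a b = proper l₃ e₃₄ b ⇒ eqC a b
     g₅ l₁ l₂ l₃ e₁₂ e₃₄ a = proper l₂ a e₁₂ ⇒ allC (g₆ l₂ l₃ e₁₂ e₃₄ a)
     g₄ : C → C → C → C → C → C → Bool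
     g₄ l₁ l₂ l₃ e₁₂ e₂₃ e₃₄ = proper l₁ e₂₃ e₃₄ ⇒ allC (g₅ l₁ l₂ l₃ e₁₂ e₃₄)
     g₃ : C → C → C → C → C → C → Bool
     g₃ l₁ l₂ l₃ l₄ e₁₂ e₂₃ = proper l₄ e₁₂ e₂₃ ⇒ allC (g₄ l₁ l₂ l₃ e₁₂ e₂₃)
     g₂ : C → C → C → C → C → Bool
     g₂ s₃ l₁ l₂ l₃ l₄ = nonzero (s₃ ⊕ l₄) ⇒ allC λ e₁₂ → allC (g₃ l₁ l₂ l₃ l₄ e₁₂)
     g₁ : C → C → C → C → Bool
     g₁ s₂ l₁ l₂ l₃ = nonzero (s₂ ⊕ l₃) ⇒ allC (g₂ (s₂ ⊕ l₃) l₁ l₂ l₃)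
     g₀ : C → C → C → Bool
     g₀ s l₁ l₂ = (nonzero s & nonzero (s ⊕ l₁) & nonzero ((s ⊕ l₁) ⊕ l₂)) ⇒ allC (g₁ ((s ⊕ l₁) ⊕ l₂) l₁ l₂)

     -- The path 7, 13, 4, 10 meets the legs in the order second, fourth, first, third. By
     -- conservation the sum of its end colours is the sum of the four legs, that is, of the
     -- elements transmitted before the first and after the last leg. So either these two agree, and
     -- the ends agree with them, or this order of the legs leaves no proper colouring of the path.
     forced : (allC λ s → allC λ l₁ → allC (g₀ s l₁)) ≡ true
     forced = refl

   &-intro : ∀ {a b} → a ≡ true → b ≡ true → (a & b) ≡ true
   &-intro refl refl = refl

   zigzag-ends : All Linked zigzagLinks → All Proper zigzagVertices → All Carry zigzagSlots → c 7 1 ≡ c 10 2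
   zigzag-ends (a₀ ∷ a₁ ∷ a₂ ∷ a₃ ∷ b₀ ∷ b₁ ∷ b₂ ∷ b₃ ∷ d₀ ∷ d₁ ∷ d₂ ∷ d₃ ∷ f₀ ∷ f₁ ∷ f₂ ∷ f₃ ∷ l₁ ∷ l₂ ∷ l₃ ∷ l₄ ∷ m₁₂ ∷ m₂₃ ∷ m₃₄ ∷ [])
     (v₂ ∷ v₄ ∷ v₅ ∷ v₇ ∷ v₈ ∷ v₁₀ ∷ v₁₁ ∷ v₁₃ ∷ []) ((p₁ , q₁) ∷ (p₃ , q₃) ∷ (p₆ , q₆) ∷ (p₉ , q₉) ∷ (p₁₂ , q₁₂) ∷ []) =
     eqC-sound (c 7 1) (c 10 2) (⇒-mp (allC-sound (g₆ (c 5 2) (c 8 2) (c 7 2) (c 4 2) (c 7 1)) r₅ (c 10 2)) w₁₀)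
     where
     s₁ : into 3 ≡ into 1 ⊕ c 2 2
     s₁ = trans (cong₂ (λ y z → (c 3 0 ⊕ y) ⊕ z) a₂ a₃) (step₀ (c 1 3) (c 1 4) (c 1 5) v₂ a₀ p₁ a₁)
     s₂ : into 6 ≡ (into 1 ⊕ c 2 2) ⊕ c 5 2
     s₂ = trans (cong₂ (λ y z → (y ⊕ c 6 1) ⊕ z) b₀ b₃) (step₁ (c 3 3) (c 3 4) (c 3 5) v₅ b₁ (trans (sym s₁) p₃) b₂)
     s₃ : into 9 ≡ ((into 1 ⊕ c 2 2) ⊕ c 5 2) ⊕ c 8 2
     s₃ = trans (cong₂ (λ y z → (y ⊕ z) ⊕ c 9 2) d₀ d₁) (step₂ (c 6 3) (c 6 4) (c 6 5) v₈ d₂ (trans (sym s₂) p₆) d₃)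
     s₄ : into 12 ≡ (((into 1 ⊕ c 2 2) ⊕ c 5 2) ⊕ c 8 2) ⊕ c 11 2
     s₄ = trans (cong₂ (λ y z → (c 12 0 ⊕ y) ⊕ z) f₂ f₃) (step₀ (c 9 3) (c 9 4) (c 9 5) v₁₁ f₀ (trans (sym s₃) p₉) f₁)
     n₁ = trans (cong nonzero (sym s₁)) q₃
     n₂ = trans (cong nonzero (sym s₂)) q₆
     n₃ = trans (cong nonzero (sym s₃)) q₉
     n₄ = trans (cong nonzero (sym s₄)) q₁₂
     w₁₃ : proper (c 11 2) (c 7 2) (c 13 2) ≡ true
     w₁₃ = subst₂ (λ x y → proper x y (c 13 2) ≡ true) l₄ m₁₂ v₁₃
     w₄ : proper (c 2 2) (c 13 2) (c 4 2) ≡ true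
     w₄ = subst₂ (λ x y → proper x y (c 4 2) ≡ true) l₁ m₂₃ v₄
     w₇ : proper (c 5 2) (c 7 1) (c 7 2) ≡ true
     w₇ = subst (λ x → proper x (c 7 1) (c 7 2) ≡ true) l₂ v₇
     w₁₀ : proper (c 8 2) (c 4 2) (c 10 2) ≡ true
     w₁₀ = subst₂ (λ x y → proper x y (c 10 2) ≡ true) l₃ m₃₄ v₁₀
     r₁ = ⇒-mp (allC³-sound g₀ forced (into 1) (c 2 2) (c 5 2)) (&-intro q₁ (&-intro n₁ n₂))
     r₂ = ⇒-mp (allC-sound (g₁ ((into 1 ⊕ c 2 2) ⊕ c 5 2) (c 2 2) (c 5 2)) r₁ (c 8 2)) n₃
     r₃ = ⇒-mp (allC-sound (g₂ (((into 1 ⊕ c 2 2) ⊕ c 5 2) ⊕ c 8 2) (c 2 2) (c 5 2) (c 8 2)) r₂ (c 11 2)) n₄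
     r₃' = ⇒-mp (allC-sound (g₃ (c 2 2) (c 5 2) (c 8 2) (c 11 2) (c 7 2)) (allC-sound (λ e₁₂ → allC (g₃ (c 2 2) (c 5 2) (c 8 2) (c 11 2) e₁₂)) r₃ (c 7 2)) (c 13 2)) w₁₃
     r₄ = ⇒-mp (allC-sound (g₄ (c 2 2) (c 5 2) (c 8 2) (c 7 2) (c 13 2)) r₃' (c 4 2)) w₄
     r₅ = ⇒-mp (allC-sound (g₅ (c 2 2) (c 5 2) (c 8 2) (c 7 2) (c 4 2)) r₄ (c 7 1)) w₇

module Uncolourability where
 open import Defs
 open Gluing
 open HalfEdgeGraphs
 open Network
 open CutTable
 open CutBound using (module ChainWalk)
 open import Data.Nat using (ℕ; zero; suc; _+_; z≤n)
 open import Data.Nat.DivMod using (_mod_)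
 open import Data.Bool using (Bool; true; false; not; if_then_else_)
 open import Data.Fin using (Fin; zero; suc)
 open import Data.List using (List; []; _∷_; _++_; map; concatMap)
 open import Data.List.Relation.Unary.All using ([]; _∷_)
 open import Data.Product using (_,_; proj₁; proj₂)
 open import Data.Sum using (inj₁; inj₂)
 open import Data.Empty using (⊥)
 open import Function using (_∘_)
 open import Relation.Binary.PropositionalEquality
 open ColourTable
 open Engine eqC eqC-sound diffC

 -- No 3-edge-colouring, with or without `s` and `t`.

 paints : List C
 paints = c1 ∷ c2 ∷ c3 ∷ []

 -- Colours of the head and tail strands of the fixed part; each q vertex separates a head from a tail.
 looseEnds : List St
 looseEnds = concatMap (λ h₀ → concatMap (λ h₁ → concatMap (λ h₂ → concatMap (λ t₀ → concatMap (λ t₁ → concatMap (λ t₂ →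
   if not (eqC h₁ t₀) & not (eqC h₀ t₁) & not (eqC h₂ t₂) then free (h₀ ∷ h₁ ∷ h₂ ∷ t₀ ∷ t₁ ∷ t₂ ∷ []) ∷ [] else []) paints) paints) paints) paints) paints) paints

 loose-covered : C → C → C → C → C → C → Bool
 loose-covered h₀ h₁ h₂ t₀ t₁ t₂ = (nonzero h₀ & nonzero h₁ & nonzero h₂) ⇒ (nonzero t₀ & nonzero t₁ & nonzero t₂) ⇒
   (not (eqC h₁ t₀) & not (eqC h₀ t₁) & not (eqC h₂ t₂)) ⇒ covers looseEnds (free (h₀ ∷ h₁ ∷ h₂ ∷ t₀ ∷ t₁ ∷ t₂ ∷ []))

 allLoose : (allC λ h₀ → allC λ h₁ → allC λ h₂ → allC λ t₀ → allC λ t₁ → allC λ t₂ → loose-covered h₀ h₁ h₂ t₀ t₁ t₂) ≡ true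
 allLoose = refl

 noneLeft : List St → Bool
 noneLeft [] = true
 noneLeft (_ ∷ _) = false

 impossible : ∀ X → noneLeft X ≡ true → Good X [] 0 0 0 → ⊥
 impossible [] e (inj₂ (_ , _ , ()))

 -- The parity behind flower snarks. A Y preserves the sum of its strands. If it is zero, the
 -- strands carry all three colours and a Y permutes them by a 3-cycle; the pairing of heads with
 -- tails, which exchanges two strands, would need an odd derangement of three objects. If the sum
 -- is a, three strands of colour a cannot pass a Y, so the strands carry a, b, b in some order, and
 -- each Y replaces b by the third colour. A block has two Y's, so b is repeated at both ends of the
 -- chain, and two positions out of three at either end must meet in a paired head and tail, which
 -- have to differ.
 colourVerdict : List St → Bool
 colourVerdict Y = let X = join 3 looseEnds Y; I = tidy (X ++ join 3 X Y) in coversAll I (join 3 I Y) & noneLeft (join 6 I Y)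

 &-intro : ∀ {a b} → a ≡ true → b ≡ true → (a & b) ≡ true
 &-intro refl refl = refl

 record Carried {real} (N : Net real) (f : Fin (Net.size N) → Fin 3 → C) : Set where
   constructor carried-by
   field carried : carries (map (λ p → f (proj₁ (Net.port N p)) (proj₂ (Net.port N p))) sixPorts) ≡ true

 Carries : ∀ {real} → Net real → Set
 Carries N = (f : Fin (Net.size N) → Fin 3 → C) →
   (∀ h k → Net.link N (proj₁ h) (proj₂ h) ≡ inj₁ k → f (proj₁ h) (proj₂ h) ≡ f (proj₁ k) (proj₂ k)) →
   (∀ v → proper (f v i0) (f v i1) (f v i2) ≡ true) → Carried N f

 carry : ∀ {real} (N : Net real) rows fm → Local.SweepOk eqC eqC-sound diffC colourTable N rows fm →
   ∀ T → Local.table-of eqC eqC-sound diffC colourTable N rows fm ≡ T → allCarry T ≡ true → Carries N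
 carry N rows fm sweep T refl e f con ok = carried-by (allCarry-sound T {labels ls} {⟨ 0 , 0 , 0 ⟩} e (Good-cover T ls (colour-good N rows fm sweep f con ok)))
   where ls = map (λ h → still (f (proj₁ h) (proj₂ h))) (map (Net.port N) sixPorts)

 isVert : Kind → Bool
 isVert vert = true
 isVert slot = false

 vertex-kind : ∀ k β → isVert k ≡ true → (f : Fin (Net.size (netK k β)) → Fin 3 → C) → (∀ v → proper (f v i0) (f v i1) (f v i2) ≡ true) →
   let g = λ p → f (proj₁ (Net.port (netK k β) p)) (proj₂ (Net.port (netK k β) p)) in proper (g zero) (g (suc zero)) (g (suc (suc zero))) ≡ true
 vertex-kind vert β _ f ok = ok zero

 slot-carries : Carries netP → Carries netQ → ∀ k β → not (isVert k) ≡ true → Carries (netK k β)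
 slot-carries p q slot true _ = q
 slot-carries p q slot false _ = p

 module Uncolourable (carriesP : Carries netP) (carriesQ : Carries netQ) (tableY : List St)
   (isY : Local.table-of eqC eqC-sound diffC colourTable netY sweepY finalY ≡ tableY) (m : ℕ) (b : Fin 45 → Bool) where
   open ChainWalk m b

   -- Two of the three vertices of the slot ring between consecutive thirds; the zigzags and the
   -- slot sums used for them lie inside the thirds.
   s t : V
   s = inj₁ (0 mod 45) , zero
   t = inj₁ (14 mod 45) , zero

   module _ (F : H → C) (con : ∀ h → F (opp h) ≡ F h) (ok : ∀ v → v ≢ s → v ≢ t → proper (F (v , i0)) (F (v , i1)) (F (v , i2)) ≡ true) where

     strandP : Port → Strand
     strandP x = still (F (vertexOf x))

     port-colour : ∀ x y → real (proj₁ x) (proj₂ x) ≡ true → mate x ≡ y → F (vertexOf x) ≡ F (vertexOf y)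
     port-colour x y r e = trans (sym (con (vertexOf x))) (cong F (trans (opp-port (proj₁ x) (proj₂ x) r) (cong vertexOf e)))

     inside : ∀ x h k → N.link x (proj₁ h) (proj₂ h) ≡ inj₁ k → F ((x , proj₁ h) , proj₂ h) ≡ F ((x , proj₁ k) , proj₂ k)
     inside x h k e = trans (sym (con _)) (cong (F ∘ cross x) e)

     colF : Fin 45 → Fin 6 → C
     colF i p = F (vertexOf (inj₁ i , p))

     kept : Fin 45 → Bool
     kept i = not (eqFin i (0 mod 45)) & not (eqFin i (14 mod 45))

     neq : ∀ {n} {i j : Fin n} → not (eqFin i j) ≡ true → i ≢ j
     neq {i = zero} () refl
     neq {i = suc i} e refl = neq {i = i} e refl

     block-proper : ∀ i → kept i ≡ true → ∀ v → proper (F ((inj₁ i , v) , i0)) (F ((inj₁ i , v) , i1)) (F ((inj₁ i , v) , i2)) ≡ true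
     block-proper i e v = ok (inj₁ i , v) (λ r → neq {i = i} {0 mod 45} (&-fst e) (block r)) (λ r → neq {i = i} {14 mod 45} (&-snd {not (eqFin i (0 mod 45))} e) (block r))
       where
       block : ∀ {i j v w} → _≡_ {A = V} (inj₁ i , v) (inj₁ j , w) → i ≡ j
       block refl = refl

     vertex-proper : ∀ i → (kept i & isVert (kindOf i)) ≡ true → proper (colF i zero) (colF i (suc zero)) (colF i (suc (suc zero))) ≡ true
     vertex-proper i e = vertex-kind (kindOf i) (b i) (&-snd {kept i} e) (λ v a → F ((inj₁ i , v) , a)) (block-proper i (&-fst e))

     slot-carried : ∀ i → (kept i & not (isVert (kindOf i))) ≡ true → carries (map (colF i) sixPorts) ≡ true
     slot-carried i e = Carried.carried (slot-carries carriesP carriesQ (kindOf i) (b i) (&-snd {kept i} e) (λ v a → F ((inj₁ i , v) , a)) (inside (inj₁ i)) (block-proper i (&-fst e)))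

     link-colour : ∀ i p j q → Fixed.linkedF (i , p) (j , q) ≡ true → colF i p ≡ colF j q
     link-colour i p j q e = port-colour (inj₁ i , p) (inj₁ j , q) (&-fst e) (cong decode (eqCode-sound _ (fixed j q) (&-snd {realF i p} e)))

     half : ℕ → ℕ → ℕ → C
     half d k p = colF ((d + k) mod 45) (p mod 6)

     -- Each third is the half-block of the zigzag shifted by `d`, so its links and kinds of pieces
     -- are compared by evaluation once `d` is a numeral.
     agree : ∀ d →
       allList (λ { ((i , p) , (j , q)) → Fixed.linkedF ((d + i) mod 45 , p mod 6) ((d + j) mod 45 , q mod 6) }) zigzagLinks ≡ true →
       allList (λ k → kept ((d + k) mod 45) & isVert (kindOf ((d + k) mod 45))) zigzagVertices ≡ true →
       allList (λ k → kept ((d + k) mod 45) & not (isVert (kindOf ((d + k) mod 45)))) zigzagSlots ≡ true →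
       half d 7 1 ≡ half d 10 2
     agree d l v s = Zigzag.zigzag-ends (half d)
       (allList-sound {P = Zigzag.Linked (half d)} _ (λ { ((i , p) , (j , q)) e → link-colour ((d + i) mod 45) (p mod 6) ((d + j) mod 45) (q mod 6) e }) zigzagLinks l)
       (allList-sound {P = Zigzag.Proper (half d)} _ (λ k → vertex-proper ((d + k) mod 45)) zigzagVertices v)
       (allList-sound {P = Zigzag.Carry (half d)} _ (λ k e → let r = slot-carried ((d + k) mod 45) e in
         eqC-sound _ _ (&-fst r) , &-snd {eqC (Zigzag.into (half d) k) (Zigzag.from (half d) k)} r) zigzagSlots s)

     module _ (q k : ℕ) where
       private
         i = q mod 45
         j = k mod 45
       separated : ∀ {a} → (kept i & isVert (kindOf i)) ≡ true → Fixed.linkedF (i , 1 mod 6) (j , 2 mod 6) ≡ true → a ≡ colF j (2 mod 6) →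
         not (eqC (colF i (2 mod 6)) a) ≡ true
       separated v l refl with colF i (2 mod 6) | colF i (1 mod 6) | colF i (0 mod 6) | link-colour i (1 mod 6) j (2 mod 6) l | vertex-proper i v
       ... | x | y | z | refl | e = distinct-sym z y x e
         where
         distinct-sym : ∀ z y x → proper z y x ≡ true → not (eqC x y) ≡ true
         distinct-sym z y x e = ⇒-mp (allC³-sound (λ z y x → proper z y x ⇒ not (eqC x y)) refl z y x) e

     nonzero₁ : ∀ i → (kept i & isVert (kindOf i)) ≡ true → nonzero (colF i (1 mod 6)) ≡ true
     nonzero₁ i v = nonzero-at (colF i (0 mod 6)) (colF i (1 mod 6)) (colF i (2 mod 6)) (vertex-proper i v) i1

     nonzero₂ : ∀ i → (kept i & isVert (kindOf i)) ≡ true → nonzero (colF i (2 mod 6)) ≡ true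
     nonzero₂ i v = nonzero-at (colF i (0 mod 6)) (colF i (1 mod 6)) (colF i (2 mod 6)) (vertex-proper i v) i2

     zeroY : Fin (suc (suc m)) → ℕ
     zeroY _ = 0

     open Walk eqC eqC-sound diffC strandP (λ x y r e → diffC-≡ (port-colour x y r e)) zeroY zeroY zeroY

     table-Y : Ygood tableY
     table-Y j = subst (λ X → Good X (map (λ p → strandP (inj₂ j , p)) sixPorts) 0 0 0) isY
       (colour-good netY sweepY finalY carryY (λ v a → F ((inj₂ j , v) , a)) (inside (inj₂ j)) (λ v → ok (inj₂ j , v) (λ ()) (λ ())))

     start-good : Good looseEnds (three headP ++ three tailP) 0 0 0
     start-good = inj₂ (0 , z≤n , covers-sound looseEnds (free (labels (three headP ++ three tailP)))
       (⇒-mp (⇒-mp (⇒-mp (allC³-sound (loose-covered h₀ h₁ h₂) (allC³-sound (λ h₀ h₁ h₂ → allC λ t₀ → allC λ t₁ → allC λ t₂ → loose-covered h₀ h₁ h₂ t₀ t₁ t₂) allLoose h₀ h₁ h₂) t₀ t₁ t₂)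
         (&-intro (nonzero₂ (43 mod 45) refl) (&-intro (nonzero₂ (42 mod 45) refl) (nonzero₂ (44 mod 45) refl))))
         (&-intro (nonzero₁ (21 mod 45) refl) (&-intro (nonzero₁ (35 mod 45) refl) (nonzero₁ (7 mod 45) refl))))
         -- Vertex 42 pairs head 1 with tail 0, vertex 43 pairs head 0 with tail 1, and vertex 44
         -- pairs head 2 with tail 2: this is the exchange of two strands that the chain cannot
         -- follow.
         (&-intro (separated 42 24 refl refl (agree 14 refl refl refl)) (&-intro (separated 43 38 refl refl (agree 28 refl refl refl)) (separated 44 10 refl refl (agree 0 refl refl refl))))))
       where
       h₀ = colF (43 mod 45) (2 mod 6)
       h₁ = colF (42 mod 45) (2 mod 6)
       h₂ = colF (44 mod 45) (2 mod 6)
       t₀ = colF (21 mod 45) (1 mod 6)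
       t₁ = colF (35 mod 45) (1 mod 6)
       t₂ = colF (7 mod 45) (1 mod 6)

     stuck : colourVerdict tableY ≡ true → ⊥
     stuck over = impossible (join 6 R.I tableY) (&-snd {coversAll R.I (join 3 R.I tableY)} over) (subst (λ k → Good (join 6 R.I tableY) [] k k k) (sumFin-zero zeroY λ _ → refl)
         (R.ring (λ {as} {w} → coversAll-sound R.I (join 3 R.I tableY) (&-fst over) {as} {w})))
       where
       module R = Ring looseEnds tableY table-Y {0} {0} {0} start-good

module FlowData where
 open import Data.Nat using (ℕ)
 open import Data.List using (List; []; _∷_)

 -- Certificates: edge colourings written as numbers in base four.

 namedFlows : List ℕ
 namedFlows =
   2989742913425361831933811135353009759278870482688001174356 ∷ 4483213036642023562836737518315319796556468592294797765299 ∷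
   6177459393215242959326306311143894846136140884589639808965 ∷ 2989102420443761189511786483833819985340757748384345348921 ∷
   2989102420443761189511786483833819985340757748384345348345 ∷ 4483649428239907605199582353098846189877509636571537559990 ∷
   4483649428239907605199582353098846189877509636571537491382 ∷ 4483649428239907605199582353098846189877509636571537479094 ∷
   6077817209241431999579541754576900701075644917152712271734 ∷ 6077817209241431999579541754576900701068727374999902594550 ∷
   4583274878254799919972045421301623496522504564642201626553 ∷ 6077817209241431998558694653814085310685521094804755671542 ∷
   6077817209241431998558694410425165533393652452579396250102 ∷ 4583275018546113439465967675579077783089116359759974885753 ∷
   6177453504931854324373238170572186911348505226912126724473 ∷ 6177453575083934222940867220752758581088582689971947170169 ∷
   3786185098754003449112268683193109074394897566119315088999 ∷ 6177453504931855631057527146975886610706997742350070442361 ∷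
   6177453504931855631057527146975886610706997742195451619705 ∷ 6177453504931855631057527146975886610706997737178929817977 ∷
   2889466265044652384205080776687254315585588178785215703734 ∷ 5878544524390155810140137266452537896912298552430204721081 ∷
   6077817209241431999579541511187985457248682243600361957238 ∷ 6077823237816134154021615608667149952997111716196585564854 ∷
   6077823237816134154021615608667149945913579372971929627318 ∷ 6077823237816134154021615608667149945913576839697139231414 ∷
   3885827070929623279635987813989651368991602063184311610038 ∷ 2690187762062067458376799394132475943675638995735314920825 ∷
   4085099894730258941636076148429101658180383619588545797095 ∷ 5380374079720813701430167032021522171612475130996252714599 ∷
   2690187691909987559809170587340819517756813355221539059065 ∷ 5380374079720813701430167032021522174998029129274258859623 ∷
   4683209081952037569973914791331172418902147653530040391033 ∷ 3686195581489015226303103707100530879092485444398323591862 ∷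
   3686195581489015226304100871486284768049744578916000459446 ∷ 3686195581489015226304100871486284804057789010797045213878 ∷
   5778555290079043495057880107958483501611259527444529321721 ∷ 5778555290074761751979798634623738105967163624437510003449 ∷
   5479424845266960762146617565426348814110024884988636231158 ∷ 4583572926552928763646384443855798290226726565273111614841 ∷
   4583572926552928763646384443856415446857639833466799117689 ∷ 4583572926552928763645387522829239975435552473661512078713 ∷
   5280008863011785667768436017365082025753850941315357583222 ∷ 5878257181476243455979230433655671307303507327828764825529 ∷
   5878263281202348643785043083770732902813632983355182504889 ∷ 3785908250425442205429722750218372205578770382122223859303 ∷
   5878263281202348645826737284133624270454718553544677874617 ∷ 5878263281202348645826737284089058429040444863648309402553 ∷
   5878263281206630388904855162286319321063469187975280548793 ∷ 5778555290079043495057916513949090883432662774990757125049 ∷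
   4683270352587613994158175846956873917029611479062285904249 ∷ 4683280917680515658514170187331225806457697163549718604153 ∷
   4683270352587613994158180292657046519001537738996392126841 ∷ 4683270352587612687473886063109259473860405398668377057657 ∷
   2989743053716675351426088328316866438709721646500399278457 ∷ 5678847298951456601210972670690499701065864385602453461945 ∷
   5778555357872718189159890574407454611925422816512759994343 ∷ 5479424845266959455462261572128517012495603050725726988150 ∷
   3686195651645374255623654171049699177227956523917958378998 ∷ 3686195651645374255580620414686162525842695770341382223350 ∷
   3686195651645374255578626572692485152033340059750961706486 ∷ 3885821044709044584488199247545622096915019197318367737334 ∷
   3886253016721702460291921447205680557587565072125034752377 ∷ 5778626750754779306361979221299990403725158722275218724601 ∷
   3886253016721702456952651491544762213127032272877006612857 ∷ 4084734386308582958174590863822784371457363813239689553319 ∷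
   4683208708893753984142686908476503639864506898846181747065 ∷ 5280153280308151293143353787802432832116668374170170271606 ∷
   6177093814389929381339151605850435606992432979669259556793 ∷ 4683208708893662876431343946030888260752051206077594200441 ∷
   4683208708893751034064706887400494644138347769131672529273 ∷ 4084744880980722891353402000300664128503663411870969034343 ∷
   6077098103667768237632313389949926312475833877771692255094 ∷ 4683208706451147695655230237935395130152306998144237300089 ∷
   3686272469078230774210279389247587565333787913965051553191 ∷ 4683208706116012358148569828645136295822645929030350006649 ∷
   4683208706103167128914216189715611722097600472802905287033 ∷ 4683208705686410802644075904446592219018347892979143272825 ∷
   4683208708806966448219068310596709097503762478149005732217 ∷ 6177104491292057759086569983627347049372421299513085302713 ∷
   5280159375476484657586339420013246812097998666525126358518 ∷ 6177105772685027004346292916923898422915301209897683556281 ∷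
   6177104258569330729530869657906411728846092846351569033145 ∷ 6077108481756699588282459145006779181860279581873394132854 ∷
   5380147494456917602509756600730158784401334465381317172153 ∷ 4483208459218895442448797704374423729158051029914073164711 ∷
   4683189040400105330328764153736751941792658953855141669241 ∷ 4283921784774262604188415661731779295205270054387033041273 ∷
   5379890567216093798258455394402508392354162670976710190966 ∷ 3662843152957125425538217955175464754351934504165203441255 ∷
   4108081300610500473673062963167102883318101676435051357799 ∷ 3804585538647384941710044865933745387552373241647705335399 ∷
   3640214689042458559811592367062393471280734914885520913910 ∷ 5172782951680135336826209044677662137306880446558354532729 ∷
   4878543807833884676021406415464802774052082535099102914937 ∷ 759195793986375424754169606484771688484911774669580265849 ∷ []

 chainFlows : List ℕ
 chainFlows =
   4682384378603050902151537995989563198548883927459601836409 ∷ 5380004406497353891328745799112241467984615506229365503399 ∷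
   6153580097834304206175551142053860014822873484755859925369 ∷ 6153580097834304206175551142053860014822873484755859925369 ∷
   4497286974958601908914337911473663378220221771851610650023 ∷ 4682384378603050902151537995989563198548883927459601836409 ∷
   5859340953988053545370748512841000651568075573296608307577 ∷ 4682384378603050902151537995989563198548883927459601836409 ∷
   5859340953988053545370748512841000651568075573296608307577 ∷ 2524630657063879389582985381761927868013699243425089972601 ∷
   2230391513217628728778182752549068504758901331965838354809 ∷ 5674243550343604552133548428325100831239413417688617121191 ∷
   3701587232448882032802195898613365321032890889262096443769 ∷ 3701587232448882032802195898613365321032890889262096443769 ∷
   2524630657063879389582985381761927868013699243425089972601 ∷ 3701587232448882032802195898613365321032890889262096443769 ∷
   2524630657063879389582985381761927868013699243425089972601 ∷ 3908808687266100587304732653047944651710625948933107414439 ∷ []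

 -- Two flows for each of the fifteen slots, one for either order of colours that `shape` may
 -- prescribe at its ports.
 slotFlows : List ℕ
 slotFlows =
   4483649428239907604178735252336030799487385814276248627102 ∷ 4483649428239907604178735252336030799487385814276248614814 ∷
   4085099894730258941637073069425940345085240761318649753575 ∷ 4085099894730258941637073069425940345085240761317563428839 ∷
   2291642558323302393969674566836410844994509174174293665654 ∷ 3786190915530514474311981473859517787351490247233457576935 ∷
   4284372137730520113038679426596262363750990774657112512249 ∷ 4284372137730520113038679426596262363750989930232182380281 ∷
   5380369401916255359234537604070878838909586846121528351719 ∷ 5380369401916255359234537604070878838906128081607707810791 ∷
   5280014889232365668527471573442905497809953291797394840551 ∷ 2590910715153270503887917160898871639056233049176544897401 ∷
   5778555290074761749938104433068092742717117438755841989369 ∷ 5778555290079043495057880107958170385396760760797988022201 ∷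
   5878263281202348643785043082592834768822322229307513461689 ∷ 5878263281202348643785043083801064247164853377609058704313 ∷
   4683270352587613994158175850809343319285714894548360489337 ∷ 4683270352587613994158175607420428075465669807181345057145 ∷
   2989743053716676658110373106237019381386728821911332579705 ∷ 2989743053716676658109376185240180694482050966616122321273 ∷
   2690840614843435337841208643993910812087604052214816667318 ∷ 2690840614843435336820361543231095421697480229919512032950 ∷
   6177093814389930853230529722369759317819170253102754782137 ∷ 4683208708897857850653508636995650034823498176829066832249 ∷
   4683208706111643154335376218325417517170975368320810215801 ∷ 4683208706459891591355630429303639293716652181598200392057 ∷
   6177104492409592702475336570495984963451248818620872481721 ∷ 6177104422257514110591996496719112993069663875136110418873 ∷
   4483210172098814394267017839093047672641750066667013532583 ∷ 4483210172098814394267017839093047672641750066667013532391 ∷ []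

 clearP : List ℕ
 clearP =
   1106108108023490149 ∷ 409534665403657589 ∷ 405036271256989365 ∷ 405036271996418997 ∷ 713230850176050677 ∷ 790200237269874073 ∷ 1106108106949749353 ∷
   1034134007009148777 ∷ 987896875968805289 ∷ 1106169917334054569 ∷ 983464400995741161 ∷ 983468512836577257 ∷ 1043280363774179165 ∷ 988112362749213597 ∷
   819002535216638589 ∷ 747028435276038013 ∷ 818994315357021885 ∷ 713169039956371453 ∷ 431120566135143014 ∷ 409746042089488230 ∷ 549331797226002854 ∷
   494163796201037286 ∷ 1043280363271060058 ∷ 751953693589208922 ∷ 1127694007004535194 ∷ 751953695224616922 ∷ 751526831231694714 ∷ 747028435606167226 ∷
   1043064876608092014 ∷ 1106169915453972142 ∷ 1106108106673986286 ∷ 823496819028236670 ∷ 502813258410456702 ∷ 553482864612054462 ∷ 493948308464328446 ∷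
   790274376503582039 ∷ 823997824780560215 ∷ 1106451323036802711 ∷ 718226137592490711 ∷ 430909189315488375 ∷ 409534665269833591 ∷ 549116310059915703 ∷
   493948309034950135 ∷ 493812360387942391 ∷ 1043134905625009515 ∷ 553764271813388139 ∷ 1106169915705826987 ∷ 549331796840324011 ∷ 789711562915371387 ∷
   823566850263443067 ∷ 789777483630564795 ∷ 713230848213511931 ∷ 1115324492314929759 ∷ 823997822633078623 ∷ 1132192400812710303 ∷ 1115324493132633759 ∷
   790200235385609695 ∷ 1115104894900410735 ∷ 1115104895639840367 ∷ 1131985135130285487 ∷ 431120564785639151 ∷ []

 openedP : List ℕ
 openedP =
   1127829956544274004 ∷ 823997824776378260 ∷ 1043134907386812260 ∷ 1127548549213298280 ∷ 983464400999923112 ∷ 1034129898302306216 ∷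
   409746042753890792 ∷ 549331795770765164 ∷ 1043064876599728108 ∷ 713169039158393724 ∷ 1043280362700438353 ∷ 1127548548760956257 ∷ 409253258072681801 ∷
   1106600890022456969 ∷ 823566850350081337 ∷ 823566850397267065 ∷ 789918829938898317 ∷ 549331795790491437 ∷ 1106169915552525549 ∷ 405243536349062125 ∷
   1106451322784947858 ∷ 1034415415472413394 ∷ 1127482629645900258 ∷ 502813257336715890 ∷ 1128045443777273158 ∷ 785420436393940422 ∷
   1106670921335937734 ∷ 987896877730608038 ∷ 823496820420744310 ∷ 823496821175718262 ∷ 1043561769528294986 ∷ 823997822987116058 ∷ 430557751473191502 ∷
   1106319483489458718 ∷ 1127694006685767838 ∷ 790274377577322835 ∷ 553764269665906531 ∷ 503094663652498915 ∷ 549116308986174899 ∷ 502813257395263987 ∷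
   1115324494462411351 ∷ 431120566130960935 ∷ 549331796309745447 ∷ 1115104896292918375 ∷ 549331797159090343 ∷ 1106169916779565735 ∷ 790200237261509915 ∷
   823997824461792347 ∷ 790274375429837147 ∷ 1115667708154310223 ∷ 1132473807069945231 ∷ 1132332460545580191 ∷ 819565347660010399 ∷ 823566849189700223 ∷ []

 piercedP : List ℕ
 piercedP =
   785274977533136505 ∷ 747028435610316409 ∷ 747028435625631353 ∷ 785274977516682873 ∷ 713169039425792889 ∷ 746954295758191481 ∷ 823566848618884729 ∷
   823496819129936761 ∷ 549116308419735161 ∷ 819002534142897785 ∷ 409538758990883705 ∷ 553614635286621049 ∷ 823434737203244665 ∷ 819072556340047481 ∷
   708723954350472825 ∷ 553610524955732857 ∷ 679416441976909433 ∷ 409328007683501689 ∷ 1105826563253563001 ∷ 694111140004228729 ∷ 704221458525580921 ∷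
   799946826452790905 ∷ 641194939603463801 ∷ 139450679622626937 ∷ []

 fourP : List ℕ
 fourP =
   440400930387676793 ∷ []

 clearQ : List ℕ
 clearQ =
   1155013761330983396200867429 ∷ 454082519832635787377044853 ∷ 577686920746921350798241461 ∷ 596727557774421027144526773 ∷
   768412238430683654785000949 ∷ 768527198539891743223834009 ∷ 1155013761334377450903693929 ∷ 907180647899445202369638249 ∷
   1063372370745895307067255209 ∷ 768224967089209166903764649 ∷ 768412238433233284557696489 ∷ 882051265478811626049628137 ∷
   896678113125765910288066397 ∷ 587063234767377402860006301 ∷ 531299172248210601156209277 ∷ 883005617909967890424655741 ∷ 768224967089156184186939069 ∷
   882051265478741257558091773 ∷ 531299172248280937470548582 ∷ 907180647899427800539389798 ∷ 1063372370745877905237006758 ∷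
   768412238433215882727448038 ∷ 1121160185929881012299225690 ∷ 887837779445418687224209242 ∷ 1073050916192808638839904666 ∷
   882165044974023798655145946 ∷ 887837779447107537084471162 ∷ 577686920764899979209203386 ∷ 896678113129969618437724014 ∷ 577686920774435529958219438 ∷
   587379415423769003303754478 ∷ 434754781200128697307879806 ∷ 763393986172893266737485438 ∷ 768527198539751022428542398 ∷ 768223786481983974701391614 ∷
   811939406189783848618728791 ∷ 762113041093986722600884055 ∷ 811708013690887749823798935 ∷ 529350976366271925566806743 ∷ 531245819724720979803282039 ∷
   907256204668514913038868343 ∷ 536307012544002587906251191 ∷ 767505544342960395743108599 ∷ 887869215076909741407901687 ∷ 502454617725955414664125803 ∷
   762185060645836073006372715 ∷ 502223225227059315869195947 ∷ 1061918103518313315181632427 ∷ 502454617731056514272958843 ∷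
   1148364674429678116816787067 ∷ 1062522566415260544820286907 ∷ 529350976355785952210689787 ∷ 1148364674442625965679352415 ∷
   838649674074934400085565279 ∷ 1121551923364930937354099103 ∷ 1119342079946688732425983647 ∷ 888473677985028231904271839 ∷
   433848087123718466833062255 ∷ 1148364674439213683687462511 ∷ 1072144222112915774003320239 ∷ 529350976365321502959705839 ∷ []

 openedQ : List ℕ
 openedQ =
   763321966591840871123975764 ∷ 1114154334446689932848027540 ∷ 766948739837051086533711716 ∷ 453931401961539854442258024 ∷
   536288345505280188274834856 ∷ 1114154334446636934009542568 ∷ 1062521385800490572416133608 ∷ 452718939204387088071483244 ∷
   1052343286478450711136393196 ∷ 1052254961070944045933112188 ∷ 588118685765968992419900241 ∷ 454082519860184738020322657 ∷
   454082519860290703453973833 ∷ 768224967087520317043502729 ∷ 768411057839062937377826105 ∷ 1121764648808761891503989881 ∷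
   1053708047735457628079908237 ∷ 587065595949633691882811181 ∷ 768714469888119568961301741 ∷ 882051265473622756052886509 ∷
   887228598996987329302093458 ∷ 1063125848458164605063715538 ∷ 588663897738015272965888482 ∷ 531299172243953878178650738 ∷
   454082519860290703520095558 ∷ 768412238434904732587709894 ∷ 1063125848458217587780541126 ∷ 596727557776953255086969766 ∷
   1205788650573146792582173814 ∷ 1073052096786118206107341174 ∷ 763393986175531476169121354 ∷ 763323147219453552415858202 ∷
   1053535906181885564343147086 ∷ 1053465067225807640589883934 ∷ 1205787469994473924037564574 ∷ 453175825784654545605531987 ∷
   907256204682307186831564643 ∷ 767505544356752669535804899 ∷ 845905580506313930138033587 ∷ 598331757976088917015435763 ∷
   1148364674440164074051244631 ∷ 529339388356450183758649895 ∷ 597783004223109308394413863 ∷ 838347442621789932137387111 ∷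
   1062163445214493652213995687 ∷ 1119285190193101270438285991 ∷ 762718684595414748121371931 ∷ 762487292096518649326441563 ∷
   502454617729367664412692827 ∷ 434531643758343007028997711 ∷ 883570677525498840317795727 ∷ 883268446070524817769602207 ∷ 495196350100918812689404831 ∷
   1148364674440058108617593471 ∷ []

 piercedQ : List ℕ
 piercedQ =
   763359300644268979532549753 ∷ 768157665352813478920658553 ∷ 763393986143619869225578105 ∷ 531245819710084297069346425 ∷ 763321966595991612678467193 ∷
   845528972842138239470792313 ∷ 531245819692105700903206521 ∷ 531299172233573902299164281 ∷ 763321966595956840055303801 ∷ 763393986143619883199884921 ∷
   453780288377732118256414329 ∷ 763321966595991580435148409 ∷ 531245819710118777619725945 ∷ 763321966595973661026283129 ∷ 763321966632018073103494777 ∷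
   877565456549565679438524025 ∷ 531245819710066498472492665 ∷ 763321966627692096948924025 ∷ 763321966622556225790668409 ∷
   1121160185923689609659543161 ∷ 763321966618299518868647545 ∷ 763393986125606501442514553 ∷ 500414554585208007880601209 ∷
   761545911338386277125320313 ∷ 577767192906679615403585145 ∷ 887274187787281238667554425 ∷ 916251193457706639053811321 ∷ 743979098141912130863492729 ∷
   597694678844858670979607417 ∷ 887225057190283922490519161 ∷ 596739145788463830567611257 ∷ 743956448998954129354649209 ∷ 453701192197943342417833593 ∷
   577993869740449090080599673 ∷ 837440747935248140185628281 ∷ 758482721542657749854711417 ∷ 792332639664008566205312633 ∷ 374686278136313046338367097 ∷
   144351504260717103637065337 ∷ []

 fourQ : List ℕ
 fourQ =
   895994455425935423476895353 ∷ []

 fillY : List ℕ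
 fillY =
   917871604 ∷ 515332824 ∷ 966618097 ∷ 460319077 ∷ 763082149 ∷ 963633637 ∷ 460254581 ∷ 467336473 ∷ 517667929 ∷ 463464793 ∷ 664790617 ∷ 970651033 ∷
   966779353 ∷ 668597801 ∷ 511408745 ∷ 763066025 ∷ 664661625 ∷ 964327353 ∷ 966650361 ∷ 517651805 ∷ 664774493 ∷ 460286829 ∷ 769244589 ∷ 460222333 ∷
   770031010 ∷ 515357014 ∷ 767014294 ∷ 770047142 ∷ 460315046 ∷ 460250550 ∷ 913233654 ∷ 515340890 ∷ 463460762 ∷ 664786586 ∷ 664657594 ∷ 968195002 ∷
   664770462 ∷ 770014894 ∷ 460282798 ∷ 460218302 ∷ 916298750 ∷ 468183367 ∷ 913939399 ∷ 468118871 ∷ 767010263 ∷ 669380199 ∷ 511416807 ∷ 511352311 ∷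
   465005403 ∷ 920311515 ∷ 668589739 ∷ 511400683 ∷ 511336187 ∷ 968190971 ∷ 468086623 ∷ 517643743 ∷ 668573615 ∷ 770010863 ∷ 920230895 ∷ []

 piercedY : List ℕ
 piercedY =
   464997337 ∷ 668540327 ∷ 964198297 ∷ 468869017 ∷ 457665383 ∷ 960326617 ∷ 349896409 ∷ 295693273 ∷ 94367449 ∷ 464997337 ∷ 513743830 ∷ 970522041 ∷
   921803749 ∷ 969763813 ∷ 960326617 ∷ 343653349 ∷ 295693273 ∷ 259759527 ∷ []

module LocalFlows where
 open import Defs
 open Gluing
 open HalfEdgeGraphs
 open Network
 open CutTable
 open ColourTable
 open Uncolourability using (&-intro; isVert)
 open FlowData
 open import Data.Nat using (ℕ; zero; suc; _∸_; _≡ᵇ_; _%_; _/_)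
 open import Data.Nat.Properties using (≡ᵇ⇒≡)
 open import Data.Bool using (Bool; true; false; not; T)
 open import Data.Fin using (Fin; zero; suc; toℕ)
 open import Data.List using (List; []; _∷_; _++_; map; filterᵇ)
 open import Data.Product using (Σ; _×_; _,_; proj₁)
 open import Data.Sum using (_⊎_; inj₁; inj₂; map₂)
 open import Data.Unit using (tt)
 open import Data.Empty using (⊥)
 open import Function using (_∘_)
 open import Relation.Binary.PropositionalEquality

 -- Colourings of single blocks with at most one zero inner edge.

 _or_ : Bool → Bool → Bool
 true or y = true
 false or y = y

 or-elim : ∀ {x y} → (x or y) ≡ true → x ≡ true ⊎ y ≡ true
 or-elim {true} e = inj₁ refl
 or-elim {false} e = inj₂ e

 ≡ᵇ-sound : ∀ {m n} → (m ≡ᵇ n) ≡ true → m ≡ n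
 ≡ᵇ-sound e = ≡ᵇ⇒≡ _ _ (subst T (sym e) tt)

 ≡ᵇ-refl : ∀ n → (n ≡ᵇ n) ≡ true
 ≡ᵇ-refl zero = refl
 ≡ᵇ-refl (suc n) = ≡ᵇ-refl n

 digit : ℕ → C
 digit 0 = c0
 digit 1 = c1
 digit 2 = c2
 digit _ = c3

 digits : ℕ → ℕ → List C
 digits zero n = []
 digits (suc k) n = digit (n % 4) ∷ digits k (n / 4)

 colour : List C → ℕ → C
 colour = nth c1

 -- A vertex on a zero edge is an end of that edge and will be removed, so nothing is asked of the
 -- other two colours there.
 fine : C → C → C → Bool
 fine x y z = proper x y z or not (nonzero x & nonzero y & nonzero z)

 fine-elim : ∀ (f : Fin 3 → C) → fine (f i0) (f i1) (f i2) ≡ true → proper (f i0) (f i1) (f i2) ≡ true ⊎ Σ (Fin 3) λ a → f a ≡ c0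
 fine-elim f e with or-elim {proper (f i0) (f i1) (f i2)} e
 ... | inj₁ p = inj₁ p
 ... | inj₂ p with f i0 in e₀ | f i1 in e₁ | f i2 in e₂
 ... | c0 | _ | _ = inj₂ (i0 , e₀)
 ... | c1 | c0 | _ = inj₂ (i1 , e₁)
 ... | c2 | c0 | _ = inj₂ (i1 , e₁)
 ... | c3 | c0 | _ = inj₂ (i1 , e₁)
 ... | c1 | c1 | c0 = inj₂ (i2 , e₂)
 ... | c1 | c2 | c0 = inj₂ (i2 , e₂)
 ... | c1 | c3 | c0 = inj₂ (i2 , e₂)
 ... | c2 | c1 | c0 = inj₂ (i2 , e₂)
 ... | c2 | c2 | c0 = inj₂ (i2 , e₂)
 ... | c2 | c3 | c0 = inj₂ (i2 , e₂)
 ... | c3 | c1 | c0 = inj₂ (i2 , e₂)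
 ... | c3 | c2 | c0 = inj₂ (i2 , e₂)
 ... | c3 | c3 | c0 = inj₂ (i2 , e₂)

 isOuter : {A : Set} → A ⊎ Fin 6 → Bool
 isOuter (inj₁ _) = false
 isOuter (inj₂ _) = true

 isOuter-sound : {A : Set} (x : A ⊎ Fin 6) → isOuter x ≡ true → Σ (Fin 6) λ p → x ≡ inj₂ p
 isOuter-sound (inj₂ p) e = p , refl

 -- A colouring of a block by edge labels, with prescribed port colours; inner edges coloured c0 have a label in Z.
 record Sol {real} (N : Net real) (q : C → C → C → Bool) (pc : Fin 6 → C) (Z : ℕ → Set) : Set where
   open Net N
   field
     f : ℕ → C
     ports : ∀ p → real p ≡ true → f (toℕ p) ≡ pc p
     fits : ∀ v → q (f (label v i0)) (f (label v i1)) (f (label v i2)) ≡ true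
     zeros : ∀ v a → f (label v a) ≡ c0 → Σ (Fin 6) (λ p → link v a ≡ inj₂ p) ⊎ Z (label v a)

 Sol-map : ∀ {real} {N : Net real} {q pc pc'} {Z Z' : ℕ → Set} → (∀ p → real p ≡ true → pc p ≡ pc' p) → (∀ l → Z l → Z' l) → Sol N q pc Z → Sol N q pc' Z'
 Sol-map e h s = record { f = f ; ports = λ p r → trans (ports p r) (e p r) ; fits = fits ; zeros = λ v a z → map₂ (h _) (zeros v a z) }
   where open Sol s

 same : ℕ → List C → List C → Bool
 same zero xs ys = true
 same (suc n) (x ∷ xs) (y ∷ ys) = eqC x y & same n xs ys
 same _ _ _ = false

 same-sound : ∀ n xs ys → same n xs ys ≡ true → ∀ (k : Fin n) → colour xs (toℕ k) ≡ colour ys (toℕ k)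
 same-sound (suc n) (x ∷ xs) (y ∷ ys) e zero = eqC-sound x y (&-fst e)
 same-sound (suc n) (x ∷ xs) (y ∷ ys) e (suc k) = same-sound n xs ys (&-snd {eqC x y} e) k

 module _ {real} (N : Net real) (q : C → C → C → Bool) (zok : ℕ → Bool) where
   open Net N
   okCorner : List C → Fin size → Fin 3 → Bool
   okCorner e v a = isOuter (link v a) or (zok (label v a) or nonzero (colour e (label v a)))

   okEntry : List C → Bool
   okEntry e = allFin? size λ v → q (colour e (label v i0)) (colour e (label v i1)) (colour e (label v i2)) & allFin? 3 (okCorner e v)

   entry-sol : ∀ e → okEntry e ≡ true → Sol N q (colour e ∘ toℕ) (λ l → zok l ≡ true)
   entry-sol e ok = record { f = colour e ; ports = λ p _ → refl ; fits = λ v → &-fst (here' v) ; zeros = z }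
     where
     test : Fin size → Bool
     test v = q (colour e (label v i0)) (colour e (label v i1)) (colour e (label v i2))
     here' : ∀ v → (test v & allFin? 3 (okCorner e v)) ≡ true
     here' v = allFin-sound size (λ v → test v & allFin? 3 (okCorner e v)) ok v
     z : ∀ v a → colour e (label v a) ≡ c0 → Σ (Fin 6) (λ p → link v a ≡ inj₂ p) ⊎ zok (label v a) ≡ true
     z v a c with or-elim {isOuter (link v a)} (allFin-sound 3 (okCorner e v) (&-snd {test v} (here' v)) a)
     ... | inj₁ o = inj₁ (isOuter-sound _ o)
     ... | inj₂ o with or-elim {zok (label v a)} o
     ... | inj₁ r = inj₂ r
     ... | inj₂ n rewrite c with n
     ... | ()

 allPairs? : ∀ m n → (Fin m → Fin n → Bool) → Bool
 allPairs? m n f = allFin? m λ i → allFin? n (f i)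

 allPairs-sound : ∀ m n f → allPairs? m n f ≡ true → ∀ i j → f i j ≡ true
 allPairs-sound m n f e i = allFin-sound n (f i) (allFin-sound m (λ i → allFin? n (f i)) e i)

 anyList : {A : Set} → (A → Bool) → List A → Bool
 anyList f [] = false
 anyList f (x ∷ xs) = f x or anyList f xs

 none : ℕ → Bool
 none _ = false

 record Fills {real} (N : Net real) (q : C → C → C → Bool) (L : List (List C)) : Set where
   constructor fills-by
   field fill : ∀ ps → anyList (λ e → same 6 e ps) L ≡ true → Sol N q (colour ps ∘ toℕ) (λ _ → ⊥)

 fills : ∀ {real} (N : Net real) q L → allList (okEntry N q none) L ≡ true → Fills N q L
 fills N q L ok = fills-by (go L ok)
   where
   go : ∀ L → allList (okEntry N q none) L ≡ true → ∀ ps → anyList (λ e → same 6 e ps) L ≡ true → Sol N q (colour ps ∘ toℕ) (λ _ → ⊥)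
   go (e ∷ L) ok ps h with or-elim {same 6 e ps} h
   ... | inj₁ s = Sol-map (λ p _ → same-sound 6 e ps s p) (λ l ()) (entry-sol N q none e (&-fst ok))
   ... | inj₂ h = go L (&-snd {okEntry N q none e} ok) ps h

 libP libQ libY clearP' clearQ' clearY' : List (List C)
 clearP' = map (digits 30) clearP
 clearQ' = map (digits 45) clearQ
 libP = map (digits 30) openedP ++ clearP'
 libQ = map (digits 45) openedQ ++ clearQ'
 libY = map (digits 15) fillY
 clearY' = filterᵇ (allList nonzero) libY

 fillsP : Fills netP fine libP
 fillsP = fills netP fine libP refl
 fillsQ : Fills netQ fine libQ
 fillsQ = fills netQ fine libQ refl
 fillsY : Fills netY fine libY
 fillsY = fills netY fine libY refl
 fillsP₄ : Fills netP distinct clearP'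
 fillsP₄ = fills netP distinct clearP' refl
 fillsQ₄ : Fills netQ distinct clearQ'
 fillsQ₄ = fills netQ distinct clearQ' refl
 fillsY₄ : Fills netY distinct clearY'
 fillsY₄ = fills netY distinct clearY' refl

 -- One inner edge, through the corner (v , a), may be coloured c0, for suitable port colours.
 shape : Bool → List C
 shape true = c1 ∷ c2 ∷ c3 ∷ c1 ∷ c2 ∷ c3 ∷ []
 shape false = c1 ∷ c2 ∷ c3 ∷ c1 ∷ c3 ∷ c2 ∷ []

 module _ {real} (N : Net real) where
   open Net N
   -- Both triples of a `shape` sum to zero, which no proper colouring of a slot permits, so an
   -- inner edge has to give way. With the two cut vertices put back, this is the criticality of the
   -- small snark at that edge; for every inner edge one of two orders of the second triple
   -- suffices.
   Pierces : Set
   Pierces = ∀ v a h → link v a ≡ inj₁ h → Σ Bool λ w → ∀ ps → same 6 (shape w) ps ≡ true → Sol N fine (colour ps ∘ toℕ) (_≡ label v a)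

   -- Zeros are recorded by label; this turns the label of a zero edge back into its two end
   -- vertices.
   Apart : Set
   Apart = ∀ v a h → link v a ≡ inj₁ h → ∀ v' a' → label v' a' ≡ label v a → v' ≡ v ⊎ v' ≡ proj₁ h

   ends : (Fin size × Fin 3) ⊎ Fin 6 → Fin size → Bool
   ends (inj₁ h) v' = eqFin v' (proj₁ h)
   ends (inj₂ _) v' = true

   sepAt : Fin size → Fin 3 → Fin size → Fin 3 → Bool
   sepAt v a v' a' = (label v' a' ≡ᵇ label v a) ⇒ (eqFin v' v or ends (link v a) v')

   labelsApart : Bool
   labelsApart = allPairs? size 3 λ v a → allPairs? size 3 (sepAt v a)

   apart : labelsApart ≡ true → Apart
   apart ok v a h e v' a' l = fin (or-elim {eqFin v' v} (⇒-mp {label v' a' ≡ᵇ label v a}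
       (allPairs-sound size 3 (sepAt v a) (allPairs-sound size 3 (λ v a → allPairs? size 3 (sepAt v a)) ok v a) v' a')
       (subst (λ z → (label v' a' ≡ᵇ z) ≡ true) l (≡ᵇ-refl (label v' a')))))
     where
     fin : eqFin v' v ≡ true ⊎ ends (link v a) v' ≡ true → v' ≡ v ⊎ v' ≡ proj₁ h
     fin (inj₁ r) = inj₁ (eqFin-sound v' v r)
     fin (inj₂ r) rewrite e = inj₂ (eqFin-sound v' (proj₁ h) r)

   module _ (entry : ℕ → List C) where
     okPierceAt : Fin size → Fin 3 → Bool
     okPierceAt v a = isOuter (link v a) or
       (okEntry N fine (_≡ᵇ label v a) (entry (label v a)) & (same 6 (entry (label v a)) (shape true) or same 6 (entry (label v a)) (shape false)))

     okPierce : Bool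
     okPierce = allPairs? size 3 okPierceAt

     pierce : okPierce ≡ true → Pierces
     pierce ok v a h e with or-elim {isOuter (link v a)} (allPairs-sound size 3 okPierceAt ok v a)
     ... | inj₁ o rewrite e with o
     ... | ()
     pierce ok v a h e | inj₂ o = sides (or-elim {same 6 E (shape true)} (&-snd {okEntry N fine (_≡ᵇ label v a) E} o))
       where
       E = entry (label v a)
       with-shape : ∀ w → same 6 E (shape w) ≡ true → ∀ ps → same 6 (shape w) ps ≡ true → Sol N fine (colour ps ∘ toℕ) (_≡ label v a)
       with-shape w s ps t = Sol-map (λ p _ → trans (same-sound 6 E (shape w) s p) (same-sound 6 (shape w) ps t p)) (λ l → ≡ᵇ-sound)
         (entry-sol N fine (_≡ᵇ label v a) E (&-fst o))
       sides : same 6 E (shape true) ≡ true ⊎ same 6 E (shape false) ≡ true → Σ Bool λ w → ∀ ps → same 6 (shape w) ps ≡ true → Sol N fine (colour ps ∘ toℕ) (_≡ label v a)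
       sides (inj₁ s) = true , with-shape true s
       sides (inj₂ s) = false , with-shape false s

 piercesP : Pierces netP
 piercesP = pierce netP (λ l → digits 30 (nth 0 piercedP (l ∸ 6))) refl
 piercesQ : Pierces netQ
 piercesQ = pierce netQ (λ l → digits 45 (nth 0 piercedQ (l ∸ 6))) refl
 apartP : Apart netP
 apartP = apart netP refl
 apartQ : Apart netQ
 apartQ = apart netQ refl
 apartY : Apart netY
 apartY = apart netY refl

module EdgeNames where
 open import Defs
 open Gluing
 open HalfEdgeGraphs
 open Network
 open CutTable
 open ColourTable
 open Uncolourability using (&-intro; isVert)
 open FlowData
 open import Data.Nat using (ℕ; zero; suc; _+_; _≤_; _<_; z≤n; s≤s; s≤s⁻¹; _<ᵇ_; _≡ᵇ_)
 open import Data.Bool using (Bool; true; false)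
 open import Data.Fin using (Fin; zero; suc; toℕ; fromℕ; inject₁; splitAt)
 open import Data.Fin.Properties using (toℕ-fromℕ; toℕ-inject₁; toℕ<n; splitAt-↑ˡ; splitAt-↑ʳ)
 open import Data.Fin.Relation.Unary.Top using (view; ‵fromℕ; ‵inject₁)
 open import Data.List using (List; []; _∷_; map)
 open import Data.Product using (Σ; _×_; _,_; proj₁; proj₂)
 open import Data.Sum using (_⊎_; inj₁; inj₂; [_,_]′)
 open import Data.Empty using (⊥; ⊥-elim)
 open import Function using (_∘_)
 open import Relation.Binary.PropositionalEquality

 open LocalFlows

 -- Names for edges that do not depend on the length of the chain.

 -- Edge names: 0 … 86 join ports of the fixed part, bases 87, 93, 90 start the three names of a junction of the chain:
 -- before, at and after the place where the colours change.
 name : Fin 45 → Fin 6 → ℕ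
 name i p = nth 99 (nth [] names (toℕ i)) (toℕ p)

 bs : Fin 3 → ℕ
 bs zero = 87
 bs (suc zero) = 93
 bs (suc (suc zero)) = 90

 -- Junctions up to t are of the first kind, junction t + 1 is the middle one and all later ones are
 -- of the last kind. Colours thus change only in the blocks t and t + 1; every other block has the
 -- same triple on both sides and may be repeated.
 seqR : ℕ → ℕ → Fin 3
 seqR zero zero = zero
 seqR zero (suc zero) = suc zero
 seqR zero (suc (suc _)) = suc (suc zero)
 seqR (suc t) zero = zero
 seqR (suc t) (suc j) = seqR t j

 seq-0 : ∀ t → seqR t 0 ≡ zero
 seq-0 zero = refl
 seq-0 (suc t) = refl

 seq-late : ∀ t j → suc (suc t) ≤ j → seqR t j ≡ suc (suc zero)
 seq-late zero (suc zero) (s≤s ())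
 seq-late zero (suc (suc j)) p = refl
 seq-late (suc t) (suc j) p = seq-late t j (s≤s⁻¹ p)

 seq-mid : ∀ t → seqR t (suc t) ≡ suc zero
 seq-mid zero = refl
 seq-mid (suc t) = seq-mid t

 Role : ℕ → ℕ → Fin 3 → Set
 Role t j r = (r ≡ zero × j ≤ t) ⊎ (r ≡ suc zero × j ≡ suc t) ⊎ (r ≡ suc (suc zero) × suc (suc t) ≤ j)

 role : ∀ t j → Role t j (seqR t j)
 role zero zero = inj₁ (refl , z≤n)
 role zero (suc zero) = inj₂ (inj₁ (refl , refl))
 role zero (suc (suc j)) = inj₂ (inj₂ (refl , s≤s (s≤s z≤n)))
 role (suc t) zero = inj₁ (refl , z≤n)
 role (suc t) (suc j) with role t j
 ... | inj₁ (e , p) = inj₁ (e , s≤s p)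
 ... | inj₂ (inj₁ (e , p)) = inj₂ (inj₁ (e , cong suc p))
 ... | inj₂ (inj₂ (e , p)) = inj₂ (inj₂ (e , s≤s p))

 along : (P : ℕ → Fin 3 → Fin 3 → Set) → ∀ t → (∀ j → j < t → P j zero zero) → P t zero (suc zero) → P (suc t) (suc zero) (suc (suc zero)) →
   (∀ j → suc t < j → P j (suc (suc zero)) (suc (suc zero))) → ∀ j → P j (seqR t j) (seqR t (suc j))
 along P zero pre p q post zero = p
 along P zero pre p q post (suc zero) = q
 along P zero pre p q post (suc (suc j)) = post (suc (suc j)) (s≤s (s≤s z≤n))
 along P (suc t) pre p q post zero = subst (P zero zero) (sym (seq-0 t)) (pre zero (s≤s z≤n))
 along P (suc t) pre p q post (suc j) = along (P ∘ suc) t (λ j → pre (suc j) ∘ s≤s) p q (λ j → post (suc j) ∘ s≤s) j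

 jn-apart : (allPairs? 3 3 λ r k → allPairs? 3 3 λ r' k' → (toℕ k + bs r ≡ᵇ toℕ k' + bs r') ⇒ (eqFin r r' & eqFin k k')) ≡ true
 jn-apart = refl

 jn-inj : ∀ r k r' k' → toℕ k + bs r ≡ toℕ k' + bs r' → r ≡ r' × k ≡ k'
 jn-inj r k r' k' e = eqFin-sound r r' (&-fst h) , eqFin-sound k k' (&-snd {eqFin r r'} h)
   where
   g : Fin 3 → Fin 3 → Fin 3 → Fin 3 → Bool
   g r k r' k' = (toℕ k + bs r ≡ᵇ toℕ k' + bs r') ⇒ (eqFin r r' & eqFin k k')
   h = ⇒-mp (allPairs-sound 3 3 (g r k) (allPairs-sound 3 3 (λ r k → allPairs? 3 3 (g r k)) jn-apart r k) r' k')
     (subst (λ z → (toℕ k + bs r ≡ᵇ z) ≡ true) e (≡ᵇ-refl (toℕ k + bs r)))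

 named-as : Code → ℕ → Bool
 named-as (fixed j q) n = name j q ≡ᵇ n
 named-as (first k) n = toℕ k + 87 ≡ᵇ n
 named-as (last k) n = toℕ k + 90 ≡ᵇ n

 ends-at : Fin 45 → Fin 6 → Fin 3 → Bool
 ends-at i p k = ((name i p ≡ᵇ toℕ k + 87) ⇒ eqCode (mateCode i p) (first k)) & ((name i p ≡ᵇ toℕ k + 90) ⇒ eqCode (mateCode i p) (last k))

 twin : Fin 45 → Fin 6 → Fin 45 → Fin 6 → Bool
 twin i p j q = realF j q ⇒ (name j q ≡ᵇ name i p) ⇒ ((eqFin j i & eqFin q p) or eqCode (mateCode i p) (fixed j q))

 okName : Fin 45 → Fin 6 → Bool
 okName i p = realF i p ⇒ (named-as (mateCode i p) (name i p) & (name i p <ᵇ 93) & allFin? 3 (ends-at i p) & allPairs? 45 6 (twin i p))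

 okNames : allPairs? 45 6 okName ≡ true
 okNames = refl

 module _ (i : Fin 45) (p : Fin 6) (r : realF i p ≡ true) where
   private
     ok : (named-as (mateCode i p) (name i p) & (name i p <ᵇ 93) & allFin? 3 (ends-at i p) & allPairs? 45 6 (twin i p)) ≡ true
     ok = ⇒-mp (allPairs-sound 45 6 okName okNames i p) r
     ok₁ = &-snd {named-as (mateCode i p) (name i p)} ok
     ok₂ = &-snd {name i p <ᵇ 93} ok₁

   name-mate : named-as (mateCode i p) (name i p) ≡ true
   name-mate = &-fst ok

   name-small : name i p < 93
   name-small = <ᵇ-true (name i p) 93 (&-fst ok₁)

   name-first : ∀ k → name i p ≡ toℕ k + 87 → mateCode i p ≡ first k
   name-first k e = eqCode-sound _ (first k) (⇒-mp (&-fst (allFin-sound 3 (ends-at i p) (&-fst ok₂) k)) (subst (λ z → (name i p ≡ᵇ z) ≡ true) e (≡ᵇ-refl (name i p))))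

   name-last : ∀ k → name i p ≡ toℕ k + 90 → mateCode i p ≡ last k
   name-last k e = eqCode-sound _ (last k) (⇒-mp (&-snd {(name i p ≡ᵇ toℕ k + 87) ⇒ eqCode (mateCode i p) (first k)} (allFin-sound 3 (ends-at i p) (&-fst ok₂) k))
     (subst (λ z → (name i p ≡ᵇ z) ≡ true) e (≡ᵇ-refl (name i p))))

   name-twin : ∀ j q → realF j q ≡ true → name j q ≡ name i p → (j ≡ i × q ≡ p) ⊎ mateCode i p ≡ fixed j q
   name-twin j q s e = cases (or-elim {eqFin j i & eqFin q p} (⇒-mp {name j q ≡ᵇ name i p} (⇒-mp {realF j q} (allPairs-sound 45 6 (twin i p) (&-snd {allFin? 3 (ends-at i p)} ok₂) j q) s)
     (subst (λ z → (name j q ≡ᵇ z) ≡ true) e (≡ᵇ-refl (name j q)))))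
     where
     cases : (eqFin j i & eqFin q p) ≡ true ⊎ eqCode (mateCode i p) (fixed j q) ≡ true → (j ≡ i × q ≡ p) ⊎ mateCode i p ≡ fixed j q
     cases (inj₁ h) = inj₁ (eqFin-sound j i (&-fst h) , eqFin-sound q p (&-snd {eqFin j i} h))
     cases (inj₂ h) = inj₂ (eqCode-sound _ (fixed j q) h)

 -- Lookup and `map` also commute past the end of the list as soon as the default name 99 has the
 -- default colour.
 colour-map : ∀ (kf : ℕ → C) → kf 99 ≡ c1 → ∀ ns k → colour (map kf ns) k ≡ kf (nth 99 ns k)
 colour-map kf e [] k = sym e
 colour-map kf e (n ∷ ns) zero = refl
 colour-map kf e (n ∷ ns) (suc k) = colour-map kf e ns k

 sides : (ℕ → C) → Fin 3 → Fin 3 → List C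
 sides kf r r' = kf (bs r) ∷ kf (1 + bs r) ∷ kf (2 + bs r) ∷ kf (bs r') ∷ kf (1 + bs r') ∷ kf (2 + bs r') ∷ []

 module _ (q : C → C → C → Bool) (LP LQ LY : List (List C)) where
   okKind : Kind → List C → Bool
   okKind vert ps = q (colour ps 0) (colour ps 1) (colour ps 2)
   okKind slot ps = anyList (λ e → same 6 e ps) LP & anyList (λ e → same 6 e ps) LQ

   okBlock : (ℕ → C) → ℕ → Fin 45 → Bool
   okBlock kf skip i = (toℕ i ≡ᵇ skip) or okKind (kindOf i) (map kf (nth [] names (toℕ i)))

   okBlocks : (ℕ → C) → ℕ → Bool
   okBlocks kf skip = allFin? 45 (okBlock kf skip)

   kind-sol : Fills netP q LP → Fills netQ q LQ → ∀ k β ps → okKind k ps ≡ true → Sol (netK k β) q (colour ps ∘ toℕ) (λ _ → ⊥)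
   kind-sol P Q vert β ps ok = record
     { f = colour ps ; ports = λ p _ → refl ; fits = λ { zero → ok }
     ; zeros = λ { zero zero _ → inj₁ (zero , refl) ; zero (suc zero) _ → inj₁ (suc zero , refl) ; zero (suc (suc zero)) _ → inj₁ (suc (suc zero) , refl) } }
   kind-sol P Q slot true ps ok = Fills.fill Q ps (&-snd {anyList (λ e → same 6 e ps) LP} ok)
   kind-sol P Q slot false ps ok = Fills.fill P ps (&-fst ok)

   okSides : (ℕ → C) → Fin 3 → Fin 3 → Bool
   okSides kf r r' = anyList (λ e → same 6 e (sides kf r r')) LY

 -- The chain has the blocks 0 to m + 1, so `t ≤ m` is what both changing blocks t and t + 1
 -- require.
 module Assemble (m : ℕ) (b : Fin 45 → Bool) (t : ℕ) (t≤m : t ≤ m) where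
   open Chain (suc m) b

   base : ℕ → ℕ
   base j = bs (seqR t j)

   pname : Port → ℕ
   pname (inj₁ i , p) = name i p
   pname (inj₂ j , p) = [ (λ k → toℕ k + base (toℕ j)) , (λ k → toℕ k + base (suc (toℕ j))) ]′ (splitAt 3 p)

   pname-lo : ∀ j k → pname (inj₂ j , lo k) ≡ toℕ k + base (toℕ j)
   pname-lo j k rewrite splitAt-↑ˡ 3 k 3 = refl

   pname-hi : ∀ j k → pname (inj₂ j , hi k) ≡ toℕ k + base (suc (toℕ j))
   pname-hi j k rewrite splitAt-↑ʳ 3 3 k = refl

   base-end : base (suc (toℕ (fromℕ (suc m)))) ≡ 90
   base-end = cong bs (seq-late t _ (s≤s (subst (suc t ≤_) (sym (toℕ-fromℕ (suc m))) (s≤s t≤m))))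

   mate-inj₁ : ∀ i p → realF i p ≡ true → pname (mate (inj₁ i , p)) ≡ name i p
   mate-inj₁ i p r = go (mateCode i p) (name-mate i p r)
     where
     go : ∀ c → named-as c (name i p) ≡ true → pname (decode c) ≡ name i p
     go (fixed j q) e = ≡ᵇ-sound e
     go (first k) e = trans (pname-lo zero k) (trans (cong (λ z → toℕ k + bs z) (seq-0 t)) (≡ᵇ-sound e))
     go (last k) e = trans (pname-hi (fromℕ (suc m)) k) (trans (cong (toℕ k +_) base-end) (≡ᵇ-sound e))

   pname-mate : ∀ x p → real x p ≡ true → pname (mate (x , p)) ≡ pname (x , p)
   pname-mate (inj₁ i) p r = mate-inj₁ i p r
   pname-mate (inj₂ j) p r = go j p (mate (inj₂ j , p)) refl
     where
     go : ∀ j p y → mate (inj₂ j , p) ≡ y → pname (mate (inj₂ j , p)) ≡ pname (inj₂ j , p)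
     go j p (inj₁ i , p') e = let (back , r') = mate-back (inj₂ j) p refl in
       trans (cong pname e) (trans (sym (mate-inj₁ i p' (subst (λ y → real (proj₁ y) (proj₂ y) ≡ true) e r')))
         (trans (cong (pname ∘ mate) (sym e)) (cong pname back)))
     go j p (inj₂ j' , p') e with splitAt 3 p in s
     go zero p (inj₂ j' , p') () | inj₁ k
     go (suc j₀) p (inj₂ j' , p') e | inj₁ k = trans (pname-hi (inject₁ j₀) k) (cong (λ z → toℕ k + base (suc z)) (toℕ-inject₁ j₀))
     go j p (inj₂ j' , p') e | inj₂ k with view j
     go j p (inj₂ j' , p') () | inj₂ k | ‵fromℕ
     ... | ‵inject₁ i = trans (pname-lo (suc i) k) (cong (λ z → toℕ k + base (suc z)) (sym (toℕ-inject₁ i)))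

   module Paint (q : C → C → C → Bool) (kf : ℕ → C) (Z : Blk → ℕ → Set) (sol : ∀ x → Sol (net x) q (λ p → kf (pname (x , p))) (Z x)) where
     F : H → C
     F ((x , v) , a) = Sol.f (sol x) (N.label x v a)

     F-port : ∀ x p → real x p ≡ true → F (vertexOf (x , p)) ≡ kf (pname (x , p))
     F-port x p r = trans (cong (Sol.f (sol x)) (proj₂ (proj₂ (N.link-port x _ _ p (N.port-link x p r))))) (Sol.ports (sol x) p r)

     F-opp : ∀ h → F (opp h) ≡ F h
     F-opp ((x , v) , a) with N.link x v a in e
     ... | inj₁ (w , c) = cong (Sol.f (sol x)) (sym (N.link-label x v a w c e))
     ... | inj₂ p = let (at , r , l) = N.link-port x v a p e; y = mate (x , p) in
       trans (F-port (proj₁ y) (proj₂ y) (proj₂ (mate-back x p r))) (trans (cong kf (pname-mate x p r))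
         (trans (sym (Sol.ports (sol x) p r)) (cong (Sol.f (sol x)) (sym l))))

     F-fits : ∀ v → q (F (v , i0)) (F (v , i1)) (F (v , i2)) ≡ true
     F-fits (x , v) = Sol.fits (sol x) v

     F-zero : ∀ x v a → F ((x , v) , a) ≡ c0 → Σ (Fin 6) (λ p → real x p ≡ true × vertexOf (x , p) ≡ ((x , v) , a) × kf (pname (x , p)) ≡ c0) ⊎ Z x (N.label x v a)
     F-zero x v a e with Sol.zeros (sol x) v a e
     ... | inj₂ z = inj₂ z
     ... | inj₁ (p , k) = let (at , r , l) = N.link-port x v a p k in
       inj₁ (p , r , cong (λ h → (x , proj₁ h) , proj₂ h) at , trans (sym (Sol.ports (sol x) p r)) (trans (cong (Sol.f (sol x)) (sym l)) e))

   module Blocks (q : C → C → C → Bool) (kf : ℕ → C) (kf99 : kf 99 ≡ c1) where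
     fixed-sol : ∀ LP LQ LY → Fills netP q LP → Fills netQ q LQ → ∀ skip → okBlocks q LP LQ LY kf skip ≡ true → ∀ i → (toℕ i ≡ skip → ⊥) →
       Sol (net (inj₁ i)) q (λ p → kf (pname (inj₁ i , p))) (λ _ → ⊥)
     fixed-sol LP LQ LY P Q skip ok i ne = cases (or-elim {toℕ i ≡ᵇ skip} (allFin-sound 45 (okBlock q LP LQ LY kf skip) ok i))
       where
       cases : (toℕ i ≡ᵇ skip) ≡ true ⊎ okKind q LP LQ LY (kindOf i) (map kf (nth [] names (toℕ i))) ≡ true → Sol (net (inj₁ i)) q (λ p → kf (pname (inj₁ i , p))) (λ _ → ⊥)
       cases (inj₁ e) = ⊥-elim (ne (≡ᵇ-sound e))
       cases (inj₂ e) = Sol-map (λ p _ → colour-map kf kf99 (nth [] names (toℕ i)) (toℕ p)) (λ l z → z)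
         (kind-sol q LP LQ LY P Q (kindOf i) (b i) (map kf (nth [] names (toℕ i))) e)

     chain-sol : ∀ (Zy : ℕ → ℕ → Set) → let S = λ j r r' → j ≤ suc m → Sol netY q (colour (sides kf r r') ∘ toℕ) (Zy j) in
       (∀ j → j < t → S j zero zero) → S t zero (suc zero) → S (suc t) (suc zero) (suc (suc zero)) → (∀ j → suc t < j → S j (suc (suc zero)) (suc (suc zero))) →
       ∀ j → Sol (net (inj₂ j)) q (λ p → kf (pname (inj₂ j , p))) (Zy (toℕ j))
     chain-sol Zy pre p p' post j = Sol-map ports (λ l z → z) (along (λ j r r' → j ≤ suc m → Sol netY q (colour (sides kf r r') ∘ toℕ) (Zy j)) t pre p p' post (toℕ j) (s≤s⁻¹ (toℕ<n j)))
       where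
       ports : ∀ p → all6 p ≡ true → colour (sides kf (seqR t (toℕ j)) (seqR t (suc (toℕ j)))) (toℕ p) ≡ kf (pname (inj₂ j , p))
       ports zero _ = refl
       ports (suc zero) _ = refl
       ports (suc (suc zero)) _ = refl
       ports (suc (suc (suc zero))) _ = refl
       ports (suc (suc (suc (suc zero)))) _ = refl
       ports (suc (suc (suc (suc (suc zero))))) _ = refl

module FlowChecks where
 open import Defs
 open Gluing
 open HalfEdgeGraphs
 open Network
 open CutTable
 open ColourTable
 open Uncolourability using (&-intro; isVert)
 open FlowData
 open import Data.Nat using (ℕ; zero; suc; _+_; _*_; _∸_; _<_; s≤s⁻¹; _<ᵇ_; _≡ᵇ_)
 open import Data.Bool using (Bool; true; false; not; if_then_else_)
 open import Data.Fin using (Fin; zero; suc; toℕ)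
 open import Data.List using (List; []; _∷_; map)
 open import Data.Product using (_×_; _,_)
 open import Data.Sum using (_⊎_; inj₁; inj₂)
 open import Data.Empty using (⊥; ⊥-elim)
 open import Function using (_∘_)
 open import Relation.Binary.PropositionalEquality

 open LocalFlows

 open EdgeNames
 open import Data.Nat.Properties using (m≤n⇒m<n∨m≡n)
 import Data.Fin as Fin

 -- Evaluation of the flow certificates.

 flowOf : List ℕ → ℕ → List C
 flowOf ls n = digits 96 (nth 0 ls n)

 nonzeroExcept : ℕ → ℕ → List C → Bool
 nonzeroExcept e i [] = true
 nonzeroExcept e i (x ∷ xs) = ((i ≡ᵇ e) or nonzero x) & nonzeroExcept e (suc i) xs

 nonzeroExcept-sound : ∀ e i xs → nonzeroExcept e i xs ≡ true → ∀ j → colour xs j ≡ c0 → j + i ≡ e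
 nonzeroExcept-sound e i (x ∷ xs) ok zero z with or-elim {i ≡ᵇ e} (&-fst ok)
 ... | inj₁ h = ≡ᵇ-sound h
 ... | inj₂ h rewrite z with h
 ... | ()
 nonzeroExcept-sound e i (x ∷ xs) ok (suc j) z = trans (sym (Data.Nat.Properties.+-suc j i)) (nonzeroExcept-sound e (suc i) xs (&-snd {(i ≡ᵇ e) or nonzero x} ok) j z)

 allBelow : ℕ → (ℕ → Bool) → Bool
 allBelow zero f = true
 allBelow (suc n) f = f n & allBelow n f

 allBelow-sound : ∀ n f → allBelow n f ≡ true → ∀ {j} → j < n → f j ≡ true
 allBelow-sound (suc n) f e p with m≤n⇒m<n∨m≡n (s≤s⁻¹ p)
 ... | inj₁ q = allBelow-sound n f (&-snd {f n} e) q
 ... | inj₂ refl = &-fst e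

 pattern first' = zero
 pattern mid = suc zero
 pattern last' = suc (suc zero)

 blocksOk : List C → ℕ → Bool
 blocksOk L skip = okBlocks fine libP libQ libY (colour L) skip

 sidesOk : List C → Fin 3 → Fin 3 → Bool
 sidesOk L = okSides fine libP libQ libY (colour L)

 sides-sol : ∀ L r r' → sidesOk L r r' ≡ true → Sol netY fine (colour (sides (colour L) r r') ∘ toℕ) (λ _ → ⊥)
 sides-sol L r r' e = Fills.fill fillsY (sides (colour L) r r') e

 inChain : ℕ → Bool
 inChain e = not (e <ᵇ 90) & (e <ᵇ 93)

 -- A zero on a name below 90 is placed with t = 0 and one on a tail name, 90 to 92, with t = m.
 -- Then the zero does not recur at other junctions, and the block type with that end repeated does
 -- not occur. The middle names 93 to 95 must work for every t and need both repeated types. The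
 -- skipped index 45 is no piece.
 okNamed : ℕ → List C → Bool
 okNamed e L = nonzeroExcept e 0 L & blocksOk L 45 & sidesOk L first' mid & sidesOk L mid last' & ((e <ᵇ 90) or sidesOk L first' first') & (inChain e or sidesOk L last' last')

 namedOk : allBelow 96 (λ e → okNamed e (flowOf namedFlows e)) ≡ true
 namedOk = refl

 record Named (e : ℕ) (L : List C) : Set where
   field
     only : nonzeroExcept e 0 L ≡ true
     blocks : blocksOk L 45 ≡ true
     fm : sidesOk L first' mid ≡ true
     ml : sidesOk L mid last' ≡ true
     ff : ((e <ᵇ 90) or sidesOk L first' first') ≡ true
     ll : (inChain e or sidesOk L last' last') ≡ true

 split-named : ∀ e L → okNamed e L ≡ true → Named e L
 split-named e L ok = record { only = &-fst ok ; blocks = &-fst r₁ ; fm = &-fst r₂ ; ml = &-fst r₃ ; ff = &-fst r₄ ; ll = &-snd {(e <ᵇ 90) or sidesOk L first' first'} r₄ }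
   where
   r₁ = &-snd {nonzeroExcept e 0 L} ok
   r₂ = &-snd {blocksOk L 45} r₁
   r₃ = &-snd {sidesOk L first' mid} r₂
   r₄ = &-snd {sidesOk L mid last'} r₃

 -- A zero inside the chain also sits at the movable place: in the initial block with t = 0, between
 -- first and middle colours, or in block j + 1 with t = j, between middle and last colours. Each
 -- position has one flow for each of the nine inner edges.
 chainIx : Bool → ℕ → ℕ
 chainIx false l = l ∸ 6
 chainIx true l = 9 + (l ∸ 6)

 okPos : Bool → List C → List C → Bool
 okPos false L E = same 6 E (sides (colour L) first' mid) & sidesOk L mid last'
 okPos true L E = same 6 E (sides (colour L) mid last') & sidesOk L first' mid & sidesOk L first' first'

 chainEntry : ℕ → List C
 chainEntry ix = digits 15 (nth 0 piercedY ix)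

 okChain' : Bool → ℕ → List C → List C → Bool
 okChain' w l L E = nonzeroExcept 96 0 L & blocksOk L 45 & okEntry netY fine (_≡ᵇ l) E & sidesOk L last' last' & okPos w L E

 okChain : Bool → Fin 8 → Fin 3 → Bool
 okChain w v a = isOuter (Net.link netY v a) or okChain' w (Net.label netY v a) (flowOf chainFlows (chainIx w (Net.label netY v a))) (chainEntry (chainIx w (Net.label netY v a)))

 chainOk₀ : allPairs? 8 3 (okChain false) ≡ true
 chainOk₀ = refl

 chainOk₁ : allPairs? 8 3 (okChain true) ≡ true
 chainOk₁ = refl

 chainOk : ∀ w v a → okChain w v a ≡ true
 chainOk false = allPairs-sound 8 3 (okChain false) chainOk₀
 chainOk true = allPairs-sound 8 3 (okChain true) chainOk₁

 slotsBefore : ℕ → List Kind → ℕ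
 slotsBefore zero ks = 0
 slotsBefore (suc n) [] = 0
 slotsBefore (suc n) (vert ∷ ks) = slotsBefore n ks
 slotsBefore (suc n) (slot ∷ ks) = suc (slotsBefore n ks)

 slotFlow : Fin 45 → Bool → List C
 slotFlow i w = flowOf slotFlows (slotsBefore (toℕ i) kinds * 2 + (if w then 0 else 1))

 -- The position 96 lies beyond all names, so no named edge is zero and the only zero is the one
 -- inside the slot left out of `blocksOk`.
 okSlot' : Fin 45 → Bool → List C → Bool
 okSlot' i w L = nonzeroExcept 96 0 L & same 6 (shape w) (map (colour L) (nth [] names (toℕ i))) & blocksOk L (toℕ i)
   & sidesOk L first' mid & sidesOk L mid last' & sidesOk L last' last'

 okSlot : Fin 45 → Bool
 okSlot i = isVert (kindOf i) or (okSlot' i true (slotFlow i true) & okSlot' i false (slotFlow i false))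

 slotsOk : allFin? 45 okSlot ≡ true
 slotsOk = refl

 no-inner : ∀ β v a h → Net.link (netK vert β) v a ≡ inj₁ h → ⊥
 no-inner β zero zero h ()
 no-inner β zero (suc zero) h ()
 no-inner β zero (suc (suc zero)) h ()

 apartK : ∀ k β → Apart (netK k β)
 apartK vert β v a h e = ⊥-elim (no-inner β v a h e)
 apartK slot true = apartQ
 apartK slot false = apartP

 piercesK : ∀ k β → Pierces (netK k β)
 piercesK vert β v a h e = ⊥-elim (no-inner β v a h e)
 piercesK slot true = piercesQ
 piercesK slot false = piercesP

 not-vert : ∀ k β v a h → Net.link (netK k β) v a ≡ inj₁ h → isVert k ≡ true → ⊥
 not-vert vert β v a h e _ = no-inner β v a h e

 all : ℕ → Bool
 all _ = true

 fourK : ∀ β → Sol (netK slot β) distinct (colour (shape true) ∘ toℕ) (λ l → all l ≡ true)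
 fourK true = Sol-map (λ p _ → same-sound 6 (digits 45 (nth 0 fourQ 0)) (shape true) refl p) (λ l z → z) (entry-sol netQ distinct all (digits 45 (nth 0 fourQ 0)) refl)
 fourK false = Sol-map (λ p _ → same-sound 6 (digits 30 (nth 0 fourP 0)) (shape true) refl p) (λ l z → z) (entry-sol netP distinct all (digits 30 (nth 0 fourP 0)) refl)

 -- This flow has nonzero colours everywhere outside piece 1, where its ports follow `shape true`.
 -- That slot is filled with `c0` as a genuine fourth colour, which gives a proper 4-edge-colouring
 -- of the whole graph.
 fourFlow : List C
 fourFlow = flowOf slotFlows 0

 fourBlocks : okBlocks distinct clearP' clearQ' clearY' (colour fourFlow) 1 ≡ true
 fourBlocks = refl

 fourSides : (okSides distinct clearP' clearQ' clearY' (colour fourFlow) first' mid & okSides distinct clearP' clearQ' clearY' (colour fourFlow) mid last'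
   & okSides distinct clearP' clearQ' clearY' (colour fourFlow) last' last') ≡ true
 fourSides = refl

 record SlotOk (i : Fin 45) (w : Bool) (L : List C) : Set where
   field
     only : nonzeroExcept 96 0 L ≡ true
     meets : same 6 (shape w) (map (colour L) (nth [] names (toℕ i))) ≡ true
     blocks : blocksOk L (toℕ i) ≡ true
     fm : sidesOk L first' mid ≡ true
     ml : sidesOk L mid last' ≡ true
     ll : sidesOk L last' last' ≡ true

 split-slot : ∀ i w L → okSlot' i w L ≡ true → SlotOk i w L
 split-slot i w L ok = record { only = &-fst ok ; meets = &-fst r₁ ; blocks = &-fst r₂ ; fm = &-fst r₃ ; ml = &-fst r₄ ; ll = &-snd {sidesOk L mid last'} r₄ }
   where
   r₁ = &-snd {nonzeroExcept 96 0 L} ok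
   r₂ = &-snd {same 6 (shape w) (map (colour L) (nth [] names (toℕ i)))} r₁
   r₃ = &-snd {blocksOk L (toℕ i)} r₂
   r₄ = &-snd {sidesOk L first' mid} r₃

 record ChainOk (w : Bool) (l : ℕ) (L E : List C) : Set where
   field
     only : nonzeroExcept 96 0 L ≡ true
     blocks : blocksOk L 45 ≡ true
     entry : okEntry netY fine (_≡ᵇ l) E ≡ true
     ll : sidesOk L last' last' ≡ true
     pos : okPos w L E ≡ true

 split-chain : ∀ w l L E → okChain' w l L E ≡ true → ChainOk w l L E
 split-chain w l L E ok = record { only = &-fst ok ; blocks = &-fst r₁ ; entry = &-fst r₂ ; ll = &-fst r₃ ; pos = &-snd {sidesOk L last' last'} r₃ }
   where
   r₁ = &-snd {nonzeroExcept 96 0 L} ok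
   r₂ = &-snd {blocksOk L 45} r₁
   r₃ = &-snd {okEntry netY fine (_≡ᵇ l) E} r₂

 split-pos₀ : ∀ L E → okPos false L E ≡ true → same 6 E (sides (colour L) first' mid) ≡ true × sidesOk L mid last' ≡ true
 split-pos₀ L E e = &-fst e , &-snd {same 6 E (sides (colour L) first' mid)} e

 split-pos₁ : ∀ L E → okPos true L E ≡ true → same 6 E (sides (colour L) mid last') ≡ true × sidesOk L first' mid ≡ true × sidesOk L first' first' ≡ true
 split-pos₁ L E e = &-fst e , &-fst r , &-snd {sidesOk L first' mid} r
   where r = &-snd {same 6 E (sides (colour L) mid last')} e

 slot-ok : ∀ i w → (isVert (kindOf i) ≡ true → ⊥) → SlotOk i w (slotFlow i w)
 slot-ok i w nv = pick w (or-elim {isVert (kindOf i)} (allFin-sound 45 okSlot slotsOk i))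
   where
   pick : ∀ w → isVert (kindOf i) ≡ true ⊎ (okSlot' i true (slotFlow i true) & okSlot' i false (slotFlow i false)) ≡ true → SlotOk i w (slotFlow i w)
   pick w (inj₁ r) = ⊥-elim (nv r)
   pick true (inj₂ r) = split-slot i true (slotFlow i true) (&-fst {okSlot' i true (slotFlow i true)} {okSlot' i false (slotFlow i false)} r)
   pick false (inj₂ r) = split-slot i false (slotFlow i false) (&-snd {okSlot' i true (slotFlow i true)} {okSlot' i false (slotFlow i false)} r)

 or-chain : ∀ w l o L E → (o or okChain' w l L E) ≡ true → (o ≡ true → ⊥) → ChainOk w l L E
 or-chain w l true L E e n = ⊥-elim (n refl)
 or-chain w l false L E e n = split-chain w l L E e

 inner-not-outer : {A : Set} {x : A ⊎ Fin 6} {h : A} → x ≡ inj₁ h → isOuter x ≡ true → ⊥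
 inner-not-outer refl ()

 chain-ok : ∀ w v a h → Net.link netY v a ≡ inj₁ h → let l = Net.label netY v a in ChainOk w l (flowOf chainFlows (chainIx w l)) (chainEntry (chainIx w l))
 chain-ok w v a h e = or-chain w (Net.label netY v a) (isOuter (Net.link netY v a)) (flowOf chainFlows (chainIx w (Net.label netY v a))) (chainEntry (chainIx w (Net.label netY v a)))
   (chainOk w v a) (inner-not-outer e)

module Flows where
 open import Defs
 open Gluing
 open HalfEdgeGraphs
 open Network
 open CutTable
 open ColourTable
 open Uncolourability using (&-intro; isVert)
 open FlowData
 open import Data.Nat using (ℕ; zero; suc; _+_; _*_; _≤_; _<_; z≤n; s≤s⁻¹; _<ᵇ_; _≡ᵇ_)
 open import Data.Nat.Properties using (≤-refl; ≤-trans; <⇒≱; suc-injective)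
 open import Data.Bool using (Bool; true; false; if_then_else_)
 open import Data.Fin using (Fin; zero; suc; toℕ; fromℕ; splitAt)
 open import Data.Fin.Properties using (toℕ-injective; toℕ-fromℕ; toℕ-inject₁; toℕ<n; splitAt⁻¹-↑ˡ; splitAt⁻¹-↑ʳ)
 open import Data.Fin.Relation.Unary.Top using (view; ‵fromℕ; ‵inject₁)
 open import Data.List using (List; []; map)
 open import Data.Product using (Σ; _×_; _,_; proj₁; proj₂)
 open import Data.Sum using (_⊎_; inj₁; inj₂; [_,_]′)
 open import Data.Unit using (⊤; tt)
 open import Data.Empty using (⊥; ⊥-elim)
 open import Function using (_∘_; case_of_)
 open import Relation.Binary.PropositionalEquality

 open LocalFlows
 open EdgeNames
 open FlowChecks
 open import Data.Nat.Properties using (m≤n+m; m≤m+n; <-irrefl; ≤-antisym; n≤0⇒n≡0)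
 import Data.Fin as Fin
 open import Relation.Nullary using (Dec; yes; no)

 -- A flow with a single zero edge for every edge of the graph.

 k+87<90 : ∀ (k : Fin 3) → (toℕ k + 87 <ᵇ 90) ≡ true
 k+87<90 zero = refl
 k+87<90 (suc zero) = refl
 k+87<90 (suc (suc zero)) = refl

 k+90≮90 : ∀ (k : Fin 3) → (toℕ k + 90 <ᵇ 90) ≡ false
 k+90≮90 zero = refl
 k+90≮90 (suc zero) = refl
 k+90≮90 (suc (suc zero)) = refl

 low-inChain : ∀ {e} → (e <ᵇ 90) ≡ true → inChain e ≡ true → ⊥
 low-inChain {e} p q with e <ᵇ 90
 low-inChain {e} p () | true
 low-inChain {e} () q | false

 k+93<96 : ∀ (k : Fin 3) → toℕ k + 93 < 96
 k+93<96 k = <ᵇ-true (toℕ k + 93) 96 (go k)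
   where
   go : ∀ (k : Fin 3) → (toℕ k + 93 <ᵇ 96) ≡ true
   go zero = refl
   go (suc zero) = refl
   go (suc (suc zero)) = refl

 k+93≮90 : ∀ (k : Fin 3) → (toℕ k + 93 <ᵇ 90) ≡ false × inChain (toℕ k + 93) ≡ false
 k+93≮90 zero = refl , refl
 k+93≮90 (suc zero) = refl , refl
 k+93≮90 (suc (suc zero)) = refl , refl

 kf99 : List C → Set
 kf99 L = colour L 99 ≡ c1

 module Final (m : ℕ) (b : Fin 45 → Bool) where
   open Chain (suc m) b

   GoodAt : (C → C → C → Bool) → H → Set
   GoodAt q h = Σ (H → C) λ F → (∀ h → F (opp h) ≡ F h) × (∀ w → w ≢ proj₁ h → w ≢ proj₁ (opp h) → q (F (w , i0)) (F (w , i1)) (F (w , i2)) ≡ true)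

   flip : ∀ {h} → GoodAt proper (opp h) → GoodAt proper h
   flip {h} (F , con , ok) = F , con , λ w p q → ok w q λ r → p (trans r (cong proj₁ (opp-inv h)))

   module _ (t : ℕ) (t≤m : t ≤ m) where
     open Assemble m b t t≤m

     module _ (kf : ℕ → C) (Z : Blk → ℕ → Set) (sol : ∀ x → Sol (net x) fine (λ p → kf (pname (x , p))) (Z x)) where
       open Paint fine kf Z sol

       -- At a vertex without zero edges `fine` can only hold by properness, so it is enough to
       -- locate all zeros at the two ends of `h`.
       conclude : ∀ h → (∀ x v a → F ((x , v) , a) ≡ c0 → (x , v) ≡ proj₁ h ⊎ (x , v) ≡ proj₁ (opp h)) → GoodAt proper h
       conclude h loc = F , F-opp , ok
         where
         ok : ∀ w → w ≢ proj₁ h → w ≢ proj₁ (opp h) → proper (F (w , i0)) (F (w , i1)) (F (w , i2)) ≡ true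
         ok w p q = pick (fine-elim (λ a → F (w , a)) (F-fits w))
           where
           pick : proper (F (w , i0)) (F (w , i1)) (F (w , i2)) ≡ true ⊎ Σ (Fin 3) (λ a → F (w , a) ≡ c0) → proper (F (w , i0)) (F (w , i1)) (F (w , i2)) ≡ true
           pick (inj₁ e) = e
           pick (inj₂ (a , z)) = ⊥-elim ([ p , q ]′ (loc (proj₁ w) (proj₂ w) a z))

       -- No port carries a zero, so every zero is inner and has the one label allowed; `Apart` then
       -- places it at the two ends of the edge.
       inner-good : ∀ x v a h → N.link x v a ≡ inj₁ h → Apart (net x) → (∀ j → kf j ≢ c0) → (∀ y l → Z y l → y ≡ x × l ≡ N.label x v a) → GoodAt proper ((x , v) , a)
       inner-good x v a h e ap nz only = conclude ((x , v) , a) loc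
         where
         loc : ∀ y v' a' → F ((y , v') , a') ≡ c0 → (y , v') ≡ (x , v) ⊎ (y , v') ≡ proj₁ (opp ((x , v) , a))
         loc y v' a' z with F-zero y v' a' z
         ... | inj₁ (_ , _ , _ , z') = ⊥-elim (nz _ z')
         ... | inj₂ z' with only y _ z'
         ... | refl , l with ap v a h e v' a' l
         ... | inj₁ r = inj₁ (cong (x ,_) r)
         ... | inj₂ r = inj₂ (trans (cong (x ,_) r) (sym (cong (proj₁ ∘ cross x) e)))

     named-good : ∀ {e} → e < 96 → ((e <ᵇ 90) ≡ true → t ≡ 0) → (inChain e ≡ true → t ≡ m) →
       ∀ x₀ → real (proj₁ x₀) (proj₂ x₀) ≡ true → (∀ y → real (proj₁ y) (proj₂ y) ≡ true → pname y ≡ e → y ≡ x₀ ⊎ y ≡ mate x₀) → GoodAt proper (vertexOf x₀)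
     named-good {e} e<96 low high x₀ r uniq = conclude kf (λ _ _ → ⊥) sol (vertexOf x₀) loc
       where
       L = flowOf namedFlows e
       kf = colour L
       open Named (split-named e L (allBelow-sound 96 (λ e → okNamed e (flowOf namedFlows e)) namedOk e<96))
       open Blocks fine kf refl
       S : ℕ → Fin 3 → Fin 3 → Set
       S j r r' = j ≤ suc m → Sol netY fine (colour (sides kf r r') ∘ toℕ) (λ _ → ⊥)
       pre : ∀ j → j < t → S j zero zero
       pre j j<t _ = [ (λ p → ⊥-elim (<⇒≱ (subst (j <_) (low p) j<t) z≤n)) , sides-sol L zero zero ]′ (or-elim {e <ᵇ 90} ff)
       post : ∀ j → suc t < j → S j last' last'
       post j t<j j≤ = [ (λ p → ⊥-elim (<⇒≱ (subst (λ t → suc t < j) (high p) t<j) j≤)) , sides-sol L last' last' ]′ (or-elim {inChain e} ll)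
       sol : ∀ x → Sol (net x) fine (λ p → kf (pname (x , p))) (λ _ → ⊥)
       sol (inj₁ i) = fixed-sol libP libQ libY fillsP fillsQ 45 blocks i (λ q → <-irrefl q (toℕ<n i))
       sol (inj₂ j) = chain-sol (λ _ _ → ⊥) pre (λ _ → sides-sol L zero (suc zero) fm) (λ _ → sides-sol L (suc zero) last' ml) post j
       open Paint fine kf (λ _ _ → ⊥) sol
       loc : ∀ x v a → F ((x , v) , a) ≡ c0 → (x , v) ≡ proj₁ (vertexOf x₀) ⊎ (x , v) ≡ proj₁ (opp (vertexOf x₀))
       loc x v a z = [ port , (λ ()) ]′ (F-zero x v a z)
         where
         port : Σ (Fin 6) (λ p → real x p ≡ true × vertexOf (x , p) ≡ ((x , v) , a) × kf (pname (x , p)) ≡ c0) → (x , v) ≡ proj₁ (vertexOf x₀) ⊎ (x , v) ≡ proj₁ (opp (vertexOf x₀))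
         port (p , r' , at' , z') = [ (λ q → inj₁ (trans (cong proj₁ (sym at')) (cong (proj₁ ∘ vertexOf) q)))
           , (λ q → inj₂ (trans (cong proj₁ (sym at')) (trans (cong (proj₁ ∘ vertexOf) q) (cong proj₁ (sym (opp-port (proj₁ x₀) (proj₂ x₀) r)))))) ]′
           (uniq (x , p) r' (trans (sym (Data.Nat.Properties.+-identityʳ (pname (x , p)))) (nonzeroExcept-sound e 0 L only (pname (x , p)) z')))

     -- Names 87 to 89 belong to all junctions up to t and names 90 to 92 to all junctions from t +
     -- 2 on. With t = 0 and t = m respectively, only the junction at the end of the chain remains.
     uniq-fixed : ∀ i p → realF i p ≡ true → ((name i p <ᵇ 90) ≡ true → t ≡ 0) → ((name i p <ᵇ 90) ≡ false → t ≡ m) →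
       ∀ y → real (proj₁ y) (proj₂ y) ≡ true → pname y ≡ name i p → y ≡ (inj₁ i , p) ⊎ y ≡ mate (inj₁ i , p)
     uniq-fixed i p r low high (inj₁ j , q) s e = twins (name-twin i p r j q s e)
       where
       twins : (j ≡ i × q ≡ p) ⊎ mateCode i p ≡ fixed j q → _≡_ {A = Port} (inj₁ j , q) (inj₁ i , p) ⊎ (inj₁ j , q) ≡ mate (inj₁ i , p)
       twins (inj₁ (refl , refl)) = inj₁ refl
       twins (inj₂ c) = inj₂ (sym (cong decode c))
     uniq-fixed i p r low high (inj₂ j , q) s e with splitAt 3 q in w
     ... | inj₁ k with seqR t (toℕ j) | role t (toℕ j)
     ... | _ | inj₁ (refl , j≤t) = inj₂ (trans (cong₂ _,_ (cong inj₂ j≡0) (sym (splitAt⁻¹-↑ˡ w))) (sym (cong decode (name-first i p r k (sym e)))))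
       where
       j≡0 : j ≡ zero
       j≡0 = toℕ-injective (n≤0⇒n≡0 (subst (toℕ j ≤_) (low (subst (λ n → (n <ᵇ 90) ≡ true) e (k+87<90 k))) j≤t))
     ... | _ | inj₂ (inj₁ (refl , _)) = ⊥-elim (<⇒≱ (name-small i p r) (subst (93 ≤_) e (m≤n+m 93 (toℕ k))))
     ... | _ | inj₂ (inj₂ (refl , t<j)) = ⊥-elim (<⇒≱ (toℕ<n j) (subst (λ t → suc (suc t) ≤ toℕ j) (high (subst (λ n → (n <ᵇ 90) ≡ false) e (k+90≮90 k))) t<j))
     uniq-fixed i p r low high (inj₂ j , q) s e | inj₂ k with seqR t (suc (toℕ j)) | role t (suc (toℕ j))
     ... | _ | inj₁ (refl , j≤t) = ⊥-elim (<⇒≱ (subst (suc (toℕ j) ≤_) (low (subst (λ n → (n <ᵇ 90) ≡ true) e (k+87<90 k))) j≤t) z≤n)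
     ... | _ | inj₂ (inj₁ (refl , _)) = ⊥-elim (<⇒≱ (name-small i p r) (subst (93 ≤_) e (m≤n+m 93 (toℕ k))))
     ... | _ | inj₂ (inj₂ (refl , t<j)) = inj₂ (trans (cong₂ _,_ (cong inj₂ j≡m) (sym (splitAt⁻¹-↑ʳ w))) (sym (cong decode (name-last i p r k (sym e)))))
       where
       j≡m : j ≡ fromℕ (suc m)
       j≡m = toℕ-injective (trans (≤-antisym (s≤s⁻¹ (toℕ<n j))
         (s≤s⁻¹ (subst (λ t → suc (suc t) ≤ suc (toℕ j)) (high (subst (λ n → (n <ᵇ 90) ≡ false) e (k+90≮90 k))) t<j))) (sym (toℕ-fromℕ (suc m))))

   fixed-good : ∀ i p → realF i p ≡ true → GoodAt proper (vertexOf (inj₁ i , p))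
   fixed-good i p r = go (name i p <ᵇ 90) refl
     where
     e<96 : name i p < 96
     e<96 = ≤-trans (name-small i p r) (m≤m+n 93 3)
     go : ∀ c → (name i p <ᵇ 90) ≡ c → GoodAt proper (vertexOf (inj₁ i , p))
     go true c = named-good 0 z≤n e<96 (λ _ → refl) (λ h → ⊥-elim (low-inChain {name i p} c h)) (inj₁ i , p) r
       (uniq-fixed 0 z≤n i p r (λ _ → refl) (λ d → case trans (sym c) d of λ ()))
     go false c = named-good m ≤-refl e<96 (λ d → case trans (sym c) d of λ ()) (λ _ → refl) (inj₁ i , p) r
       (uniq-fixed m ≤-refl i p r (λ d → case trans (sym c) d of λ ()) (λ _ → refl))

   -- Taking for t the index of the preceding block makes this junction the middle one, and the
   -- middle names occur at no other place.
   junction-good : ∀ j' k₀ → GoodAt proper (vertexOf (inj₂ (suc j') , lo k₀))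
   junction-good j' k₀ = named-good t t≤m (k+93<96 k₀) (λ h → case trans (sym h) (proj₁ (k+93≮90 k₀)) of λ ()) (λ h → case trans (sym h) (proj₂ (k+93≮90 k₀)) of λ ())
       (inj₂ (suc j') , lo k₀) refl uniq
     where
     t = toℕ j'
     t≤m : t ≤ m
     t≤m = s≤s⁻¹ (toℕ<n j')
     open Assemble m b t t≤m
     is-mid : ∀ j r → Role t j r → r ≡ mid → j ≡ suc t
     is-mid j r (inj₁ (refl , _)) ()
     is-mid j r (inj₂ (inj₁ (_ , p))) _ = p
     is-mid j r (inj₂ (inj₂ (refl , _))) ()
     uniq : ∀ y → real (proj₁ y) (proj₂ y) ≡ true → pname y ≡ toℕ k₀ + 93 → y ≡ (inj₂ (suc j') , lo k₀) ⊎ y ≡ mate (inj₂ (suc j') , lo k₀)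
     uniq (inj₁ i , p) r e = ⊥-elim (<⇒≱ (name-small i p r) (subst (93 ≤_) (sym e) (m≤n+m 93 (toℕ k₀))))
     uniq (inj₂ j , q) r e with splitAt 3 q in w
     ... | inj₁ k = let (p , k≡) = jn-inj (seqR t (toℕ j)) k mid k₀ e in
       inj₁ (cong₂ _,_ (cong inj₂ (toℕ-injective (is-mid (toℕ j) (seqR t (toℕ j)) (role t (toℕ j)) p))) (trans (sym (splitAt⁻¹-↑ˡ w)) (cong lo k≡)))
     ... | inj₂ k = let (p , k≡) = jn-inj (seqR t (suc (toℕ j))) k mid k₀ e in
       inj₂ (trans (cong₂ _,_ (cong inj₂ (toℕ-injective (trans (suc-injective (is-mid (suc (toℕ j)) (seqR t (suc (toℕ j))) (role t (suc (toℕ j))) p)) (sym (toℕ-inject₁ j')))))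
         (trans (sym (splitAt⁻¹-↑ʳ w)) (cong hi k≡))) (sym (mate-lo (suc j') k₀)))

   real-ends : ∀ k → realF (proj₁ (headPort k)) (proj₂ (headPort k)) ≡ true × realF (proj₁ (tailPort k)) (proj₂ (tailPort k)) ≡ true
   real-ends zero = refl , refl
   real-ends (suc zero) = refl , refl
   real-ends (suc (suc zero)) = refl , refl

   opp-lo : ∀ j k → opp (vertexOf (inj₂ j , lo k)) ≡ vertexOf (before j k)
   opp-lo j k = trans (opp-port (inj₂ j) (lo k) refl) (cong vertexOf (mate-lo j k))

   opp-hi : ∀ j k → opp (vertexOf (inj₂ j , hi k)) ≡ vertexOf (after j k)
   opp-hi j k = trans (opp-port (inj₂ j) (hi k) refl) (cong vertexOf (mate-hi j k))

   lo-good : ∀ j k → GoodAt proper (vertexOf (inj₂ j , lo k))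
   lo-good zero k = flip {vertexOf (inj₂ zero , lo k)} (subst (GoodAt proper) (sym (opp-lo zero k)) (fixed-good (proj₁ (headPort k)) (proj₂ (headPort k)) (proj₁ (real-ends k))))
   lo-good (suc j) k = junction-good j k

   after-good : ∀ j k → GoodAt proper (vertexOf (after j k))
   after-good j k with view j
   ... | ‵fromℕ = fixed-good (proj₁ (tailPort k)) (proj₂ (tailPort k)) (proj₂ (real-ends k))
   ... | ‵inject₁ i = junction-good i k

   hi-good : ∀ j k → GoodAt proper (vertexOf (inj₂ j , hi k))
   hi-good j k = flip {vertexOf (inj₂ j , hi k)} (subst (GoodAt proper) (sym (opp-hi j k)) (after-good j k))

   port-good : ∀ x p → real x p ≡ true → GoodAt proper (vertexOf (x , p))
   port-good (inj₁ i) p r = fixed-good i p r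
   port-good (inj₂ j) p r = go (splitAt 3 p) refl
     where
     go : ∀ s → splitAt 3 p ≡ s → GoodAt proper (vertexOf (inj₂ j , p))
     move : ∀ p' → p' ≡ p → GoodAt proper (vertexOf (inj₂ j , p')) → GoodAt proper (vertexOf (inj₂ j , p))
     move p' refl g = g
     go (inj₁ k) w = move (lo k) (splitAt⁻¹-↑ˡ w) (lo-good j k)
     go (inj₂ k) w = move (hi k) (splitAt⁻¹-↑ʳ w) (hi-good j k)

   -- The one position excepted from the check is 96, past the 96 digits of the flow, where lookup
   -- returns the nonzero default `c1`.
   nonzero-all : ∀ ls n → nonzeroExcept 96 0 (flowOf ls n) ≡ true → ∀ j → colour (flowOf ls n) j ≢ c0
   nonzero-all ls n ok j z = past (trans (sym (Data.Nat.Properties.+-identityʳ j)) (nonzeroExcept-sound 96 0 (flowOf ls n) ok j z)) z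
     where
     past : ∀ {j} → j ≡ 96 → colour (flowOf ls n) j ≢ c0
     past refl ()

   slot-at : ∀ i v a h → N.link (inj₁ i) v a ≡ inj₁ h → ∀ w L → SlotOk i w L → kf99 L → (∀ j → colour L j ≢ c0) →
     (∀ ps → same 6 (shape w) ps ≡ true → Sol (net (inj₁ i)) fine (colour ps ∘ toℕ) (_≡ N.label (inj₁ i) v a)) → GoodAt proper ((inj₁ i , v) , a)
   slot-at i v a h e w L ok k99 nz pierced = inner-good 0 z≤n (colour L) Z sol (inj₁ i) v a h e (apartK (kindOf i) (b i)) nz (λ y l z → z)
     where
     open SlotOk ok
     Z : Blk → ℕ → Set
     Z y l = y ≡ inj₁ i × l ≡ N.label (inj₁ i) v a
     open Assemble m b 0 z≤n
     open Blocks fine (colour L) k99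
     fixedᵢ : ∀ j → Dec (j ≡ i) → Sol (net (inj₁ j)) fine (λ p → colour L (name j p)) (Z (inj₁ j))
     fixedᵢ j (yes refl) = Sol-map (λ p _ → colour-map (colour L) k99 (nth [] names (toℕ i)) (toℕ p)) (λ l z → refl , z)
       (pierced (map (colour L) (nth [] names (toℕ i))) meets)
     fixedᵢ j (no ne) = Sol-map (λ _ _ → refl) (λ l ()) (fixed-sol libP libQ libY fillsP fillsQ (toℕ i) blocks j (ne ∘ toℕ-injective))
     sol : ∀ x → Sol (net x) fine (λ p → colour L (pname (x , p))) (Z x)
     sol (inj₁ j) = fixedᵢ j (j Fin.≟ i)
     sol (inj₂ j) = Sol-map (λ _ _ → refl) (λ l ()) (chain-sol (λ _ _ → ⊥) (λ j ()) (λ _ → sides-sol L first' mid fm)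
       (λ _ → sides-sol L mid last' ml) (λ _ _ _ → sides-sol L last' last' ll) j)

   slot-good : ∀ i v a h → N.link (inj₁ i) v a ≡ inj₁ h → GoodAt proper ((inj₁ i , v) , a)
   slot-good i v a h e = slot-at i v a h e (proj₁ pierced) (slotFlow i (proj₁ pierced)) ok refl (nonzero-all slotFlows (slotsBefore (toℕ i) kinds * 2 + (if proj₁ pierced then 0 else 1)) (SlotOk.only ok)) (proj₂ pierced)
     where
     pierced = piercesK (kindOf i) (b i) v a h e
     ok : SlotOk i (proj₁ pierced) (slotFlow i (proj₁ pierced))
     ok = slot-ok i (proj₁ pierced) (not-vert (kindOf i) (b i) v a h e)

   module _ (v : Fin 8) (a : Fin 3) (h : Fin 8 × Fin 3) (e : Net.link netY v a ≡ inj₁ h) (w : Bool) (L E : List C)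
            (ok : ChainOk w (Net.label netY v a) L E) (k99 : kf99 L) (nz : ∀ j → colour L j ≢ c0)
            (j₀ : Fin (suc (suc m))) (t : ℕ) (t≤m : t ≤ m) where
     open ChainOk ok
     private
       l = Net.label netY v a
       Zy : ℕ → ℕ → Set
       Zy j l' = j ≡ toℕ j₀ × l' ≡ l
       Z : Blk → ℕ → Set
       Z y l' = y ≡ inj₂ j₀ × l' ≡ l
       S : ℕ → Fin 3 → Fin 3 → Set
       S j r r' = j ≤ suc m → Sol netY fine (colour (sides (colour L) r r') ∘ toℕ) (Zy j)

     plain : ∀ j r r' → sidesOk L r r' ≡ true → S j r r'
     plain j r r' o _ = Sol-map (λ _ _ → refl) (λ l ()) (sides-sol L r r' o)

     holed : ∀ r r' → same 6 E (sides (colour L) r r') ≡ true → S (toℕ j₀) r r'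
     holed r r' s _ = Sol-map (λ p _ → same-sound 6 E (sides (colour L) r r') s p) (λ l z → refl , ≡ᵇ-sound z) (entry-sol netY fine (_≡ᵇ l) E entry)

     chain-at : (∀ j → j < t → S j first' first') → S t first' mid → S (suc t) mid last' → GoodAt proper ((inj₂ j₀ , v) , a)
     chain-at pre s₁ s₂ = inner-good t t≤m (colour L) Z sol (inj₂ j₀) v a h e apartY nz (λ y l z → z)
       where
       open Assemble m b t t≤m
       open Blocks fine (colour L) k99
       sol : ∀ x → Sol (net x) fine (λ p → colour L (pname (x , p))) (Z x)
       sol (inj₁ i) = Sol-map (λ _ _ → refl) (λ l ()) (fixed-sol libP libQ libY fillsP fillsQ 45 blocks i (λ q → <-irrefl q (toℕ<n i)))
       sol (inj₂ j) = Sol-map (λ _ _ → refl) (λ { l (z , z') → cong inj₂ (toℕ-injective z) , z' })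
         (chain-sol Zy pre s₁ s₂ (λ j _ → plain j last' last' ll) j)

   chain-zero : ∀ v a h (e : Net.link netY v a ≡ inj₁ h) L E → ChainOk false (Net.label netY v a) L E → kf99 L → (∀ j → colour L j ≢ c0) → GoodAt proper ((inj₂ zero , v) , a)
   chain-zero v a h e L E ok k99 nz = chain-at v a h e false L E ok k99 nz zero 0 z≤n (λ j ()) (holed v a h e false L E ok k99 nz zero 0 z≤n first' mid (proj₁ ps))
       (plain v a h e false L E ok k99 nz zero 0 z≤n 1 mid last' (proj₂ ps))
     where ps = split-pos₀ L E (ChainOk.pos ok)

   chain-suc : ∀ v a h (e : Net.link netY v a ≡ inj₁ h) L E → ChainOk true (Net.label netY v a) L E → kf99 L → (∀ j → colour L j ≢ c0) → ∀ j → GoodAt proper ((inj₂ (suc j) , v) , a)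
   chain-suc v a h e L E ok k99 nz j = chain-at v a h e true L E ok k99 nz (suc j) (toℕ j) t≤m
       (λ j' _ → plain v a h e true L E ok k99 nz (suc j) (toℕ j) t≤m j' first' first' (proj₂ (proj₂ ps)))
       (plain v a h e true L E ok k99 nz (suc j) (toℕ j) t≤m (toℕ j) first' mid (proj₁ (proj₂ ps))) (holed v a h e true L E ok k99 nz (suc j) (toℕ j) t≤m mid last' (proj₁ ps))
     where
     t≤m = s≤s⁻¹ (toℕ<n j)
     ps = split-pos₁ L E (ChainOk.pos ok)

   chain-good : ∀ j v a h → Net.link netY v a ≡ inj₁ h → GoodAt proper ((inj₂ j , v) , a)
   chain-good zero v a h e = chain-zero v a h e (flowOf chainFlows n) (chainEntry n) ok refl (nonzero-all chainFlows n (ChainOk.only ok))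
     where
     n : ℕ
     n = chainIx false (Net.label netY v a)
     ok : ChainOk false (Net.label netY v a) (flowOf chainFlows n) (chainEntry n)
     ok = chain-ok false v a h e
   chain-good (suc j) v a h e = chain-suc v a h e (flowOf chainFlows n) (chainEntry n) ok refl (nonzero-all chainFlows n (ChainOk.only ok)) j
     where
     n : ℕ
     n = chainIx true (Net.label netY v a)
     ok : ChainOk true (Net.label netY v a) (flowOf chainFlows n) (chainEntry n)
     ok = chain-ok true v a h e

   good-at : ∀ h → GoodAt proper h
   good-at ((x , v) , a) = go x v (N.link x v a) refl
     where
     go : ∀ x v s → N.link x v a ≡ s → GoodAt proper ((x , v) , a)
     go x v (inj₂ p) e = let (at' , r , _) = N.link-port x v a p e in
       subst (GoodAt proper) (cong (λ h → (x , proj₁ h) , proj₂ h) at') (port-good x p r)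
     go (inj₁ i) v (inj₁ h) e = slot-good i v a h e
     go (inj₂ j) v (inj₁ h) e = chain-good j v a h e

   four-good : Σ (H → C) λ F → (∀ h → F (opp h) ≡ F h) × (∀ w → distinct (F (w , i0)) (F (w , i1)) (F (w , i2)) ≡ true)
   four-good = F , F-opp , F-fits
     where
     open Assemble m b 0 z≤n
     open Blocks distinct (colour fourFlow) refl
     fill : ∀ r r' → okSides distinct clearP' clearQ' clearY' (colour fourFlow) r r' ≡ true → Sol netY distinct (colour (sides (colour fourFlow) r r') ∘ toℕ) (λ _ → ⊤)
     fill r r' e = Sol-map (λ _ _ → refl) (λ l ()) (Fills.fill fillsY₄ (sides (colour fourFlow) r r') e)
     rest = &-snd {okSides distinct clearP' clearQ' clearY' (colour fourFlow) first' mid} fourSides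
     fixedᵢ : ∀ i → Dec (i ≡ suc zero) → Sol (net (inj₁ i)) distinct (λ p → colour fourFlow (name i p)) (λ _ → ⊤)
     fixedᵢ i (yes refl) = Sol-map (λ p _ → trans (same-sound 6 (shape true) (map (colour fourFlow) (nth [] names 1)) refl p) (colour-map (colour fourFlow) refl (nth [] names 1) (toℕ p))) (λ _ _ → tt) (fourK (b (suc zero)))
     fixedᵢ i (no ne) = Sol-map (λ _ _ → refl) (λ l ()) (fixed-sol clearP' clearQ' clearY' fillsP₄ fillsQ₄ 1 fourBlocks i (λ q → ne (toℕ-injective q)))
     sol : ∀ x → Sol (net x) distinct (λ p → colour fourFlow (pname (x , p))) (λ _ → ⊤)
     sol (inj₁ i) = fixedᵢ i (i Fin.≟ suc zero)
     sol (inj₂ j) = chain-sol (λ _ _ → ⊤) (λ j ()) (λ _ → fill first' mid (&-fst fourSides)) (λ _ → fill mid last' (&-fst rest))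
       (λ _ _ _ → fill last' last' (&-snd {okSides distinct clearP' clearQ' clearY' (colour fourFlow) mid last'} rest)) j
     open Paint distinct (colour fourFlow) (λ _ _ → ⊤) sol

module Assembly where
 open import Defs
 open Gluing
 open HalfEdgeGraphs
 open Network
 open CutTable
 open CutBound
 open ColourTable using (diffC; eqC-sound; colourTable)
 open Uncolourability
 open Flows
 open import Data.Nat using (ℕ; zero; suc; _+_; _*_; _∸_; _≤_; _≡ᵇ_)
 open import Data.Nat.Properties using (≤-trans; m≤m+n; +-assoc; *-assoc; *-distribʳ-+; *-cancelʳ-≤; m+[n∸m]≡n)
 open import Data.Nat.Divisibility using (_∣_; divides)
 open import Data.Nat.DivMod using (_divMod_; result; DivMod)
 open import Data.Bool using (Bool; true; false; not)
 open import Data.Fin using (Fin; zero; suc; toℕ)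
 open import Data.List using (List; []; _∷_; _++_)
 open import Data.Product using (Σ; _×_; _,_; proj₁; proj₂)
 open import Data.Sum using (inj₁; inj₂)
 open import Data.Empty using (⊥)
 open import Function using (_∘_)
 open import Relation.Binary.PropositionalEquality

 -- From half-edges to graphs, and all even orders.

 record CutCheck : Set where
   open Engine eqB eqB-sound diffB
   field
     tableP tableQ tableY : List St
     isP : Local.table-of eqB eqB-sound diffB vertexTable netP sweepP finalP ≡ tableP
     isQ : Local.table-of eqB eqB-sound diffB vertexTable netQ sweepQ finalQ ≡ tableQ
     isY : Local.table-of eqB eqB-sound diffB vertexTable netY sweepY finalY ≡ tableY
     holds : Fixed.verdict (Fixed.chainInv (tidy (tableP ++ tableQ)) tableY) tableY ≡ true

 record ColourCheck : Set where
   open Engine eqC eqC-sound diffC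
   field
     carriesP : Carries netP
     carriesQ : Carries netQ
     tableY : List St
     isY : Local.table-of eqC eqC-sound diffC colourTable netY sweepY finalY ≡ tableY
     holds : colourVerdict tableY ≡ true

 module Construction (cut : CutCheck) (col : ColourCheck) (m : ℕ) (b : Fin 45 → Bool) where
   open Chain (suc m) b

   fromV-inj : ∀ {v w} → fromV v ≡ fromV w → v ≡ w
   fromV-inj {v} {w} e = trans (sym (toV-fromV v)) (trans (cong toV e) (toV-fromV w))

   toV-inj : ∀ {x y} → toV x ≡ toV y → x ≡ y
   toV-inj {x} {y} e = trans (sym (fromV-toV x)) (trans (cong fromV e) (fromV-toV y))

   down : H → Fin order × Fin 3
   down (v , a) = fromV v , a

   up : Fin order × Fin 3 → H
   up (x , a) = toV x , a

   up-down : ∀ h → up (down h) ≡ h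
   up-down (v , a) = cong (_, a) (toV-fromV v)

   opp′ : Fin order × Fin 3 → Fin order × Fin 3
   opp′ = down ∘ opp ∘ up

   opp′-inv : ∀ h → opp′ (opp′ h) ≡ h
   opp′-inv h = trans (cong (down ∘ opp) (up-down (opp (up h)))) (trans (cong down (opp-inv (up h))) (cong (_, proj₂ h) (fromV-toV (proj₁ h))))

   module _ (large : 12 ≤ order) where
     open HalfEdges order opp′ opp′-inv large

     module _ (S : Fin order → Bool) where
       private
         module B = CutTables.CutSize (CutCheck.tableP cut) (CutCheck.tableQ cut) (CutCheck.tableY cut) (CutCheck.isP cut) (CutCheck.isQ cut) (CutCheck.isY cut) m b

         leaves : ∀ v → leave S (fromV v) i0 + (leave S (fromV v) i1 + leave S (fromV v) i2) ≡ B.lv (S ∘ fromV) v i0 + (B.lv (S ∘ fromV) v i1 + B.lv (S ∘ fromV) v i2)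
         leaves v = cong (λ w → exits w i0 + (exits w i1 + exits w i2)) (toV-fromV v)
           where
           exits : V → Fin 3 → ℕ
           exits w a = b2n (S (fromV v) ∧ not (S (fromV (proj₁ (opp (w , a))))))

       bound : Bound (boundary S) (size S) (size (not ∘ S))
       bound = subst₂ (λ k s → Bound k s (size (not ∘ S))) (sym cost) (sym (sum-V (b2n ∘ S)))
         (subst (Bound _ _) (sym (sum-V (b2n ∘ not ∘ S)))
           (B.bound (S ∘ fromV) (Fixed.chainInv (Engine.tidy eqB eqB-sound diffB (CutCheck.tableP cut ++ CutCheck.tableQ cut)) (CutCheck.tableY cut)) refl (CutCheck.holds cut)))
         where
         cost : boundary S ≡ sumFin (B.costF (S ∘ fromV)) + sumFin (B.costY (S ∘ fromV))
         cost = trans (sum-V (λ u → leave S u i0 + (leave S u i1 + leave S u i2)))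
           (cong₂ _+_ (sumFin-cong λ i → sumFin-cong λ v → leaves (inj₁ i , v)) (sumFin-cong λ j → sumFin-cong λ v → leaves (inj₂ j , v)))

     open Tight bound

     module U = Uncolourable (ColourCheck.carriesP col) (ColourCheck.carriesQ col) (ColourCheck.tableY col) (ColourCheck.isY col) m b

     tag : Blk → ℕ
     tag (inj₁ i) = toℕ i
     tag (inj₂ _) = 99

     near : V → Fin 3 → ℕ
     near v a = tag (proj₁ (proj₁ (opp (v , a))))

     -- Distance between `s` and `t` is read off the pieces in which their neighbours lie: these
     -- depend neither on the fillings nor on the length of the chain, and no piece occurs for both
     -- vertices.
     far : allFin? 3 (λ a → allFin? 3 λ c → not (near U.s a ≡ᵇ near U.t c)) ≡ true
     far = refl

     s≢t : fromV U.s ≢ fromV U.t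
     s≢t e = case-0≡14 (cong (tag ∘ proj₁) (fromV-inj {U.s} {U.t} e))
       where
       case-0≡14 : 0 ≡ 14 → ⊥
       case-0≡14 ()

     from-end : ∀ x a v → nbr x a ≡ fromV v → Σ (Fin 3) λ c → proj₁ (opp (v , c)) ≡ toV x
     from-end x a v e = proj₂ (opp (toV x , a)) , trans (cong (λ w → proj₁ (opp (w , proj₂ (opp (toV x , a))))) (sym (fromV-inj {proj₁ (opp (toV x , a))} {v} e))) (cong proj₁ (opp-inv (toV x , a)))

     apart-st : ∀ x a c → nbr x a ≡ fromV U.s → nbr x c ≡ fromV U.t → ⊥
     apart-st x a c e f = differ (near U.s (proj₁ p)) (near U.t (proj₁ q))
         (allFin-sound 3 (λ c → not (near U.s (proj₁ p) ≡ᵇ near U.t c)) (allFin-sound 3 (λ a → allFin? 3 λ c → not (near U.s a ≡ᵇ near U.t c)) far (proj₁ p)) (proj₁ q))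
         (cong (tag ∘ proj₁) (trans (proj₂ p) (sym (proj₂ q))))
       where
       p = from-end x a U.s e
       q = from-end x c U.t f
       same-tag : ∀ k → not (k ≡ᵇ k) ≡ true → ⊥
       same-tag zero ()
       same-tag (suc k) e = same-tag k e
       differ : ∀ k l → not (k ≡ᵇ l) ≡ true → k ≡ l → ⊥
       differ k .k e refl = same-tag k e

     stuck-st : ∀ F → Consistent F → (∀ x → x ≢ fromV U.s → x ≢ fromV U.t → around proper F x ≡ true) → ⊥
     stuck-st F con ok = U.stuck (F ∘ down) (λ h → trans (cong (F ∘ down ∘ opp) (sym (up-down h))) (con (down h)))
       (λ v p q → ok (fromV v) (p ∘ fromV-inj) (q ∘ fromV-inj)) (ColourCheck.holds col)

     open Colour₃ (fromV U.s) (fromV U.t) s≢t apart-st stuck-st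
     open Final m b

     con-up : ∀ (F : H → C) → (∀ h → F (opp h) ≡ F h) → Consistent (F ∘ up)
     con-up F con h = trans (cong F (up-down (opp (up h)))) (con (up h))

     flows : ∀ u a → Σ (Half → C) λ F → Consistent F × (∀ x → x ≢ u → x ≢ nbr u a → around proper F x ≡ true)
     flows u a = let (F , con , ok) = good-at (toV u , a) in
       F ∘ up , con-up F con , λ x p q → ok (toV x) (p ∘ toV-inj) (λ e → q (trans (sym (fromV-toV x)) (cong fromV e)))

     four : Σ (Half → C) λ F → Consistent F × (∀ x → around distinct F x ≡ true)
     four = let (F , con , ok) = four-good in F ∘ up , con-up F con , ok ∘ toV

     strict-snark : Σ (Graph order) λ G → CyclicallyConnected 6 G × StrictlyCritical G
     strict-snark = graph , strictly-critical flows four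

 -- Replacing the cut J5 by the cut double-star snark adds ten vertices; the lists do this in the
 -- pieces 1, 3 and 6 in turn. The orders 300, 310, 320, 330 represent the four even residues modulo
 -- eight, the size of a chain block.
 doubles : Fin 4 → Fin 45 → Bool
 doubles ρ i = nth false (nth [] ((false ∷ []) ∷ (false ∷ true ∷ []) ∷ (false ∷ true ∷ false ∷ true ∷ []) ∷ (false ∷ true ∷ false ∷ true ∷ false ∷ false ∷ true ∷ []) ∷ []) (toℕ ρ)) (toℕ i)

 eights : ∀ n → sumFin {n} (λ _ → 8) ≡ n * 8
 eights zero = refl
 eights (suc n) = cong (8 +_) (eights n)

 order-at : ℕ → Fin 4 → ℕ
 order-at m ρ = Chain.order (suc m) (doubles ρ)

 order-is : ∀ m ρ c → sumFin (Chain.sizeF (suc m) (doubles ρ)) ≡ c → order-at m ρ ≡ c + (2 + m) * 8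
 order-is m ρ c e = cong₂ _+_ e (eights (2 + m))

 arith : ∀ c i d r q → c + i * 8 ≡ (d + r) * 2 → c + (i + q) * 8 ≡ (d + (r + q * 4)) * 2
 arith c i d r q e = begin
   c + (i + q) * 8 ≡⟨ cong (c +_) (*-distribʳ-+ 8 i q) ⟩
   c + (i * 8 + q * 8) ≡⟨ sym (+-assoc c (i * 8) (q * 8)) ⟩
   c + i * 8 + q * 8 ≡⟨ cong₂ _+_ e (sym (*-assoc q 4 2)) ⟩
   (d + r) * 2 + q * 4 * 2 ≡⟨ sym (*-distribʳ-+ 2 (d + r) (q * 4)) ⟩
   (d + r + q * 4) * 2 ≡⟨ cong (_* 2) (+-assoc d r (q * 4)) ⟩
   (d + (r + q * 4)) * 2 ∎
   where open ≡-Reasoning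

 sizes : ∀ m → sumFin (Chain.sizeF (suc m) (doubles zero)) ≡ 300 × sumFin (Chain.sizeF (suc m) (doubles (suc zero))) ≡ 310
   × sumFin (Chain.sizeF (suc m) (doubles (suc (suc zero)))) ≡ 320 × sumFin (Chain.sizeF (suc m) (doubles (suc (suc (suc zero))))) ≡ 330
 sizes m = refl , refl , refl , refl

 -- The fixed part has 300 + 10ρ vertices and there are m + 2 blocks of 8 vertices.
 residue : ∀ k → Σ ℕ λ m → Σ (Fin 4) λ ρ → order-at m ρ ≡ (171 + k) * 2
 residue k = go (k divMod 4)
   where
   go : DivMod k 4 → Σ ℕ λ m → Σ (Fin 4) λ ρ → order-at m ρ ≡ (171 + k) * 2
   go (result q zero e) = 2 + q , suc zero , trans (order-is (2 + q) (suc zero) 310 (proj₁ (proj₂ (sizes (2 + q)))))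
     (trans (arith 310 4 171 0 q refl) (cong (λ k → (171 + k) * 2) (sym e)))
   go (result q (suc zero) e) = 1 + q , suc (suc zero) , trans (order-is (1 + q) (suc (suc zero)) 320 (proj₁ (proj₂ (proj₂ (sizes (1 + q))))))
     (trans (arith 320 3 171 1 q refl) (cong (λ k → (171 + k) * 2) (sym e)))
   go (result q (suc (suc zero)) e) = q , suc (suc (suc zero)) , trans (order-is q (suc (suc (suc zero))) 330 (proj₂ (proj₂ (proj₂ (sizes q)))))
     (trans (arith 330 2 171 2 q refl) (cong (λ k → (171 + k) * 2) (sym e)))
   go (result q (suc (suc (suc zero))) e) = 4 + q , zero , trans (order-is (4 + q) zero 300 (proj₁ (sizes (4 + q))))
     (trans (arith 300 6 171 3 q refl) (cong (λ k → (171 + k) * 2) (sym e)))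

 every-even : CutCheck → ColourCheck → ∀ n → 2 ∣ n → 342 ≤ n → Σ (Graph n) λ G → CyclicallyConnected 6 G × StrictlyCritical G
 every-even cut col n (divides k e) le = of-order (residue (k ∸ 171))
   where
   big : 171 + (k ∸ 171) ≡ k
   big = m+[n∸m]≡n (*-cancelʳ-≤ 171 k 2 (subst (342 ≤_) e le))
   twelve : 12 ≤ n
   twelve = ≤-trans (m≤m+n 12 330) le
   at-order : ∀ m ρ → order-at m ρ ≡ n → Σ (Graph n) λ G → CyclicallyConnected 6 G × StrictlyCritical G
   at-order m ρ p = subst (λ n → Σ (Graph n) λ G → CyclicallyConnected 6 G × StrictlyCritical G) p
     (Construction.strict-snark cut col m (doubles ρ) (subst (12 ≤_) (sym p) twelve))
   of-order : (Σ ℕ λ m → Σ (Fin 4) λ ρ → order-at m ρ ≡ (171 + (k ∸ 171)) * 2) → Σ (Graph n) λ G → CyclicallyConnected 6 G × StrictlyCritical G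
   of-order (m , ρ , p) = at-order m ρ (trans p (trans (cong (_* 2) big) (sym e)))

module Checks where
 open Gluing
 open HalfEdgeGraphs
 open Network
 open CutTable
 open ColourTable
 open Uncolourability
 open Assembly
 open import Relation.Binary.PropositionalEquality using (refl)

 -- The two finite verdicts, on cuts and on colourings.

 cut : CutCheck
 cut = record
   { tableP = Local.table-of eqB eqB-sound diffB vertexTable netP sweepP finalP ; isP = refl
   ; tableQ = Local.table-of eqB eqB-sound diffB vertexTable netQ sweepQ finalQ ; isQ = refl
   ; tableY = Local.table-of eqB eqB-sound diffB vertexTable netY sweepY finalY ; isY = refl
   ; holds = refl }

 colouring : ColourCheck
 colouring = record
   { carriesP = carry netP sweepP finalP carryP (Local.table-of eqC eqC-sound diffC colourTable netP sweepP finalP) refl refl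
   ; carriesQ = carry netQ sweepQ finalQ carryQ (Local.table-of eqC eqC-sound diffC colourTable netQ sweepQ finalQ) refl refl
   ; tableY = Local.table-of eqC eqC-sound diffC colourTable netY sweepY finalY ; isY = refl
   ; holds = refl }

theorem2 : (n : ℕ) → 2 ∣ n → 342 ≤ n →
  Σ (Graph n) λ G → CyclicallyConnected 6 G × StrictlyCritical G
theorem2 = Assembly.every-even Checks.cut Checks.colouring
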